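{- There exist absolute constants $c_1,c_2>0$ such that the following holds. Let $p$ be a prime and let $A\subseteq\mathbb{Z}_p$ be random, each $a\in\mathbb{Z}_p$ included independently with probability $q=1/\sqrt{p}$. Then, with probability tending to $1$ as $p\to\infty$, \[c_1\log p\le ap(A+A)\le c_2\log p.\]
   Context: $A+A=\{a+b:a,b\in A\}$. For $X\subseteq\mathbb{Z}_p$, $ap(X)$ denotes the maximum length $k$ of an arithmetic progression $b,b+d,\dots,b+(k-1)d$ (with $d\neq 0$) all of whose terms lie in $X$. -}

module Defs where

open import Data.Nat as ℕ using (ℕ; zero; suc; NonZero; _^_)
open import Data.Nat.DivMod using (_%_; m%n<n)
open import Data.Fin using (Fin; toℕ; fromℕ<)
open import Data.Fin.Subset using (Subset; _∈_; ∣_∣)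
open import Data.Bool using (true; false)
open import Data.Vec using (Vec; []; _∷_)
open import Data.List using (List; []; _∷_; map; _++_)
open import Data.Integer using (+_)
open import Data.Rational as ℚ using (ℚ; 0ℚ; 1ℚ; _≤_; _<_)
open import Data.Product using (Σ; _×_; _,_)
open import Data.Sum using (_⊎_)
open import Relation.Binary.PropositionalEquality using (_≡_; _≢_)

module _ (p : ℕ) .{{_ : NonZero p}} where

  [_]ₚ : ℕ → Fin p
  [ m ]ₚ = fromℕ< (m%n<n m p)

  _+ₚ_ : Fin p → Fin p → Fin p
  x +ₚ y = [ toℕ x ℕ.+ toℕ y ]ₚ

  apTerm : Fin p → Fin p → ℕ → Fin p
  apTerm b d i = [ toℕ b ℕ.+ i ℕ.* toℕ d ]ₚ

  SumSet : Subset p → Fin p → Set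
  SumSet A z = Σ (Fin p) λ a → Σ (Fin p) λ b → a ∈ A × b ∈ A × (a +ₚ b) ≡ z

  HasAP : (Fin p → Set) → ℕ → Set
  HasAP X k = Σ (Fin p) λ b → Σ (Fin p) λ d → toℕ d ≢ 0 ×
              ((i : ℕ) → i ℕ.< k → X (apTerm b d i))

  -- "ap(X) ≥ t" : some AP of length k ≥ t lies in X ;
  -- "ap(X) ≤ t" : every AP lying in X has length k ≤ t.
  -- With c₁ = a₁/b₁ and c₂ = a₂/b₂ (positive rationals) and log = log₂:
  --   c₁ log p ≤ k  ⇔  p^a₁ ≤ 2^(b₁ k)      and     k ≤ c₂ log p  ⇔  2^(b₂ k) ≤ p^a₂
  GoodEvent : (a₁ b₁ a₂ b₂ : ℕ) → Subset p → Set
  GoodEvent a₁ b₁ a₂ b₂ A =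
    (Σ ℕ λ k → (p ^ a₁ ℕ.≤ 2 ^ (b₁ ℕ.* k)) × HasAP (SumSet A) k) ×
    ((k : ℕ) → HasAP (SumSet A) k → 2 ^ (b₂ ℕ.* k) ℕ.≤ p ^ a₂)

-- The field Q(√p): the pair (x , y) denotes x + y √p.

record Q√ : Set where
  constructor _+√_
  field
    re : ℚ
    im : ℚ
open Q√ public

module _ (p : ℕ) where

  pℚ : ℚ
  pℚ = + p ℚ./ 1

  _⊕_ : Q√ → Q√ → Q√
  (x₁ +√ y₁) ⊕ (x₂ +√ y₂) = (x₁ ℚ.+ x₂) +√ (y₁ ℚ.+ y₂)

  _⊗_ : Q√ → Q√ → Q√
  (x₁ +√ y₁) ⊗ (x₂ +√ y₂) =
    (x₁ ℚ.* x₂ ℚ.+ pℚ ℚ.* (y₁ ℚ.* y₂)) +√ (x₁ ℚ.* y₂ ℚ.+ y₁ ℚ.* x₂)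

  pow√ : Q√ → ℕ → Q√
  pow√ z zero    = 1ℚ +√ 0ℚ
  pow√ z (suc n) = z ⊗ pow√ z n

  -- x + y √p ≥ 0 (real-number order, decided exactly via squares)
  Nonneg√ : Q√ → Set
  Nonneg√ (x +√ y) =
    (0ℚ ≤ x × 0ℚ ≤ y) ⊎
    (0ℚ ≤ x × y < 0ℚ × pℚ ℚ.* (y ℚ.* y) ≤ x ℚ.* x) ⊎
    (x < 0ℚ × 0ℚ < y × x ℚ.* x ≤ pℚ ℚ.* (y ℚ.* y))

  _≤√_ : Q√ → Q√ → Set
  z ≤√ w = Nonneg√ (w ⊕ ((ℚ.- re z) +√ (ℚ.- im z)))

module _ (p : ℕ) .{{_ : NonZero p}} where

  -- q = 1/√p = (1/p) √p
  qₚ : Q√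
  qₚ = 0ℚ +√ (+ 1 ℚ./ p)

  1-qₚ : Q√
  1-qₚ = 1ℚ +√ (ℚ.- (+ 1 ℚ./ p))

  -- probability that the random set equals A : q^|A| (1-q)^(p-|A|)
  weight : Subset p → Q√
  weight A = _⊗_ p (pow√ p qₚ ∣ A ∣) (pow√ p 1-qₚ (p ℕ.∸ ∣ A ∣))

  totalWeight : List (Subset p) → Q√
  totalWeight []       = 0ℚ +√ 0ℚ
  totalWeight (A ∷ As) = _⊕_ p (weight A) (totalWeight As)

{-# OPTIONS --safe #-}
module Submission where

-- Upper bound. Fix an arithmetic progression X of k ≈ C log p residues. Expose representations
-- t = a + b of the elements of X greedily, keeping the set V of summands exposed so far. The next
-- uncovered t has about p / 2 unordered representations, each contained in A with probability
-- q² = 1 / p, and a generic one covers nothing else, which costs a factor about 1 / 2 per element.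
-- The only other choices are O(k²) exceptional a, each costing a factor q; they cover at most 12
-- elements unless some translate of X meets A in 7 points, which has probability at most p k⁷ q⁷.
-- Hence P(X ⊆ A + A) ≤ (3/4)^k + p k⁷ q⁷, and the union bound over the p² progressions applies.
--
-- Lower bound. Expose A on [0, p/2) first and keep one element of A from every cell of length W that
-- it hits, the cells being separated by gaps of length W. There are n ≫ √p such elements a with high
-- probability (exponential moment), and the residues y - a with 0 ≤ y < W are pairwise distinct and
-- not yet exposed. So the events y ∈ A + A are then implied by independent events of probability
-- 1 - (1-q)^n ≥ 2⁻⁹, and one of 2^(10k) disjoint intervals of length k in [0, W) is contained in A + A
-- with high probability.

open import Defs
open import Level using (0ℓ)
open import Algebra.Bundles using (CommutativeRing)
open import Algebra.Structures using (IsCommutativeRing)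
open import Data.Nat as ℕ using (ℕ; zero; suc; NonZero)
import Data.Nat.Properties as ℕP
open import Data.Nat.DivMod using (m%n<n; m≡m%n+[m/n]*n; m<n⇒m%n≡m; %-distribˡ-+; m%n%n≡m%n; [m+n]%n≡m%n; m<n*o⇒m/o<n; m*n/n≡m; /-mono-≤; /-monoˡ-≤; m/n*n≤m)
open import Data.Nat.Divisibility using (_∣_; divides; >⇒∤)
open import Data.Nat.Primality using (Prime; prime⇒nonZero; euclidsLemma)
open import Data.Nat.Tactic.RingSolver using (solve-∀)
import Data.Integer as ℤ
import Data.Integer.Properties as ℤP
open import Data.Rational as ℚ using (ℚ; 0ℚ; 1ℚ; mkℚ; toℚᵘ)
import Data.Rational.Properties as ℚP
import Data.Rational.Unnormalised as ℚᵘ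
import Data.Rational.Unnormalised.Properties as ℚᵘP
open import Data.Rational.Solver using (module +-*-Solver)
open import Data.Bool using (Bool; true; false; if_then_else_)
import Data.Bool.Properties as BoolP
open import Data.Fin as Fin using (Fin; zero; suc; toℕ)
import Data.Fin.Properties as FinP
open import Data.Fin.Subset using (Subset; _∈_; ∣_∣)
open import Data.Fin.Subset.Properties using (_∈?_; ∣p∣≤n)
open import Data.Vec using ([]; _∷_; lookup; tabulate)
import Data.Vec.Properties as VecP
open import Data.List using (List; []; _∷_; _++_; map; filter; length; upTo; applyUpTo; allFin; concatMap; cartesianProductWith)
import Data.List.Properties as ListP
open import Data.List.Relation.Unary.All as All using (All; []; _∷_)
import Data.List.Relation.Unary.All.Properties as AllP
open import Data.List.Relation.Unary.Any as Any using (Any; here; there)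
open import Data.List.Relation.Unary.AllPairs as AllPairs using ([]; _∷_)
open import Data.List.Relation.Unary.Unique.Propositional using (Unique)
import Data.List.Relation.Unary.Unique.Propositional.Properties as UniqueP
open import Data.List.Membership.Propositional using (lose; find) renaming (_∈_ to _∈ₗ_; _∉_ to _∉ₗ_)
open import Data.List.Membership.Propositional.Properties
  using (∈-++⁺ˡ; ∈-++⁺ʳ; ∈-map⁺; ∈-map⁻; ∈-upTo⁺; ∈-upTo⁻; ∈-allFin; ∈-concatMap⁺; ∈-cartesianProductWith⁺; ∈-filter⁻)
open import Data.List.Relation.Binary.Sublist.Propositional using (_⊆_; _∷ʳ_; ⊆-trans; ⊆-refl)
open import Data.List.Relation.Binary.Sublist.Propositional.Properties using (filter-⊆; filter⁺; length-mono-≤)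
open import Data.Product using (Σ; _×_; _,_; proj₁; proj₂)
open import Data.Sum using (_⊎_; inj₁; inj₂)
open import Data.Unit using (⊤; tt)
open import Data.Empty using (⊥; ⊥-elim)
open import Function using (_∘_; case_of_)
open import Relation.Nullary using (Dec; yes; no; ¬_; does)
open import Relation.Nullary.Decidable using (_×-dec_; _⊎-dec_; ¬?; dec-true; dec-false; decidable-stable)
open import Relation.Unary using (Decidable)
open import Relation.Binary.Bundles using (Preorder)
open import Relation.Binary.Definitions using (tri<; tri≈; tri>)
open import Relation.Binary.PropositionalEquality using (_≡_; _≢_; refl; sym; trans; cong; cong₂; subst; subst₂; isEquivalence; module ≡-Reasoning)

-- Ordered commutative rings

-- Different residues do not enter A + A independently, because one element of `A` can serve many
-- sums. For the upper bound every exposed summand must therefore be charged only once; for the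
-- lower bound no coordinate of the second stage may be read twice. The 7 is the least exponent for
-- which p³ q⁷ tends to 0: one factor p comes from the translates and two from the progressions. The
-- 12 is 6 + 6, for the two summands exposed together. With the rate 3/4 the generic choices spend
-- (p/2) · q² · (4/3), about 2/3, of what a step may cost; the remaining third has to pay for O(k²)
-- exceptional choices of weight q (4/3)^12, which tends to 0. As q = 1/√p is irrational,
-- probabilities are exact elements of ℚ(√p), and the argument runs over an abstract ordered ring.
-- Exponential estimates are replaced by Bernoulli's inequality in the form (1 - x)^n (1 + n x) ≤ 1,
-- comparisons of q with integers by comparisons of squares, and quotients by products with a
-- cleared denominator.

record OrderedRing : Set₁ where
  infixl 6 _+_
  infixl 7 _*_
  infix  8 -_
  field
    Carrier : Set
    _+_ _*_ : Carrier → Carrier → Carrier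
    -_ : Carrier → Carrier
    0# 1# : Carrier
    isCommutativeRing : IsCommutativeRing _≡_ _+_ _*_ -_ 0# 1#
    Nonneg : Carrier → Set
    nonneg-0 : Nonneg 0#
    nonneg-1 : Nonneg 1#
    nonneg-+ : ∀ {x y} → Nonneg x → Nonneg y → Nonneg (x + y)
    nonneg-* : ∀ {x y} → Nonneg x → Nonneg y → Nonneg (x * y)

  commutativeRing : CommutativeRing 0ℓ 0ℓ
  commutativeRing = record { isCommutativeRing = isCommutativeRing }

module OrderedRingProperties (R : OrderedRing) where
  open OrderedRing R using (Nonneg; nonneg-0; nonneg-1; nonneg-+; nonneg-*; commutativeRing) public
  open CommutativeRing commutativeRing
    using (Carrier; _+_; _*_; -_; 0#; 1#; commutativeSemiring; -‿inverseʳ;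
           +-assoc; +-comm; +-identityˡ; +-identityʳ; *-assoc; *-comm; *-identityˡ; *-identityʳ;
           distribˡ; distribʳ; zeroˡ; zeroʳ) public
  open import Algebra.Solver.Ring.NaturalCoefficients.Default commutativeSemiring public
    using (solve; _:=_; _:+_; _:*_; con)
  open import Algebra.Properties.Ring (CommutativeRing.ring commutativeRing) public
    using () renaming (+-cancelʳ to +-cancelʳ-≡)
  open import Algebra.Properties.CommutativeSemiring.Exp commutativeSemiring public
    using (_^_; ^-homo-*; ^-assocʳ; ^-distrib-*)

  infix 4 _≲_

  -- Storing the difference turns an inequality into an equation without subtraction, which the
  -- natural-coefficient solver can rearrange.
  record _≲_ (x y : Carrier) : Set where
    no-eta-equality
    pattern
    constructor gap
    field
      diff    : Carrier
      nonneg  : Nonneg diff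
      +diff≡  : x + diff ≡ y

  open _≲_ public

  ≲-reflexive : ∀ {x y} → x ≡ y → x ≲ y
  ≲-reflexive refl = gap 0# nonneg-0 (+-identityʳ _)

  ≲-refl : ∀ {x} → x ≲ x
  ≲-refl = ≲-reflexive refl

  ≲-trans : ∀ {x y z} → x ≲ y → y ≲ z → x ≲ z
  ≲-trans {x} (gap c c≥0 refl) (gap d d≥0 refl) =
    gap (c + d) (nonneg-+ c≥0 d≥0) (sym (+-assoc x c d))

  ≲-respʳ : ∀ {x y z} → y ≡ z → x ≲ y → x ≲ z
  ≲-respʳ refl p = p

  ≲-respˡ : ∀ {x y z} → x ≡ y → x ≲ z → y ≲ z
  ≲-respˡ refl p = p

  ≲-preorder : Preorder 0ℓ 0ℓ 0ℓ
  ≲-preorder = record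
    { _≈_ = _≡_ ; _≲_ = _≲_
    ; isPreorder = record
      { isEquivalence = isEquivalence ; reflexive = ≲-reflexive ; trans = ≲-trans } }

  module ≲-Reasoning where
    open import Relation.Binary.Reasoning.Preorder ≲-preorder public

  0≲ : ∀ {x} → Nonneg x → 0# ≲ x
  0≲ x≥0 = gap _ x≥0 (+-identityˡ _)

  nonneg⁻ : ∀ {x} → 0# ≲ x → Nonneg x
  nonneg⁻ (gap c c≥0 eq) = subst Nonneg (trans (sym (+-identityˡ c)) eq) c≥0

  0≲1 : 0# ≲ 1#
  0≲1 = 0≲ nonneg-1

  0≲* : ∀ {x y} → 0# ≲ x → 0# ≲ y → 0# ≲ x * y
  0≲* p q = 0≲ (nonneg-* (nonneg⁻ p) (nonneg⁻ q))

  0≲+ : ∀ {x y} → 0# ≲ x → 0# ≲ y → 0# ≲ x + y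
  0≲+ p q = 0≲ (nonneg-+ (nonneg⁻ p) (nonneg⁻ q))

  +-mono : ∀ {x y u v} → x ≲ y → u ≲ v → x + u ≲ y + v
  +-mono {x} {_} {u} (gap c c≥0 refl) (gap d d≥0 refl) = gap (c + d) (nonneg-+ c≥0 d≥0)
    (solve 4 (λ x c u d → (x :+ u) :+ (c :+ d) := (x :+ c) :+ (u :+ d)) refl x c u d)

  +-monoˡ : ∀ {x y} z → x ≲ y → x + z ≲ y + z
  +-monoˡ z p = +-mono p ≲-refl

  +-monoʳ : ∀ {x y} z → x ≲ y → z + x ≲ z + y
  +-monoʳ z p = +-mono ≲-refl p

  x≲x+y : ∀ {x y} → 0# ≲ y → x ≲ x + y
  x≲x+y 0≲y = gap _ (nonneg⁻ 0≲y) refl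

  x≲y+x : ∀ {x y} → 0# ≲ y → x ≲ y + x
  x≲y+x {x} {y} 0≲y = gap _ (nonneg⁻ 0≲y) (+-comm x y)

  +-cancelʳ : ∀ {x y} z → x + z ≲ y + z → x ≲ y
  +-cancelʳ {x} {y} z (gap c c≥0 eq) = gap c c≥0 (+-cancelʳ-≡ z (x + c) y
    (trans (solve 3 (λ x c z → (x :+ c) :+ z := (x :+ z) :+ c) refl x c z) eq))

  *-monoʳ : ∀ {x y} z → 0# ≲ z → x ≲ y → z * x ≲ z * y
  *-monoʳ {x} z z≥0 (gap c c≥0 refl) = gap (z * c) (nonneg-* (nonneg⁻ z≥0) c≥0) (sym (distribˡ z x c))

  *-monoˡ : ∀ {x y} z → 0# ≲ z → x ≲ y → x * z ≲ y * z
  *-monoˡ {x} {y} z z≥0 p = subst₂ _≲_ (*-comm z x) (*-comm z y) (*-monoʳ z z≥0 p)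

  *-mono : ∀ {x y u v} → 0# ≲ x → 0# ≲ v → x ≲ y → u ≲ v → x * u ≲ y * v
  *-mono {x} {v = v} x≥0 v≥0 p q = ≲-trans (*-monoʳ x x≥0 q) (*-monoˡ v v≥0 p)

  ^-nonneg : ∀ {x} n → 0# ≲ x → 0# ≲ x ^ n
  ^-nonneg zero    x≥0 = 0≲1
  ^-nonneg (suc n) x≥0 = 0≲* x≥0 (^-nonneg n x≥0)

  ^-monoˡ : ∀ {x y} n → 0# ≲ x → x ≲ y → x ^ n ≲ y ^ n
  ^-monoˡ zero    x≥0 p = ≲-refl
  ^-monoˡ (suc n) x≥0 p = *-mono x≥0 (^-nonneg n (≲-trans x≥0 p)) p (^-monoˡ n x≥0 p)

  1^n≡1 : ∀ n → 1# ^ n ≡ 1#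
  1^n≡1 zero    = refl
  1^n≡1 (suc n) = trans (*-identityˡ _) (1^n≡1 n)

  ^-upper : ∀ {x} n → 0# ≲ x → x ≲ 1# → x ^ n ≲ 1#
  ^-upper n x≥0 p = ≲-respʳ (1^n≡1 n) (^-monoˡ n x≥0 p)

  ^-lower : ∀ {x} n → 1# ≲ x → 1# ≲ x ^ n
  ^-lower n p = ≲-respˡ (1^n≡1 n) (^-monoˡ n 0≲1 p)

  ^-antitone : ∀ {x m n} → 0# ≲ x → x ≲ 1# → m ℕ.≤ n → x ^ n ≲ x ^ m
  ^-antitone {x} {m} {n} x≥0 x≤1 m≤n =
    subst₂ _≲_ (trans (sym (^-homo-* x m (n ℕ.∸ m))) (cong (x ^_) (ℕP.m+[n∸m]≡n m≤n))) (*-identityʳ _)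
      (*-monoʳ (x ^ m) (^-nonneg m x≥0) (^-upper (n ℕ.∸ m) x≥0 x≤1))

  1-_ : Carrier → Carrier
  1- x = 1# + - x

  x+1-x : ∀ x → x + 1- x ≡ 1#
  x+1-x x = trans (solve 3 (λ x o y → x :+ (o :+ y) := o :+ (x :+ y)) refl x 1# (- x))
    (trans (cong (1# +_) (-‿inverseʳ x)) (+-identityʳ 1#))

  1-nonneg : ∀ {x} → x ≲ 1# → 0# ≲ 1- x
  1-nonneg {x} p = +-cancelʳ x (subst₂ _≲_ (sym (+-identityˡ x)) (trans (sym (x+1-x x)) (+-comm x _)) p)

  1-upper : ∀ {x} → 0# ≲ x → 1- x ≲ 1#
  1-upper {x} p = ≲-respʳ (x+1-x x) (x≲y+x p)

  -- Opaque because literals as large as `⟦ 4 ℕ.^ 12 ⟧` occur and must not unfold into sums of ones.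
  opaque
    ⟦_⟧ : ℕ → Carrier
    ⟦ zero ⟧  = 0#
    ⟦ suc n ⟧ = 1# + ⟦ n ⟧

    ⟦0⟧ : ⟦ 0 ⟧ ≡ 0#
    ⟦0⟧ = refl

    ⟦suc⟧ : ∀ n → ⟦ suc n ⟧ ≡ 1# + ⟦ n ⟧
    ⟦suc⟧ n = refl

  ⟦1⟧ : ⟦ 1 ⟧ ≡ 1#
  ⟦1⟧ = trans (⟦suc⟧ 0) (trans (cong (1# +_) ⟦0⟧) (+-identityʳ 1#))

  ⟦+⟧ : ∀ m n → ⟦ m ℕ.+ n ⟧ ≡ ⟦ m ⟧ + ⟦ n ⟧
  ⟦+⟧ zero    n = trans (sym (+-identityˡ _)) (cong (_+ ⟦ n ⟧) (sym ⟦0⟧))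
  ⟦+⟧ (suc m) n = trans (⟦suc⟧ _) (trans (cong (1# +_) (⟦+⟧ m n))
    (trans (sym (+-assoc 1# _ _)) (cong (_+ ⟦ n ⟧) (sym (⟦suc⟧ m)))))

  ⟦*⟧ : ∀ m n → ⟦ m ℕ.* n ⟧ ≡ ⟦ m ⟧ * ⟦ n ⟧
  ⟦*⟧ zero    n = trans ⟦0⟧ (sym (trans (cong (_* ⟦ n ⟧) ⟦0⟧) (zeroˡ _)))
  ⟦*⟧ (suc m) n = trans (⟦+⟧ n (m ℕ.* n)) (trans (cong (⟦ n ⟧ +_) (⟦*⟧ m n))
    (trans (solve 2 (λ m n → n :+ m :* n := (con 1 :+ m) :* n) refl ⟦ m ⟧ ⟦ n ⟧)
           (cong (_* ⟦ n ⟧) (sym (⟦suc⟧ m)))))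

  ⟦^⟧ : ∀ m n → ⟦ m ℕ.^ n ⟧ ≡ ⟦ m ⟧ ^ n
  ⟦^⟧ m zero    = ⟦1⟧
  ⟦^⟧ m (suc n) = trans (⟦*⟧ m (m ℕ.^ n)) (cong (⟦ m ⟧ *_) (⟦^⟧ m n))

  ⟦⟧-nonneg : ∀ n → 0# ≲ ⟦ n ⟧
  ⟦⟧-nonneg zero    = ≲-reflexive (sym ⟦0⟧)
  ⟦⟧-nonneg (suc n) = ≲-respʳ (sym (⟦suc⟧ n)) (0≲+ 0≲1 (⟦⟧-nonneg n))

  ⟦⟧-mono : ∀ {m n} → m ℕ.≤ n → ⟦ m ⟧ ≲ ⟦ n ⟧
  ⟦⟧-mono {m} {n} m≤n = gap ⟦ n ℕ.∸ m ⟧ (nonneg⁻ (⟦⟧-nonneg _))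
    (trans (sym (⟦+⟧ m (n ℕ.∸ m))) (cong ⟦_⟧ (ℕP.m+[n∸m]≡n m≤n)))

  -- This is (1 - x)^n ≤ 1 / (1 + n x) with the denominator cleared, the substitute for exp(-n x).
  -- The induction works because y (1 + (n + 1) x) falls short of 1 + n x by exactly (n + 1) x².
  bernoulli : ∀ {x y} n → x + y ≡ 1# → 0# ≲ x → 0# ≲ y → y ^ n * (1# + ⟦ n ⟧ * x) ≲ 1#
  bernoulli {x} {y} zero eq x≥0 y≥0 = ≲-reflexive
    (trans (*-identityˡ _) (trans (cong (1# +_) (trans (cong (_* x) ⟦0⟧) (zeroˡ x))) (+-identityʳ 1#)))
  bernoulli {x} {y} (suc n) eq x≥0 y≥0 = ≲-trans (gap _ (nonneg⁻ (0≲* (^-nonneg n y≥0) gap≥0)) shift) (bernoulli n eq x≥0 y≥0)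
    where
    N = ⟦ n ⟧
    gap≥0 : 0# ≲ ⟦ n ⟧ * (x * x) + x * x
    gap≥0 = 0≲+ (0≲* (⟦⟧-nonneg n) (0≲* x≥0 x≥0)) (0≲* x≥0 x≥0)
    open ≡-Reasoning
    shift : y ^ suc n * (1# + ⟦ suc n ⟧ * x) + y ^ n * (N * (x * x) + x * x) ≡ y ^ n * (1# + N * x)
    shift = begin
      y ^ suc n * (1# + ⟦ suc n ⟧ * x) + y ^ n * (N * (x * x) + x * x)
        ≡⟨ cong (λ z → y ^ suc n * (1# + z * x) + y ^ n * (N * (x * x) + x * x)) (⟦suc⟧ n) ⟩
      y * y ^ n * (1# + (1# + N) * x) + y ^ n * (N * (x * x) + x * x)
        -- The factors `x + y` stand for 1; they absorb the terms that would otherwise be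
        -- subtracted.
        ≡⟨ solve 4 (λ y z N x → y :* z :* (con 1 :+ (con 1 :+ N) :* x) :+ z :* (N :* (x :* x) :+ x :* x)
                     := z :* ((x :+ y) :* (N :* x) :+ (x :+ y) :* x :+ y)) refl y (y ^ n) N x ⟩
      y ^ n * ((x + y) * (N * x) + (x + y) * x + y)
        ≡⟨ cong (λ s → y ^ n * (s * (N * x) + s * x + y)) eq ⟩
      y ^ n * (1# * (N * x) + 1# * x + y)
        ≡⟨ solve 4 (λ y z N x → z :* (con 1 :* (N :* x) :+ con 1 :* x :+ y)
                     := z :* ((x :+ y) :+ N :* x)) refl y (y ^ n) N x ⟩
      y ^ n * ((x + y) + N * x) ≡⟨ cong (λ s → y ^ n * (s + N * x)) eq ⟩
      y ^ n * (1# + N * x) ∎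

  module _ {I : Set} where

    sumOver : List I → (I → Carrier) → Carrier
    sumOver []      f = 0#
    sumOver (i ∷ L) f = f i + sumOver L f

    sumOver-upper : ∀ L {f : I → Carrier} {b} → (∀ i → i ∈ₗ L → f i ≲ b) → sumOver L f ≲ ⟦ length L ⟧ * b
    sumOver-upper [] {b = b} f≤b = ≲-reflexive (sym (trans (cong (_* b) ⟦0⟧) (zeroˡ _)))
    sumOver-upper (i ∷ L) {f} {b} f≤b = ≲-trans
      (+-mono (f≤b i (here refl)) (sumOver-upper L λ j j∈L → f≤b j (there j∈L)))
      (≲-reflexive (trans (solve 2 (λ b l → b :+ l :* b := (con 1 :+ l) :* b) refl b ⟦ length L ⟧)
        (cong (_* b) (sym (⟦suc⟧ (length L))))))

-- Random subsets

module Expectation (R : OrderedRing) (q : OrderedRing.Carrier R)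
                   (0≲q : OrderedRingProperties._≲_ R (OrderedRing.0# R) q)
                   (q≲1 : OrderedRingProperties._≲_ R q (OrderedRing.1# R)) where

  open OrderedRingProperties R

  private
    q̄ : Carrier
    q̄ = 1- q

    0≲q̄ : 0# ≲ q̄
    0≲q̄ = 1-nonneg q≲1

    q+q̄ : q + q̄ ≡ 1#
    q+q̄ = x+1-x q

    mix-const : ∀ c → q * c + q̄ * c ≡ c
    mix-const c = trans (sym (distribʳ c q q̄)) (trans (cong (_* c) q+q̄) (*-identityˡ c))

  -- Coordinates are integrated out one at a time, so that independence and two-stage exposure
  -- become plain inductions; `E-as-sum` recovers the weighted sum over all subsets.
  E : ∀ {n} → (Subset n → Carrier) → Carrier
  E {zero}  f = f []
  E {suc n} f = q * E (f ∘ (true ∷_)) + q̄ * E (f ∘ (false ∷_))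

  E-cong : ∀ {n} {f g : Subset n → Carrier} → (∀ A → f A ≡ g A) → E f ≡ E g
  E-cong {zero}  f≡g = f≡g []
  E-cong {suc n} f≡g = cong₂ (λ a b → q * a + q̄ * b) (E-cong (f≡g ∘ (true ∷_))) (E-cong (f≡g ∘ (false ∷_)))

  E-mono : ∀ {n} {f g : Subset n → Carrier} → (∀ A → f A ≲ g A) → E f ≲ E g
  E-mono {zero}  f≤g = f≤g []
  E-mono {suc n} f≤g = +-mono (*-monoʳ q 0≲q (E-mono (f≤g ∘ (true ∷_))))
                              (*-monoʳ q̄ 0≲q̄ (E-mono (f≤g ∘ (false ∷_))))

  E-const : ∀ n c → E {n} (λ _ → c) ≡ c
  E-const zero    c = refl
  E-const (suc n) c = trans (cong₂ (λ a b → q * a + q̄ * b) (E-const n c) (E-const n c)) (mix-const c)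

  E-+ : ∀ {n} (f g : Subset n → Carrier) → E (λ A → f A + g A) ≡ E f + E g
  E-+ {zero}  f g = refl
  E-+ {suc n} f g = trans (cong₂ (λ a b → q * a + q̄ * b) (E-+ (f ∘ (true ∷_)) (g ∘ (true ∷_)))
                                                          (E-+ (f ∘ (false ∷_)) (g ∘ (false ∷_))))
    (solve 6 (λ q r a b c d → q :* (a :+ b) :+ r :* (c :+ d) := (q :* a :+ r :* c) :+ (q :* b :+ r :* d))
      refl q q̄ _ _ _ _)

  E-* : ∀ {n} c (f : Subset n → Carrier) → E (λ A → c * f A) ≡ c * E f
  E-* {zero}  c f = refl
  E-* {suc n} c f = trans (cong₂ (λ a b → q * a + q̄ * b) (E-* c (f ∘ (true ∷_))) (E-* c (f ∘ (false ∷_))))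
    (solve 5 (λ q r c a b → q :* (c :* a) :+ r :* (c :* b) := c :* (q :* a :+ r :* b)) refl q q̄ c _ _)

  E-1- : ∀ {n} (f : Subset n → Carrier) → E (λ A → 1- f A) ≡ 1- E f
  E-1- {n} f = +-cancelʳ-≡ (E f) _ _ (begin
    E (λ A → 1- f A) + E f    ≡⟨ E-+ (λ A → 1- f A) f ⟨
    E (λ A → 1- f A + f A)    ≡⟨ E-cong (λ A → trans (+-comm _ _) (x+1-x (f A))) ⟩
    E {n} (λ _ → 1#)          ≡⟨ E-const n 1# ⟩
    1#                        ≡⟨ x+1-x (E f) ⟨
    E f + 1- E f              ≡⟨ +-comm _ _ ⟩
    1- E f + E f              ∎)
    where open ≡-Reasoning

  E-sumOver : ∀ {n} {I : Set} (L : List I) (f : I → Subset n → Carrier) →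
              E (λ A → sumOver L (λ i → f i A)) ≡ sumOver L (λ i → E (f i))
  E-sumOver {n} []      f = E-const n 0#
  E-sumOver     (i ∷ L) f = trans (E-+ (f i) _) (cong (E (f i) +_) (E-sumOver L f))

  _DependsOn_ : ∀ {n} → (Subset n → Carrier) → (Fin n → Set) → Set
  f DependsOn S = ∀ A B → (∀ i → S i → lookup A i ≡ lookup B i) → f A ≡ f B

  private
    ignores-head : ∀ {n} {f : Subset (suc n) → Carrier} {S : Fin (suc n) → Set} → f DependsOn S → ¬ S zero →
                   ∀ A → f (false ∷ A) ≡ f (true ∷ A)
    ignores-head dep 0∉S A = dep _ _ λ { zero s → ⊥-elim (0∉S s) ; (suc i) s → refl }

    tail-depends : ∀ {n} {f : Subset (suc n) → Carrier} {S : Fin (suc n) → Set} → f DependsOn S →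
                   ∀ b → (f ∘ (b ∷_)) DependsOn (S ∘ suc)
    tail-depends dep b A B eq = dep _ _ λ { zero s → refl ; (suc i) s → eq i s }

  -- By induction on the coordinates: the head coordinate is invisible to one of the two functions,
  -- which therefore comes out of the average over it.
  E-independent : ∀ {n} (S : Fin n → Bool) {f g : Subset n → Carrier} →
                  f DependsOn (λ i → S i ≡ true) → g DependsOn (λ i → S i ≡ false) →
                  E (λ A → f A * g A) ≡ E f * E g
  E-independent {zero}  S df dg = refl
  E-independent {suc n} S {f} {g} df dg
    with S zero in eq
       | E-independent (S ∘ suc) {f ∘ (true ∷_)}  {g ∘ (true ∷_)}  (tail-depends df true)  (tail-depends dg true)
       | E-independent (S ∘ suc) {f ∘ (false ∷_)} {g ∘ (false ∷_)} (tail-depends df false) (tail-depends dg false)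
  ... | true  | ih₁ | ih₀ = begin
      q * E (λ A → f (true ∷ A) * g (true ∷ A)) + q̄ * E (λ A → f (false ∷ A) * g (false ∷ A))
        ≡⟨ cong₂ (λ a b → q * a + q̄ * b) ih₁ (trans ih₀ (cong (E (f ∘ (false ∷_)) *_) g₀)) ⟩
      q * (F₁ * G) + q̄ * (F₀ * G)
        ≡⟨ solve 5 (λ q r a b c → q :* (a :* c) :+ r :* (b :* c) := (q :* a :+ r :* b) :* c) refl q q̄ F₁ F₀ G ⟩
      (q * F₁ + q̄ * F₀) * G
        ≡⟨ cong ((q * F₁ + q̄ * F₀) *_) (sym (mix-const G)) ⟩
      (q * F₁ + q̄ * F₀) * (q * G + q̄ * G)
        ≡⟨ cong (λ z → (q * F₁ + q̄ * F₀) * (q * G + q̄ * z)) (sym g₀) ⟩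
      E f * E g ∎
      where
      open ≡-Reasoning
      F₁ = E (f ∘ (true ∷_))
      F₀ = E (f ∘ (false ∷_))
      G  = E (g ∘ (true ∷_))
      g₀ : E (g ∘ (false ∷_)) ≡ E (g ∘ (true ∷_))
      g₀ = E-cong (ignores-head dg λ s → BoolP.not-¬ eq s)
  ... | false | ih₁ | ih₀ = begin
      q * E (λ A → f (true ∷ A) * g (true ∷ A)) + q̄ * E (λ A → f (false ∷ A) * g (false ∷ A))
        ≡⟨ cong₂ (λ a b → q * a + q̄ * b) ih₁ (trans ih₀ (cong (_* E (g ∘ (false ∷_))) f₀)) ⟩
      q * (F * G₁) + q̄ * (F * G₀)
        ≡⟨ solve 5 (λ q r a b c → q :* (c :* a) :+ r :* (c :* b) := c :* (q :* a :+ r :* b)) refl q q̄ G₁ G₀ F ⟩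
      F * (q * G₁ + q̄ * G₀)
        ≡⟨ cong (_* (q * G₁ + q̄ * G₀)) (sym (mix-const F)) ⟩
      (q * F + q̄ * F) * (q * G₁ + q̄ * G₀)
        ≡⟨ cong (λ z → (q * F + q̄ * z) * (q * G₁ + q̄ * G₀)) (sym f₀) ⟩
      E f * E g ∎
      where
      open ≡-Reasoning
      F  = E (f ∘ (true ∷_))
      G₁ = E (g ∘ (true ∷_))
      G₀ = E (g ∘ (false ∷_))
      f₀ : E (f ∘ (false ∷_)) ≡ E (f ∘ (true ∷_))
      f₀ = E-cong (ignores-head df λ s → BoolP.not-¬ eq s)

  merge : ∀ {n} → (Fin n → Bool) → Subset n → Subset n → Subset n
  merge S u v = tabulate λ i → if S i then lookup u i else lookup v i

  lookup-merge : ∀ {n} (S : Fin n → Bool) u v i →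
                 lookup (merge S u v) i ≡ (if S i then lookup u i else lookup v i)
  lookup-merge S u v i = VecP.lookup∘tabulate _ i

  -- Two-stage exposure: the coordinates in S are revealed first.
  E-merge : ∀ {n} (S : Fin n → Bool) (f : Subset n → Carrier) →
            E f ≡ E (λ u → E (λ v → f (merge S u v)))
  E-merge {zero}  S f = refl
  E-merge {suc n} S f with S zero
  ... | true  = cong₂ (λ a b → q * a + q̄ * b) (side true) (side false)
    where
    side : ∀ b → E (f ∘ (b ∷_)) ≡
           E (λ u → q * E (λ v → f (b ∷ merge (S ∘ suc) u v)) + q̄ * E (λ v → f (b ∷ merge (S ∘ suc) u v)))
    side b = trans (E-merge (S ∘ suc) (f ∘ (b ∷_))) (E-cong {n} λ u → sym (mix-const _))
  ... | false = begin
      q * E (f ∘ (true ∷_)) + q̄ * E (f ∘ (false ∷_))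
        ≡⟨ cong₂ (λ a b → q * a + q̄ * b) (E-merge (S ∘ suc) (f ∘ (true ∷_))) (E-merge (S ∘ suc) (f ∘ (false ∷_))) ⟩
      q * E (inner true) + q̄ * E (inner false)
        ≡⟨ cong₂ _+_ (sym (E-* q (inner true))) (sym (E-* q̄ (inner false))) ⟩
      E (λ u → q * inner true u) + E (λ u → q̄ * inner false u)
        ≡⟨ sym (E-+ (λ u → q * inner true u) (λ u → q̄ * inner false u)) ⟩
      E (λ u → q * inner true u + q̄ * inner false u)
        ≡⟨ sym (mix-const _) ⟩
      q * E (λ u → q * inner true u + q̄ * inner false u) + q̄ * E (λ u → q * inner true u + q̄ * inner false u) ∎
    where
    open ≡-Reasoning
    inner : Bool → Subset n → Carrier
    inner b u = E (λ v → f (b ∷ merge (S ∘ suc) u v))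

  ind : ∀ {P : Set} → Dec P → Carrier
  ind P? = if does P? then 1# else 0#

  ind-nonneg : ∀ {P : Set} (P? : Dec P) → 0# ≲ ind P?
  ind-nonneg (yes _) = 0≲1
  ind-nonneg (no _)  = ≲-refl

  ind-upper : ∀ {P : Set} (P? : Dec P) → ind P? ≲ 1#
  ind-upper (yes _) = ≲-refl
  ind-upper (no _)  = 0≲1

  ind-yes : ∀ {P : Set} (P? : Dec P) → P → ind P? ≡ 1#
  ind-yes (yes _) p = refl
  ind-yes (no ¬p) p = ⊥-elim (¬p p)

  ind-≲ : ∀ {P : Set} (P? : Dec P) {x} → 0# ≲ x → (P → 1# ≲ x) → ind P? ≲ x
  ind-≲ (yes p) 0≤x 1≤x = 1≤x p
  ind-≲ (no _)  0≤x 1≤x = 0≤x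

  Pr : ∀ {n} {Q : Subset n → Set} → Decidable Q → Carrier
  Pr Q? = E (λ A → ind (Q? A))

  module _ {n : ℕ} where

    Pr-mono : {Q Q′ : Subset n → Set} (Q? : Decidable Q) (Q′? : Decidable Q′) →
              (∀ A → Q A → Q′ A) → Pr Q? ≲ Pr Q′?
    Pr-mono Q? Q′? Q⇒Q′ = E-mono λ A → ind-≲ (Q? A) (ind-nonneg (Q′? A))
      λ QA → ≲-reflexive (sym (ind-yes (Q′? A) (Q⇒Q′ A QA)))

    Pr-impossible : {Q : Subset n → Set} (Q? : Decidable Q) → (∀ A → ¬ Q A) → Pr Q? ≲ 0#
    Pr-impossible Q? ¬Q = ≲-respʳ (E-const n 0#) (E-mono λ A → ind-≲ (Q? A) ≲-refl λ QA → ⊥-elim (¬Q A QA))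

    Pr-⊎ : {Q Q₁ Q₂ : Subset n → Set} (Q? : Decidable Q) (Q₁? : Decidable Q₁) (Q₂? : Decidable Q₂) →
           (∀ A → Q A → Q₁ A ⊎ Q₂ A) → Pr Q? ≲ Pr Q₁? + Pr Q₂?
    Pr-⊎ Q? Q₁? Q₂? split = ≲-respʳ (E-+ (λ A → ind (Q₁? A)) (λ A → ind (Q₂? A))) (E-mono λ A →
      ind-≲ (Q? A) (0≲+ (ind-nonneg (Q₁? A)) (ind-nonneg (Q₂? A))) λ QA → bound A (split A QA))
      where
      bound : ∀ A → _ ⊎ _ → 1# ≲ ind (Q₁? A) + ind (Q₂? A)
      bound A (inj₁ Q₁A) = ≲-respˡ (ind-yes (Q₁? A) Q₁A) (x≲x+y (ind-nonneg (Q₂? A)))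
      bound A (inj₂ Q₂A) = ≲-respˡ (ind-yes (Q₂? A) Q₂A) (x≲y+x (ind-nonneg (Q₁? A)))

    Pr-Any : {I : Set} (L : List I) {Q : Subset n → Set} (Q? : Decidable Q)
             {P : I → Subset n → Set} (P? : ∀ i → Decidable (P i)) →
             (∀ A → Q A → Any (λ i → P i A) L) → Pr Q? ≲ sumOver L (λ i → Pr (P? i))
    Pr-Any L Q? {P} P? cover = ≲-respʳ (E-sumOver L (λ i A → ind (P? i A))) (E-mono λ A →
      ind-≲ (Q? A) (sum-nonneg A L) λ QA → bound A L (cover A QA))
      where
      sum-nonneg : ∀ A L → 0# ≲ sumOver L (λ i → ind (P? i A))
      sum-nonneg A []      = ≲-refl
      sum-nonneg A (i ∷ L) = 0≲+ (ind-nonneg (P? i A)) (sum-nonneg A L)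
      bound : ∀ A L → Any (λ i → P i A) L → 1# ≲ sumOver L (λ i → ind (P? i A))
      bound A (i ∷ L) (here PA)  = ≲-respˡ (ind-yes (P? i A) PA) (x≲x+y (sum-nonneg A L))
      bound A (i ∷ L) (there PA) = ≲-trans (bound A L PA) (x≲y+x (ind-nonneg (P? i A)))

  -- Read-once polynomials in the indicators of membership

  data Poly (n : ℕ) : Set where
    const   : Carrier → Poly n
    var     : Fin n → Poly n
    compl   : Poly n → Poly n
    add mul : Poly n → Poly n → Poly n

  module _ {n : ℕ} where

    eval : Poly n → Subset n → Carrier
    eval (const c) A = c
    eval (var i)   A = if lookup A i then 1# else 0#
    eval (compl P) A = 1- eval P A
    eval (add P Q) A = eval P A + eval Q A
    eval (mul P Q) A = eval P A * eval Q A

    value : Poly n → Carrier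
    value (const c) = c
    value (var i)   = q
    value (compl P) = 1- value P
    value (add P Q) = value P + value Q
    value (mul P Q) = value P * value Q

    Occurs : Fin n → Poly n → Set
    Occurs i (const c) = ⊥
    Occurs i (var j)   = i ≡ j
    Occurs i (compl P) = Occurs i P
    Occurs i (add P Q) = Occurs i P ⊎ Occurs i Q
    Occurs i (mul P Q) = Occurs i P ⊎ Occurs i Q

    occurs? : ∀ i P → Dec (Occurs i P)
    occurs? i (const c) = no λ ()
    occurs? i (var j)   = i FinP.≟ j
    occurs? i (compl P) = occurs? i P
    occurs? i (add P Q) = occurs? i P ⊎-dec occurs? i Q
    occurs? i (mul P Q) = occurs? i P ⊎-dec occurs? i Q

    -- Only products need disjoint variables, since expectation respects sums and complements
    -- anyway; `E-eval` then evaluates by substituting `q` for every variable.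
    ReadOnce : Poly n → Set
    ReadOnce (const c) = ⊤
    ReadOnce (var i)   = ⊤
    ReadOnce (compl P) = ReadOnce P
    ReadOnce (add P Q) = ReadOnce P × ReadOnce Q
    ReadOnce (mul P Q) = ReadOnce P × ReadOnce Q × (∀ i → Occurs i P → ¬ Occurs i Q)

    eval-depends : ∀ P → eval P DependsOn (λ i → Occurs i P)
    eval-depends (const c) A B eq = refl
    eval-depends (var i)   A B eq = cong (if_then 1# else 0#) (eq i refl)
    eval-depends (compl P) A B eq = cong 1-_ (eval-depends P A B eq)
    eval-depends (add P Q) A B eq = cong₂ _+_ (eval-depends P A B λ i o → eq i (inj₁ o))
                                              (eval-depends Q A B λ i o → eq i (inj₂ o))
    eval-depends (mul P Q) A B eq = cong₂ _*_ (eval-depends P A B λ i o → eq i (inj₁ o))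
                                              (eval-depends Q A B λ i o → eq i (inj₂ o))

  E-var : ∀ {n} (i : Fin n) → E (eval (var i)) ≡ q
  E-var {suc n} zero = trans (cong₂ (λ a b → q * a + q̄ * b) (E-const n 1#) (E-const n 0#))
    (solve 2 (λ q r → q :* con 1 :+ r :* con 0 := q) refl q q̄)
  E-var {suc n} (suc i) = trans (cong₂ (λ a b → q * a + q̄ * b) (E-var i) (E-var i)) (mix-const q)

  E-eval : ∀ {n} (P : Poly n) → ReadOnce P → E (eval P) ≡ value P
  E-eval {n} (const c) _ = E-const n c
  E-eval (var i)   _ = E-var i
  E-eval (compl P) r = trans (E-1- (eval P)) (cong 1-_ (E-eval P r))
  E-eval (add P Q) (r , s) = trans (E-+ (eval P) (eval Q)) (cong₂ _+_ (E-eval P r) (E-eval Q s))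
  E-eval (mul P Q) (r , s , disjoint) = trans
    (E-independent (λ i → does (occurs? i P))
      (λ A B eq → eval-depends P A B λ i o → eq i (dec-true (occurs? i P) o))
      (λ A B eq → eval-depends Q A B λ i o → eq i (dec-false (occurs? i P) λ o′ → disjoint i o′ o)))
    (cong₂ _*_ (E-eval P r) (E-eval Q s))

  -- Carries the logical structure of an event, negations and conjunctions, over to a polynomial
  -- built with `compl` and `mul`.
  data Indicates (x : Carrier) (Q : Set) : Set where
    holds : Q → x ≡ 1# → Indicates x Q
    fails : ¬ Q → x ≡ 0# → Indicates x Q

  indicates-⇔ : ∀ {x} {Q Q′ : Set} → (Q → Q′) → (Q′ → Q) → Indicates x Q → Indicates x Q′
  indicates-⇔ f g (holds Q eq)  = holds (f Q) eq
  indicates-⇔ f g (fails ¬Q eq) = fails (¬Q ∘ g) eq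

  indicates-¬ : ∀ {x} {Q : Set} → Indicates x Q → Indicates (1- x) (¬ Q)
  indicates-¬ (holds Q refl)  = fails (λ ¬Q → ¬Q Q) (-‿inverseʳ 1#)
  indicates-¬ (fails ¬Q refl) = holds ¬Q (trans (sym (+-identityˡ _)) (x+1-x 0#))

  indicates-× : ∀ {x y} {Q Q′ : Set} → Indicates x Q → Indicates y Q′ → Indicates (x * y) (Q × Q′)
  indicates-× {y = y} (fails ¬Q refl) i = fails (¬Q ∘ proj₁) (zeroˡ y)
  indicates-× (holds Q refl) (holds Q′ refl)  = holds (Q , Q′) (*-identityˡ 1#)
  indicates-× (holds Q refl) (fails ¬Q′ refl) = fails (¬Q′ ∘ proj₂) (zeroʳ 1#)

  ind≡ : ∀ {x} {Q : Set} (Q? : Dec Q) → Indicates x Q → ind Q? ≡ x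
  ind≡ (yes Q)  (holds _ refl) = refl
  ind≡ (yes Q)  (fails ¬Q _)   = ⊥-elim (¬Q Q)
  ind≡ (no ¬Q)  (holds Q _)    = ⊥-elim (¬Q Q)
  ind≡ (no ¬Q)  (fails _ refl) = refl

  indicates-var : ∀ {n} (i : Fin n) A → Indicates (eval (var i) A) (i ∈ A)
  indicates-var i A with lookup A i in eq
  ... | true  = holds (VecP.lookup⇒[]= i A eq) refl
  ... | false = fails (λ i∈A → BoolP.not-¬ eq (VecP.[]=⇒lookup i∈A)) refl

  module _ {n : ℕ} {I : Set} where

    prod : List I → (I → Poly n) → Poly n
    prod []      f = const 1#
    prod (i ∷ L) f = mul (f i) (prod L f)

    occurs-prod : ∀ {c} L (f : I → Poly n) → Occurs c (prod L f) → Σ I λ i → i ∈ₗ L × Occurs c (f i)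
    occurs-prod (i ∷ L) f (inj₁ o) = i , here refl , o
    occurs-prod (i ∷ L) f (inj₂ o) = let j , j∈L , o′ = occurs-prod L f o in j , there j∈L , o′

    readOnce-prod : ∀ {L} {f : I → Poly n} → Unique L → (∀ i → i ∈ₗ L → ReadOnce (f i)) →
                    (∀ i j c → i ∈ₗ L → j ∈ₗ L → Occurs c (f i) → Occurs c (f j) → i ≡ j) → ReadOnce (prod L f)
    readOnce-prod {[]} _ _ _ = tt
    readOnce-prod {i ∷ L} {f} (i∉L ∷ uniq) ro disjoint =
      ro i (here refl) ,
      readOnce-prod uniq (λ j j∈L → ro j (there j∈L)) (λ j k c j∈L k∈L → disjoint j k c (there j∈L) (there k∈L)) ,
      λ c o o′ → let j , j∈L , o″ = occurs-prod L f o′ in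
        All.lookup i∉L j∈L (disjoint i j c (here refl) (there j∈L) o o″)

    value-prod : ∀ L (f : I → Poly n) v → (∀ i → value (f i) ≡ v) → value (prod L f) ≡ v ^ length L
    value-prod []      f v eq = refl
    value-prod (i ∷ L) f v eq = cong₂ _*_ (eq i) (value-prod L f v eq)

    indicates-prod : ∀ L (f : I → Poly n) A {Q : I → Set} → (∀ i → Indicates (eval (f i) A) (Q i)) →
                     Indicates (eval (prod L f) A) (All Q L)
    indicates-prod []      f A h = holds [] refl
    indicates-prod (i ∷ L) f A h = indicates-⇔ (λ (Qi , QL) → Qi ∷ QL) (λ { (Qi ∷ QL) → Qi , QL })
      (indicates-× (h i) (indicates-prod L f A h))

  Pr-⊆ : ∀ {n} (V : List (Fin n)) → Unique V → (V⊆? : Decidable (λ A → All (_∈ A) V)) → Pr V⊆? ≡ q ^ length V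
  Pr-⊆ V uniq V⊆? = begin
    Pr V⊆?                  ≡⟨ E-cong (λ A → ind≡ (V⊆? A) (indicates-prod V var A (λ i → indicates-var i A))) ⟩
    E (eval (prod V var))   ≡⟨ E-eval (prod V var) (readOnce-prod uniq (λ _ _ → tt) λ { i j c _ _ refl refl → refl }) ⟩
    value (prod V var)      ≡⟨ value-prod V var q (λ _ → refl) ⟩
    q ^ length V            ∎
    where open ≡-Reasoning

-- The ordered field ℚ(√p)

-- Everything that the estimates use about 1 / √p. Comparisons of q with 1 / m are read off from m²
-- and p; `inv n` is the reciprocal of n + 1 and serves to cancel denominators.
record InverseSqrt (R : OrderedRing) (p : ℕ) : Set where
  open OrderedRingProperties R
  field
    q      : Carrier
    0≲q    : 0# ≲ q
    pq²≡1  : ⟦ p ⟧ * (q * q) ≡ 1#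
    mq≲1   : ∀ m → m ℕ.* m ℕ.≤ p → ⟦ m ⟧ * q ≲ 1#
    1≲mq   : ∀ m → p ℕ.≤ m ℕ.* m → 1# ≲ ⟦ m ⟧ * q
    inv    : ℕ → Carrier
    0≲inv  : ∀ n → 0# ≲ inv n
    invˡ   : ∀ n → ⟦ suc n ⟧ * inv n ≡ 1#

module InverseSqrtProperties (R : OrderedRing) {p : ℕ} .{{_ : NonZero p}} (s : InverseSqrt R p) where
  open OrderedRingProperties R
  open InverseSqrt s public

  q≲1 : q ≲ 1#
  q≲1 = ≲-respˡ (trans (cong (_* q) ⟦1⟧) (*-identityˡ q)) (mq≲1 1 (ℕ.>-nonZero⁻¹ p))

  ⟦⟧-cancel : ∀ n {x y} → ⟦ suc n ⟧ * x ≲ ⟦ suc n ⟧ * y → x ≲ y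
  ⟦⟧-cancel n {x} {y} le = ≲-respˡ (undo x) (≲-respʳ (undo y) (*-monoʳ (inv n) (0≲inv n) le))
    where
    undo : ∀ z → inv n * (⟦ suc n ⟧ * z) ≡ z
    undo z = trans (solve 3 (λ i n z → i :* (n :* z) := n :* i :* z) refl (inv n) ⟦ suc n ⟧ z)
      (trans (cong (_* z) (invˡ n)) (*-identityˡ z))

module QuadraticField where

  open import Data.Rational using (_≤_; _<_; _+_; _*_; -_; _-_)
  open +-*-Solver using (solve; _:=_; _:+_; _:*_; :-_; _:-_; con)

  private
    <⇒≱ : ∀ {a b} → a < b → ¬ b ≤ a
    <⇒≱ a<b b≤a = ℚP.<-irrefl refl (ℚP.<-≤-trans a<b b≤a)

    0≤* : ∀ {a b} → 0ℚ ≤ a → 0ℚ ≤ b → 0ℚ ≤ a * b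
    0≤* {a} {b} p q = ℚP.nonNegative⁻¹ (a * b) {{ℚP.nonNeg*nonNeg⇒nonNeg a {{ℚ.nonNegative p}} b {{ℚ.nonNegative q}}}}

    0<* : ∀ {a b} → 0ℚ < a → 0ℚ < b → 0ℚ < a * b
    0<* {a} {b} p q = ℚP.positive⁻¹ (a * b) {{ℚP.pos*pos⇒pos a {{ℚ.positive p}} b {{ℚ.positive q}}}}

    0≤+ : ∀ {a b} → 0ℚ ≤ a → 0ℚ ≤ b → 0ℚ ≤ a + b
    0≤+ p q = ℚP.+-mono-≤ p q

    0≤sub : ∀ {a b} → a ≤ b → 0ℚ ≤ b - a
    0≤sub {a} {b} p = subst (_≤ b - a) (ℚP.+-inverseʳ a) (ℚP.+-monoˡ-≤ (- a) p)

    sub⇒≤ : ∀ {a b} → 0ℚ ≤ b - a → a ≤ b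
    sub⇒≤ {a} {b} p = subst₂ _≤_ (ℚP.+-identityˡ a) (solve 2 (λ a b → b :- a :+ a := b) refl a b) (ℚP.+-monoˡ-≤ a p)

    -pos : ∀ {a} → a < 0ℚ → 0ℚ < - a
    -pos p = ℚP.neg-antimono-< p

    *-mono : ∀ {a b c d} → 0ℚ ≤ a → 0ℚ ≤ d → a ≤ b → c ≤ d → a * c ≤ b * d
    *-mono {a} {b} {c} {d} 0≤a 0≤d a≤b c≤d = ℚP.≤-trans (ℚP.*-monoˡ-≤-nonNeg a {{ℚ.nonNegative 0≤a}} c≤d)
                                                        (ℚP.*-monoʳ-≤-nonNeg d {{ℚ.nonNegative 0≤d}} a≤b)

    cancel : ∀ c {a b} → 0ℚ < c → c * a ≤ c * b → a ≤ b
    cancel c 0<c = ℚP.*-cancelˡ-≤-pos c {{ℚ.positive 0<c}}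

    0≤² : ∀ a → 0ℚ ≤ a * a
    0≤² a with ℚP.≤-total 0ℚ a
    ... | inj₁ p = 0≤* p p
    ... | inj₂ p = subst (0ℚ ≤_) (solve 1 (λ a → (:- a) :* (:- a) := a :* a) refl a) (0≤* (ℚP.neg-antimono-≤ p) (ℚP.neg-antimono-≤ p))

    -- If a + b < 0 with a ≥ 0, then also a - b > 0, and (-a - b)(a - b) = b² - a² > 0 contradicts
    -- the hypothesis.
    square-dominates : ∀ {a b} → 0ℚ ≤ a → b * b ≤ a * a → 0ℚ ≤ a + b
    square-dominates {a} {b} 0≤a b²≤a² = ℚP.≮⇒≥ λ a+b<0 →
      let 0<-a-b : 0ℚ < - a - b
          0<-a-b = subst (0ℚ <_) (solve 2 (λ a b → :- (a :+ b) := :- a :- b) refl a b) (-pos a+b<0)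
          0<a-b : 0ℚ < a - b
          0<a-b = subst (0ℚ <_) (solve 2 (λ a b → (:- a :- b) :+ (a :+ a) := a :- b) refl a b) (ℚP.+-mono-<-≤ 0<-a-b (0≤+ 0≤a 0≤a))
          a²<b² : 0ℚ < b * b - a * a
          a²<b² = subst (0ℚ <_) (solve 2 (λ a b → (:- a :- b) :* (a :- b) := b :* b :- a :* a) refl a b) (0<* 0<-a-b 0<a-b)
      in <⇒≱ a²<b² (subst (b * b - a * a ≤_) (ℚP.+-inverseʳ (a * a)) (ℚP.+-monoˡ-≤ (- (a * a)) b²≤a²))

  module Cone (p : ℕ) (0<P : 0ℚ < pℚ p) where

    private
      P : ℚ
      P = pℚ p

      0≤P : 0ℚ ≤ P
      0≤P = ℚP.<⇒≤ 0<P

    -- x + y√p ≥ 0, split by the sign of the norm x² − p y² instead of the signs of x and y.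
    Nonnegᴺ : Q√ → Set
    Nonnegᴺ (x +√ y) = (0ℚ ≤ x × P * (y * y) ≤ x * x) ⊎ (0ℚ ≤ y × x * x ≤ P * (y * y))

    toᴺ : ∀ {z} → Nonneg√ p z → Nonnegᴺ z
    toᴺ {x +√ y} (inj₁ (0≤x , 0≤y)) with ℚP.≤-total (P * (y * y)) (x * x)
    ... | inj₁ le = inj₁ (0≤x , le)
    ... | inj₂ le = inj₂ (0≤y , le)
    toᴺ (inj₂ (inj₁ (0≤x , _ , le))) = inj₁ (0≤x , le)
    toᴺ (inj₂ (inj₂ (_ , 0<y , le))) = inj₂ (ℚP.<⇒≤ 0<y , le)

    fromᴺ : ∀ {z} → Nonnegᴺ z → Nonneg√ p z
    fromᴺ {x +√ y} (inj₁ (0≤x , le)) with y ℚP.<? 0ℚ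
    ... | yes y<0 = inj₂ (inj₁ (0≤x , y<0 , le))
    ... | no  y≮0 = inj₁ (0≤x , ℚP.≮⇒≥ y≮0)
    fromᴺ {x +√ y} (inj₂ (0≤y , le)) with x ℚP.<? 0ℚ
    ... | no  x≮0 = inj₁ (ℚP.≮⇒≥ x≮0 , 0≤y)
    ... | yes x<0 = inj₂ (inj₂ (x<0 , ℚP.≰⇒> y≰0 , le))
      where
      -- For y = 0 the norm condition reads x² ≤ 0, against x < 0.
      y≰0 : ¬ y ≤ 0ℚ
      y≰0 y≤0 with ℚP.≤-antisym y≤0 0≤y
      ... | refl = <⇒≱ (0<* (-pos x<0) (-pos x<0)) (ℚP.≤-trans
        (ℚP.≤-reflexive (solve 1 (λ x → (:- x) :* (:- x) := x :* x) refl x))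
        (ℚP.≤-trans le (ℚP.≤-reflexive (solve 1 (λ P → P :* (con 0ℚ :* con 0ℚ) := con 0ℚ) refl P))))

    -- The norm is multiplicative (Brahmagupta's identity), so the norms of the factors decide which
    -- alternative holds for the product; `square-dominates` gives the sign of its dominant
    -- coordinate.
    nonneg-⊗ : ∀ {z w} → Nonnegᴺ z → Nonnegᴺ w → Nonnegᴺ (_⊗_ p z w)
    nonneg-⊗ {a +√ b} {c +√ d} (inj₁ (0≤a , le)) (inj₁ (0≤c , le′)) = inj₁
      ( square-dominates (0≤* 0≤a 0≤c) (subst₂ _≤_
          (solve 3 (λ P b d → P :* (b :* b) :* (P :* (d :* d)) := P :* (b :* d) :* (P :* (b :* d))) refl P b d)
          (solve 2 (λ a c → a :* a :* (c :* c) := a :* c :* (a :* c)) refl a c)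
          (*-mono (0≤* 0≤P (0≤² b)) (0≤² c) le le′))
      , sub⇒≤ (subst (0ℚ ≤_)
          (solve 5 (λ P a b c d → (a :* a :- P :* (b :* b)) :* (c :* c :- P :* (d :* d))
            := (a :* c :+ P :* (b :* d)) :* (a :* c :+ P :* (b :* d)) :- P :* ((a :* d :+ b :* c) :* (a :* d :+ b :* c))) refl P a b c d)
          (0≤* (0≤sub le) (0≤sub le′))))
    nonneg-⊗ {a +√ b} {c +√ d} (inj₁ (0≤a , le)) (inj₂ (0≤d , le′)) = inj₂
      ( square-dominates (0≤* 0≤a 0≤d) (cancel P 0<P (subst₂ _≤_
          (solve 3 (λ P b c → P :* (b :* b) :* (c :* c) := P :* (b :* c :* (b :* c))) refl P b c)
          (solve 3 (λ P a d → a :* a :* (P :* (d :* d)) := P :* (a :* d :* (a :* d))) refl P a d)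
          (*-mono (0≤* 0≤P (0≤² b)) (0≤* 0≤P (0≤² d)) le le′)))
      , sub⇒≤ (subst (0ℚ ≤_)
          (solve 5 (λ P a b c d → (a :* a :- P :* (b :* b)) :* (P :* (d :* d) :- c :* c)
            := P :* ((a :* d :+ b :* c) :* (a :* d :+ b :* c)) :- (a :* c :+ P :* (b :* d)) :* (a :* c :+ P :* (b :* d))) refl P a b c d)
          (0≤* (0≤sub le) (0≤sub le′))))
    nonneg-⊗ {a +√ b} {c +√ d} (inj₂ (0≤b , le)) (inj₁ (0≤c , le′)) = inj₂
      ( subst (0ℚ ≤_) (ℚP.+-comm (b * c) (a * d)) (square-dominates (0≤* 0≤b 0≤c) (cancel P 0<P (subst₂ _≤_
          (solve 3 (λ P a d → a :* a :* (P :* (d :* d)) := P :* (a :* d :* (a :* d))) refl P a d)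
          (solve 3 (λ P b c → P :* (b :* b) :* (c :* c) := P :* (b :* c :* (b :* c))) refl P b c)
          (*-mono (0≤² a) (0≤² c) le le′))))
      , sub⇒≤ (subst (0ℚ ≤_)
          (solve 5 (λ P a b c d → (P :* (b :* b) :- a :* a) :* (c :* c :- P :* (d :* d))
            := P :* ((a :* d :+ b :* c) :* (a :* d :+ b :* c)) :- (a :* c :+ P :* (b :* d)) :* (a :* c :+ P :* (b :* d))) refl P a b c d)
          (0≤* (0≤sub le) (0≤sub le′))))
    nonneg-⊗ {a +√ b} {c +√ d} (inj₂ (0≤b , le)) (inj₂ (0≤d , le′)) = inj₁
      ( subst (0ℚ ≤_) (ℚP.+-comm (P * (b * d)) (a * c)) (square-dominates (0≤* 0≤P (0≤* 0≤b 0≤d)) (subst₂ _≤_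
          (solve 2 (λ a c → a :* a :* (c :* c) := a :* c :* (a :* c)) refl a c)
          (solve 3 (λ P b d → P :* (b :* b) :* (P :* (d :* d)) := P :* (b :* d) :* (P :* (b :* d))) refl P b d)
          (*-mono (0≤² a) (0≤* 0≤P (0≤² d)) le le′)))
      , sub⇒≤ (subst (0ℚ ≤_)
          (solve 5 (λ P a b c d → (P :* (b :* b) :- a :* a) :* (P :* (d :* d) :- c :* c)
            := (a :* c :+ P :* (b :* d)) :* (a :* c :+ P :* (b :* d)) :- P :* ((a :* d :+ b :* c) :* (a :* d :+ b :* c))) refl P a b c d)
          (0≤* (0≤sub le) (0≤sub le′))))

    private
      -- With norms of opposite sign the sum may have either, so its own coordinates are split by
      -- sign. `cross` orders the slopes of the two elements and carries the norm condition of one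
      -- of them over to the sum.
      module Mixed {a b c d : ℚ} (0≤a : 0ℚ ≤ a) (le : P * (b * b) ≤ a * a) (0≤d : 0ℚ ≤ d) (le′ : c * c ≤ P * (d * d)) where

        cross : 0ℚ ≤ a * d + - (b * c)
        cross = square-dominates (0≤* 0≤a 0≤d) (cancel P 0<P (subst₂ _≤_
          (solve 3 (λ P b c → P :* (b :* b) :* (c :* c) := P :* ((:- (b :* c)) :* (:- (b :* c)))) refl P b c)
          (solve 3 (λ P a d → a :* a :* (P :* (d :* d)) := P :* (a :* d :* (a :* d))) refl P a d)
          (*-mono (0≤* 0≤P (0≤² b)) (0≤* 0≤P (0≤² d)) le le′)))

        sum : Nonnegᴺ ((a + c) +√ (b + d))
        sum with (a + c) ℚP.<? 0ℚ | (b + d) ℚP.<? 0ℚ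
        ... | no x≮0 | no y≮0 = toᴺ (inj₁ (ℚP.≮⇒≥ x≮0 , ℚP.≮⇒≥ y≮0))
        ... | no x≮0 | yes y<0 = inj₁ (0≤x , cancel (b * b) 0<b² (ℚP.≤-trans
              (subst₂ _≤_ (solve 3 (λ P b y → P :* (b :* b) :* (y :* y) := b :* b :* (P :* (y :* y))) refl P b y)
                          (solve 2 (λ a y → a :* a :* (y :* y) := (a :* (:- y)) :* (a :* (:- y))) refl a y)
                (ℚP.*-monoʳ-≤-nonNeg (y * y) {{ℚ.nonNegative (0≤² y)}} le))
              (subst (a * - y * (a * - y) ≤_) (solve 2 (λ x b → (x :* (:- b)) :* (x :* (:- b)) := b :* b :* (x :* x)) refl x b)
                (*-mono 0≤-ay (ℚP.≤-trans 0≤-ay slope) slope slope))))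
          where
          x = a + c
          y = b + d
          0≤x = ℚP.≮⇒≥ x≮0
          0<-b : 0ℚ < - b
          0<-b = subst (0ℚ <_) (solve 2 (λ b d → :- (b :+ d) :+ d := :- b) refl b d) (ℚP.+-mono-<-≤ (-pos y<0) 0≤d)
          0<b² : 0ℚ < b * b
          0<b² = subst (0ℚ <_) (solve 1 (λ b → (:- b) :* (:- b) := b :* b) refl b) (0<* 0<-b 0<-b)
          0≤-ay : 0ℚ ≤ a * - y
          0≤-ay = 0≤* 0≤a (ℚP.<⇒≤ (-pos y<0))
          slope : a * - y ≤ x * - b
          slope = sub⇒≤ (subst (0ℚ ≤_) (solve 4 (λ a b c d → a :* d :+ :- (b :* c) := (a :+ c) :* (:- b) :- a :* (:- (b :+ d))) refl a b c d) cross)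
        ... | yes x<0 | no y≮0 = inj₂ (0≤y , cancel (c * c) 0<c² (ℚP.≤-trans
              (subst₂ _≤_ refl
                          (solve 3 (λ P d x → P :* (d :* d) :* (x :* x) := P :* ((d :* (:- x)) :* (d :* (:- x)))) refl P d x)
                (ℚP.*-monoʳ-≤-nonNeg (x * x) {{ℚ.nonNegative (0≤² x)}} le′))
              (subst (P * (d * - x * (d * - x)) ≤_) (solve 3 (λ P y c → P :* ((y :* (:- c)) :* (y :* (:- c))) := c :* c :* (P :* (y :* y))) refl P y c)
                (ℚP.*-monoˡ-≤-nonNeg P {{ℚ.nonNegative 0≤P}} (*-mono 0≤-dx (ℚP.≤-trans 0≤-dx slope) slope slope)))))
          where
          x = a + c
          y = b + d
          0≤y = ℚP.≮⇒≥ y≮0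
          0<-c : 0ℚ < - c
          0<-c = subst (0ℚ <_) (solve 2 (λ a c → :- (a :+ c) :+ a := :- c) refl a c) (ℚP.+-mono-<-≤ (-pos x<0) 0≤a)
          0<c² : 0ℚ < c * c
          0<c² = subst (0ℚ <_) (solve 1 (λ b → (:- b) :* (:- b) := b :* b) refl c) (0<* 0<-c 0<-c)
          0≤-dx : 0ℚ ≤ d * - x
          0≤-dx = 0≤* 0≤d (ℚP.<⇒≤ (-pos x<0))
          slope : d * - x ≤ y * - c
          slope = sub⇒≤ (subst (0ℚ ≤_) (solve 4 (λ a b c d → a :* d :+ :- (b :* c) := (b :+ d) :* (:- c) :- d :* (:- (a :+ c))) refl a b c d) cross)
        -- a d - b c = (a + c) d - c (b + d) would be negative, as c < 0 and d ≥ 0.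
        ... | yes x<0 | yes y<0 = ⊥-elim (<⇒≱ contra cross)
          where
          0<-c : 0ℚ < - c
          0<-c = subst (0ℚ <_) (solve 2 (λ a c → :- (a :+ c) :+ a := :- c) refl a c) (ℚP.+-mono-<-≤ (-pos x<0) 0≤a)
          contra : a * d + - (b * c) < 0ℚ
          contra = subst₂ _<_ (solve 4 (λ a b c d → :- ((:- c) :* (:- (b :+ d)) :+ (:- (a :+ c)) :* d) := a :* d :+ :- (b :* c)) refl a b c d) refl
            (ℚP.neg-antimono-< (ℚP.+-mono-<-≤ (0<* 0<-c (-pos y<0)) (0≤* (ℚP.<⇒≤ (-pos x<0)) 0≤d)))

    -- For norms of equal sign, the norm of the sum is the sum of the norms plus a double cross
    -- term, whose sign follows from a comparison of squares as in the Cauchy-Schwarz inequality.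
    nonneg-⊕ : ∀ {z w} → Nonnegᴺ z → Nonnegᴺ w → Nonnegᴺ (_⊕_ p z w)
    nonneg-⊕ {a +√ b} {c +√ d} (inj₁ (0≤a , le)) (inj₁ (0≤c , le′)) = inj₁ (0≤+ 0≤a 0≤c , sub⇒≤ (subst (0ℚ ≤_)
      (solve 5 (λ P a b c d → (a :* a :- P :* (b :* b)) :+ (c :* c :- P :* (d :* d)) :+ ((a :* c :+ :- (P :* (b :* d))) :+ (a :* c :+ :- (P :* (b :* d))))
        := (a :+ c) :* (a :+ c) :- P :* ((b :+ d) :* (b :+ d))) refl P a b c d)
      (0≤+ (0≤+ (0≤sub le) (0≤sub le′)) (0≤+ cross cross))))
      where
      cross : 0ℚ ≤ a * c + - (P * (b * d))
      cross = square-dominates (0≤* 0≤a 0≤c) (subst₂ _≤_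
        (solve 3 (λ P b d → P :* (b :* b) :* (P :* (d :* d)) := (:- (P :* (b :* d))) :* (:- (P :* (b :* d)))) refl P b d)
        (solve 2 (λ a c → a :* a :* (c :* c) := a :* c :* (a :* c)) refl a c)
        (*-mono (0≤* 0≤P (0≤² b)) (0≤² c) le le′))
    nonneg-⊕ {a +√ b} {c +√ d} (inj₂ (0≤b , le)) (inj₂ (0≤d , le′)) = inj₂ (0≤+ 0≤b 0≤d , sub⇒≤ (subst (0ℚ ≤_)
      (solve 5 (λ P a b c d → (P :* (b :* b) :- a :* a) :+ (P :* (d :* d) :- c :* c) :+ ((P :* (b :* d) :+ :- (a :* c)) :+ (P :* (b :* d) :+ :- (a :* c)))
        := P :* ((b :+ d) :* (b :+ d)) :- (a :+ c) :* (a :+ c)) refl P a b c d)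
      (0≤+ (0≤+ (0≤sub le) (0≤sub le′)) (0≤+ cross cross))))
      where
      cross : 0ℚ ≤ P * (b * d) + - (a * c)
      cross = square-dominates (0≤* 0≤P (0≤* 0≤b 0≤d)) (subst₂ _≤_
        (solve 2 (λ a c → a :* a :* (c :* c) := (:- (a :* c)) :* (:- (a :* c))) refl a c)
        (solve 3 (λ P b d → P :* (b :* b) :* (P :* (d :* d)) := P :* (b :* d) :* (P :* (b :* d))) refl P b d)
        (*-mono (0≤² a) (0≤* 0≤P (0≤² d)) le le′))
    nonneg-⊕ {a +√ b} {c +√ d} (inj₁ (0≤a , le)) (inj₂ (0≤d , le′)) = Mixed.sum {a} {b} {c} {d} 0≤a le 0≤d le′
    nonneg-⊕ {a +√ b} {c +√ d} (inj₂ (0≤b , le)) (inj₁ (0≤c , le′)) =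
      subst Nonnegᴺ (cong₂ _+√_ (ℚP.+-comm c a) (ℚP.+-comm d b)) (Mixed.sum {c} {d} {a} {b} 0≤c le′ 0≤b le)

    ⊖_ : Q√ → Q√
    ⊖ (x +√ y) = (- x) +√ (- y)

    opaque
      Q√-isCommutativeRing : IsCommutativeRing _≡_ (_⊕_ p) (_⊗_ p) ⊖_ (0ℚ +√ 0ℚ) (1ℚ +√ 0ℚ)
      Q√-isCommutativeRing = record
        { isRing = record
          { +-isAbelianGroup = record
            { isGroup = record
              { isMonoid = record
                { isSemigroup = record
                  { isMagma = record { isEquivalence = isEquivalence ; ∙-cong = cong₂ (_⊕_ p) }
                  ; assoc = λ (a +√ b) (c +√ d) (e +√ f) → cong₂ _+√_ (ℚP.+-assoc a c e) (ℚP.+-assoc b d f) }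
                ; identity = (λ (a +√ b) → cong₂ _+√_ (ℚP.+-identityˡ a) (ℚP.+-identityˡ b))
                           , (λ (a +√ b) → cong₂ _+√_ (ℚP.+-identityʳ a) (ℚP.+-identityʳ b)) }
              ; inverse = (λ (a +√ b) → cong₂ _+√_ (ℚP.+-inverseˡ a) (ℚP.+-inverseˡ b))
                        , (λ (a +√ b) → cong₂ _+√_ (ℚP.+-inverseʳ a) (ℚP.+-inverseʳ b))
              ; ⁻¹-cong = cong ⊖_ }
            ; comm = λ (a +√ b) (c +√ d) → cong₂ _+√_ (ℚP.+-comm a c) (ℚP.+-comm b d) }
          ; *-cong = cong₂ (_⊗_ p)
          ; *-assoc = λ (a +√ b) (c +√ d) (e +√ f) → cong₂ _+√_
              (solve 7 (λ P a b c d e f → (a :* c :+ P :* (b :* d)) :* e :+ P :* ((a :* d :+ b :* c) :* f)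
                := a :* (c :* e :+ P :* (d :* f)) :+ P :* (b :* (c :* f :+ d :* e))) refl P a b c d e f)
              (solve 7 (λ P a b c d e f → (a :* c :+ P :* (b :* d)) :* f :+ (a :* d :+ b :* c) :* e
                := a :* (c :* f :+ d :* e) :+ b :* (c :* e :+ P :* (d :* f))) refl P a b c d e f)
          ; *-identity = (λ (a +√ b) → cong₂ _+√_
                (solve 3 (λ P a b → con 1ℚ :* a :+ P :* (con 0ℚ :* b) := a) refl P a b)
                (solve 2 (λ a b → con 1ℚ :* b :+ con 0ℚ :* a := b) refl a b))
            , (λ (a +√ b) → cong₂ _+√_
                (solve 3 (λ P a b → a :* con 1ℚ :+ P :* (b :* con 0ℚ) := a) refl P a b)
                (solve 2 (λ a b → a :* con 0ℚ :+ b :* con 1ℚ := b) refl a b))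
          ; distrib = (λ (a +√ b) (c +√ d) (e +√ f) → cong₂ _+√_
                (solve 7 (λ P a b c d e f → a :* (c :+ e) :+ P :* (b :* (d :+ f)) := (a :* c :+ P :* (b :* d)) :+ (a :* e :+ P :* (b :* f))) refl P a b c d e f)
                (solve 6 (λ a b c d e f → a :* (d :+ f) :+ b :* (c :+ e) := (a :* d :+ b :* c) :+ (a :* f :+ b :* e)) refl a b c d e f))
            , (λ (a +√ b) (c +√ d) (e +√ f) → cong₂ _+√_
                (solve 7 (λ P a b c d e f → (c :+ e) :* a :+ P :* ((d :+ f) :* b) := (c :* a :+ P :* (d :* b)) :+ (e :* a :+ P :* (f :* b))) refl P a b c d e f)
                (solve 6 (λ a b c d e f → (c :+ e) :* b :+ (d :+ f) :* a := (c :* b :+ d :* a) :+ (e :* b :+ f :* a)) refl a b c d e f)) }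
        ; *-comm = λ (a +√ b) (c +√ d) → cong₂ _+√_
            (solve 5 (λ P a b c d → a :* c :+ P :* (b :* d) := c :* a :+ P :* (d :* b)) refl P a b c d)
            (solve 4 (λ a b c d → a :* d :+ b :* c := c :* b :+ d :* a) refl a b c d) }

      nonneg√-0 : Nonneg√ p (0ℚ +√ 0ℚ)
      nonneg√-0 = inj₁ (ℚP.≤-refl , ℚP.≤-refl)

      nonneg√-1 : Nonneg√ p (1ℚ +√ 0ℚ)
      nonneg√-1 = inj₁ (ℚP.nonNegative⁻¹ 1ℚ , ℚP.≤-refl)

      nonneg√-⊕ : ∀ {z w} → Nonneg√ p z → Nonneg√ p w → Nonneg√ p (_⊕_ p z w)
      nonneg√-⊕ z w = fromᴺ (nonneg-⊕ (toᴺ z) (toᴺ w))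

      nonneg√-⊗ : ∀ {z w} → Nonneg√ p z → Nonneg√ p w → Nonneg√ p (_⊗_ p z w)
      nonneg√-⊗ z w = fromᴺ (nonneg-⊗ (toᴺ z) (toᴺ w))

    Q√-ring : OrderedRing
    Q√-ring = record
      { Carrier = Q√ ; _+_ = _⊕_ p ; _*_ = _⊗_ p ; -_ = ⊖_ ; 0# = 0ℚ +√ 0ℚ ; 1# = 1ℚ +√ 0ℚ
      ; isCommutativeRing = Q√-isCommutativeRing
      ; Nonneg = Nonneg√ p ; nonneg-0 = nonneg√-0 ; nonneg-1 = nonneg√-1 ; nonneg-+ = nonneg√-⊕ ; nonneg-* = nonneg√-⊗
      }

  private
    ι : ℕ → ℚ
    ι n = ℤ.+ n ℚ./ 1

    1/suc : ℕ → ℚ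
    1/suc n = ℤ.+ 1 ℚ./ suc n

    ι-+ : ∀ m n → ι (m ℕ.+ n) ≡ ι m + ι n
    ι-+ m n = ℚP.toℚᵘ-injective (begin
      toℚᵘ (ι (m ℕ.+ n))                          ≈⟨ ℚP.toℚᵘ-fromℚᵘ (ℚᵘ.mkℚᵘ (ℤ.+ (m ℕ.+ n)) 0) ⟩
      ℚᵘ.mkℚᵘ (ℤ.+ (m ℕ.+ n)) 0                     ≈⟨ ℚᵘ.*≡* (cong (ℤ._* ℤ.+ 1) (sym (cong₂ ℤ._+_ (ℤP.*-identityʳ (ℤ.+ m)) (ℤP.*-identityʳ (ℤ.+ n))))) ⟩
      ℚᵘ.mkℚᵘ (ℤ.+ m) 0 ℚᵘ.+ ℚᵘ.mkℚᵘ (ℤ.+ n) 0        ≈⟨ ℚᵘP.+-cong (ℚP.toℚᵘ-fromℚᵘ (ℚᵘ.mkℚᵘ (ℤ.+ m) 0)) (ℚP.toℚᵘ-fromℚᵘ (ℚᵘ.mkℚᵘ (ℤ.+ n) 0)) ⟨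
      toℚᵘ (ι m) ℚᵘ.+ toℚᵘ (ι n)                  ≈⟨ ℚP.toℚᵘ-homo-+ (ι m) (ι n) ⟨
      toℚᵘ (ι m + ι n)                            ∎)
      where open import Relation.Binary.Reasoning.Setoid ℚᵘP.≃-setoid

    ι-* : ∀ m n → ι (m ℕ.* n) ≡ ι m * ι n
    ι-* zero    n = sym (ℚP.*-zeroˡ (ι n))
    ι-* (suc m) n = trans (ι-+ n (m ℕ.* n)) (trans (cong (λ z → ι n + z) (ι-* m n))
      (trans (solve 2 (λ m n → n :+ m :* n := (con 1ℚ :+ m) :* n) refl (ι m) (ι n)) (cong (_* ι n) (sym (ι-+ 1 m)))))

    0≤ι : ∀ n → 0ℚ ≤ ι n
    0≤ι n = ℚP.nonNegative⁻¹ (ι n) {{ℚP.normalize-nonNeg n 1}}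

    ι-mono : ∀ {m n} → m ℕ.≤ n → ι m ≤ ι n
    ι-mono {m} {n} m≤n = sub⇒≤ (subst (0ℚ ≤_) eq (0≤ι (n ℕ.∸ m)))
      where
      eq : ι (n ℕ.∸ m) ≡ ι n - ι m
      eq = trans (solve 2 (λ d m → d := (m :+ d) :- m) refl (ι (n ℕ.∸ m)) (ι m))
        (cong (_- ι m) (trans (sym (ι-+ m (n ℕ.∸ m))) (cong ι (ℕP.m+[n∸m]≡n m≤n))))

    ι-inverse : ∀ n → ι (suc n) * 1/suc n ≡ 1ℚ
    ι-inverse n = ℚP.toℚᵘ-injective (begin
      toℚᵘ (ι (suc n) * 1/suc n)                  ≈⟨ ℚP.toℚᵘ-homo-* (ι (suc n)) (1/suc n) ⟩
      toℚᵘ (ι (suc n)) ℚᵘ.* toℚᵘ (1/suc n)        ≈⟨ ℚᵘP.*-cong (ℚP.toℚᵘ-fromℚᵘ (ℚᵘ.mkℚᵘ (ℤ.+ suc n) 0)) (ℚP.toℚᵘ-fromℚᵘ (ℚᵘ.mkℚᵘ (ℤ.+ 1) n)) ⟩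
      ℚᵘ.mkℚᵘ (ℤ.+ suc n) 0 ℚᵘ.* ℚᵘ.mkℚᵘ (ℤ.+ 1) n    ≈⟨ ℚᵘ.*≡* (trans (ℤP.*-identityʳ _) (trans (ℤP.*-identityʳ (ℤ.+ suc n)) (trans (cong (λ k → ℤ.+ suc k) (sym (ℕP.+-identityʳ n))) (sym (ℤP.*-identityˡ _))))) ⟩
      toℚᵘ 1ℚ                                     ∎)
      where open import Relation.Binary.Reasoning.Setoid ℚᵘP.≃-setoid

    ι-inverse′ : ∀ n .{{_ : NonZero n}} → ι n * (ℤ.+ 1 ℚ./ n) ≡ 1ℚ
    ι-inverse′ (suc n) = ι-inverse n

    0≤1/suc : ∀ n → 0ℚ ≤ 1/suc n
    0≤1/suc n = ℚP.nonNegative⁻¹ (1/suc n) {{ℚP.normalize-nonNeg 1 (suc n)}}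

  0<pℚ : ∀ p .{{_ : NonZero p}} → 0ℚ < pℚ p
  0<pℚ p = ℚP.positive⁻¹ (pℚ p) {{ℚP.normalize-pos p 1}}

  ℚ[√_] : ∀ p .{{_ : NonZero p}} → OrderedRing
  ℚ[√ p ] = Cone.Q√-ring p (0<pℚ p)

  module InverseSqrt√ (p : ℕ) .{{_ : NonZero p}} where

    private
      P t : ℚ
      P = pℚ p
      t = ℤ.+ 1 ℚ./ p

      Pt≡1 : P * t ≡ 1ℚ
      Pt≡1 = ι-inverse′ p

    open Cone p (0<pℚ p) using (fromᴺ)
    open OrderedRingProperties ℚ[√ p ] using (⟦_⟧; ⟦0⟧; ⟦suc⟧; _≲_; gap)

    ⟦⟧√ : ∀ m → ⟦ m ⟧ ≡ ι m +√ 0ℚ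
    ⟦⟧√ zero    = ⟦0⟧
    ⟦⟧√ (suc m) = trans (⟦suc⟧ m) (trans (cong (_⊕_ p (1ℚ +√ 0ℚ)) (⟦⟧√ m)) (cong₂ _+√_ (sym (ι-+ 1 m)) (ℚP.+-identityˡ 0ℚ)))

    private
      scalar-⊗ : ∀ a x y → _⊗_ p (a +√ 0ℚ) (x +√ y) ≡ (a * x) +√ (a * y)
      scalar-⊗ a x y = cong₂ _+√_ (solve 4 (λ P a x y → a :* x :+ P :* (con 0ℚ :* y) := a :* x) refl P a x y)
                                  (solve 3 (λ a x y → a :* y :+ con 0ℚ :* x := a :* y) refl a x y)

      mq≡ : ∀ m → _⊗_ p ⟦ m ⟧ (qₚ p) ≡ 0ℚ +√ (ι m * t)
      mq≡ m = trans (cong (λ z → _⊗_ p z (qₚ p)) (⟦⟧√ m)) (trans (scalar-⊗ (ι m) 0ℚ t) (cong (_+√ (ι m * t)) (ℚP.*-zeroʳ (ι m))))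

      -- The norm of 1 - m q is 1 - m² / p; this is what reduces comparisons with q to comparisons
      -- of m² with p.
      P[mt]² : ∀ m → P * (ι m * t * (ι m * t)) ≡ ι (m ℕ.* m) * t
      P[mt]² m = trans (solve 3 (λ P m t → P :* (m :* t :* (m :* t)) := P :* t :* (m :* m :* t)) refl P (ι m) t)
        (trans (cong (_* (ι m * ι m * t)) Pt≡1) (trans (ℚP.*-identityˡ _) (cong (_* t) (sym (ι-* m m)))))

      0≤t : 0ℚ ≤ t
      0≤t = ℚP.nonNegative⁻¹ t {{ℚP.normalize-nonNeg 1 p}}

    opaque
      inverseSqrt : InverseSqrt ℚ[√ p ] p
      inverseSqrt = record
        { q     = qₚ p
        ; 0≲q   = gap (qₚ p) (inj₁ (ℚP.≤-refl , 0≤t)) (cong₂ _+√_ (ℚP.+-identityˡ 0ℚ) (ℚP.+-identityˡ t))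
        ; pq²≡1 = trans (cong (λ z → _⊗_ p z (_⊗_ p (qₚ p) (qₚ p))) (⟦⟧√ p)) (trans (scalar-⊗ P _ _) (cong₂ _+√_
            (trans (solve 2 (λ P t → P :* (con 0ℚ :* con 0ℚ :+ P :* (t :* t)) := P :* t :* (P :* t)) refl P t)
              (trans (cong₂ _*_ Pt≡1 Pt≡1) (ℚP.*-identityˡ 1ℚ)))
            (solve 2 (λ P t → P :* (con 0ℚ :* t :+ t :* con 0ℚ) := con 0ℚ) refl P t)))
        ; mq≲1  = λ m m²≤p → gap (1ℚ +√ (- (ι m * t)))
            (fromᴺ (inj₁ (ℚP.nonNegative⁻¹ 1ℚ , subst₂ _≤_
              (trans (sym (P[mt]² m)) (cong (P *_) (solve 1 (λ y → y :* y := (:- y) :* (:- y)) refl (ι m * t))))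
              (trans Pt≡1 (sym (ℚP.*-identityˡ 1ℚ)))
              (ℚP.*-monoʳ-≤-nonNeg t {{ℚ.nonNegative 0≤t}} (ι-mono m²≤p)))))
            (trans (cong (λ z → _⊕_ p z (1ℚ +√ (- (ι m * t)))) (mq≡ m)) (cong₂ _+√_ (ℚP.+-identityˡ 1ℚ) (ℚP.+-inverseʳ (ι m * t))))
        ; 1≲mq  = λ m p≤m² → gap ((- 1ℚ) +√ (ι m * t))
            (fromᴺ (inj₂ (0≤* (0≤ι m) 0≤t , subst₂ _≤_ Pt≡1 (sym (P[mt]² m))
              (ℚP.*-monoʳ-≤-nonNeg t {{ℚ.nonNegative 0≤t}} (ι-mono p≤m²)))))
            (trans (cong₂ _+√_ (ℚP.+-inverseʳ 1ℚ) (ℚP.+-identityˡ _)) (sym (mq≡ m)))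
        ; inv   = λ m → 1/suc m +√ 0ℚ
        ; 0≲inv = λ m → gap (1/suc m +√ 0ℚ) (inj₁ (0≤1/suc m , ℚP.≤-refl)) (cong₂ _+√_ (ℚP.+-identityˡ _) (ℚP.+-identityˡ 0ℚ))
        ; invˡ  = λ m → trans (cong (λ z → _⊗_ p z (1/suc m +√ 0ℚ)) (⟦⟧√ (suc m)))
            (trans (scalar-⊗ (ι (suc m)) (1/suc m) 0ℚ) (cong₂ _+√_ (ι-inverse m) (ℚP.*-zeroʳ (ι (suc m)))))
        }

      q≡ : InverseSqrt.q inverseSqrt ≡ qₚ p
      q≡ = refl

      inv≡ : ∀ m → InverseSqrt.inv inverseSqrt m ≡ (ℤ.+ 1 ℚ./ suc m) +√ 0ℚ
      inv≡ m = refl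

open import Data.Nat using (_≤_; _<_; _∸_; _/_; _%_; s≤s; z≤n)
open QuadraticField

-- Residues modulo p

module Residues (p : ℕ) .{{_ : NonZero p}} where

  toℕ-[] : ∀ m → toℕ ([_]ₚ p m) ≡ m % p
  toℕ-[] m = FinP.toℕ-fromℕ< (m%n<n m p)

  toℕ-[]-small : ∀ {m} → m < p → toℕ ([_]ₚ p m) ≡ m
  toℕ-[]-small m<p = trans (toℕ-[] _) (m<n⇒m%n≡m m<p)

  []-cong : ∀ {m n} → m % p ≡ n % p → [_]ₚ p m ≡ [_]ₚ p n
  []-cong {m} {n} eq = FinP.toℕ-injective (trans (toℕ-[] m) (trans eq (sym (toℕ-[] n))))

  [toℕ] : ∀ x → [_]ₚ p (toℕ x) ≡ x
  [toℕ] x = FinP.toℕ-injective (toℕ-[]-small (FinP.toℕ<n x))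

  [m+p] : ∀ m → [_]ₚ p (m ℕ.+ p) ≡ [_]ₚ p m
  [m+p] m = []-cong ([m+n]%n≡m%n m p)

  [[m]+n] : ∀ m n → [_]ₚ p (toℕ ([_]ₚ p m) ℕ.+ n) ≡ [_]ₚ p (m ℕ.+ n)
  [[m]+n] m n = []-cong (trans (cong (λ z → (z ℕ.+ n) % p) (toℕ-[] m))
    (trans (%-distribˡ-+ (m % p) n p) (trans (cong (λ z → (z ℕ.+ n % p) % p) (m%n%n≡m%n m p)) (sym (%-distribˡ-+ m n p)))))

  [m+[n]] : ∀ m n → [_]ₚ p (m ℕ.+ toℕ ([_]ₚ p n)) ≡ [_]ₚ p (m ℕ.+ n)
  [m+[n]] m n = trans (cong [_]ₚ′ (ℕP.+-comm m _)) (trans ([[m]+n] n m) (cong [_]ₚ′ (ℕP.+-comm n m)))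
    where [_]ₚ′ = [_]ₚ p

  infixl 6 _⊹_ _-ₚ_

  _⊹_ : Fin p → Fin p → Fin p
  _⊹_ = _+ₚ_ p

  _-ₚ_ : Fin p → Fin p → Fin p
  x -ₚ y = [_]ₚ p (toℕ x ℕ.+ (p ∸ toℕ y))

  ⊹-comm : ∀ x y → x ⊹ y ≡ y ⊹ x
  ⊹-comm x y = cong ([_]ₚ p) (ℕP.+-comm (toℕ x) (toℕ y))

  x⊹[z-x]≡z : ∀ x z → x ⊹ (z -ₚ x) ≡ z
  x⊹[z-x]≡z x z = begin
    x ⊹ (z -ₚ x)                                       ≡⟨ [m+[n]] (toℕ x) _ ⟩
    [_]ₚ p (toℕ x ℕ.+ (toℕ z ℕ.+ (p ∸ toℕ x)))         ≡⟨ cong ([_]ₚ p) eq ⟩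
    [_]ₚ p (toℕ z ℕ.+ p)                               ≡⟨ [m+p] (toℕ z) ⟩
    [_]ₚ p (toℕ z)                                     ≡⟨ [toℕ] z ⟩
    z                                                  ∎
    where
    open ≡-Reasoning
    eq : toℕ x ℕ.+ (toℕ z ℕ.+ (p ∸ toℕ x)) ≡ toℕ z ℕ.+ p
    eq = trans (ℕP.+-comm (toℕ x) _) (trans (ℕP.+-assoc (toℕ z) _ _)
      (cong (toℕ z ℕ.+_) (ℕP.m∸n+n≡m (ℕP.<⇒≤ (FinP.toℕ<n x)))))

  ⊹⇒- : ∀ {x y z} → x ⊹ y ≡ z → y ≡ z -ₚ x
  ⊹⇒- {x} {y} refl = sym (begin
    (x ⊹ y) -ₚ x                                     ≡⟨ [[m]+n] (toℕ x ℕ.+ toℕ y) _ ⟩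
    [_]ₚ p (toℕ x ℕ.+ toℕ y ℕ.+ (p ∸ toℕ x))         ≡⟨ cong ([_]ₚ p) eq ⟩
    [_]ₚ p (toℕ y ℕ.+ p)                             ≡⟨ [m+p] (toℕ y) ⟩
    [_]ₚ p (toℕ y)                                   ≡⟨ [toℕ] y ⟩
    y                                                ∎)
    where
    open ≡-Reasoning
    eq : toℕ x ℕ.+ toℕ y ℕ.+ (p ∸ toℕ x) ≡ toℕ y ℕ.+ p
    eq = trans (cong (ℕ._+ (p ∸ toℕ x)) (ℕP.+-comm (toℕ x) (toℕ y))) (trans (ℕP.+-assoc (toℕ y) _ _)
      (cong (toℕ y ℕ.+_) (ℕP.m+[n∸m]≡n (ℕP.<⇒≤ (FinP.toℕ<n x)))))

  -ₚ-injective : ∀ u {x y} → x -ₚ u ≡ y -ₚ u → x ≡ y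
  -ₚ-injective u {x} {y} eq = trans (sym (x⊹[z-x]≡z u x)) (trans (cong (u ⊹_) eq) (x⊹[z-x]≡z u y))

  ⊹-cases : ∀ x y {z} → x ⊹ y ≡ z → toℕ x ℕ.+ toℕ y ≡ toℕ z ⊎ toℕ x ℕ.+ toℕ y ≡ toℕ z ℕ.+ p
  ⊹-cases x y refl = go (s ℕ./ p) (m<n*o⇒m/o<n (subst (s <_) (cong (p ℕ.+_) (sym (ℕP.+-identityʳ p)))
      (ℕP.+-mono-< (FinP.toℕ<n x) (FinP.toℕ<n y)))) (m≡m%n+[m/n]*n s p)
    where
    s = toℕ x ℕ.+ toℕ y
    go : ∀ k → k < 2 → s ≡ s % p ℕ.+ k ℕ.* p → s ≡ toℕ (x ⊹ y) ⊎ s ≡ toℕ (x ⊹ y) ℕ.+ p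
    go 0 _ eq = inj₁ (trans eq (trans (ℕP.+-identityʳ _) (sym (toℕ-[] s))))
    go 1 _ eq = inj₂ (trans eq (cong₂ ℕ._+_ (sym (toℕ-[] s)) (ℕP.+-identityʳ p)))
    go (suc (suc _)) (s≤s (s≤s ())) _

  -- Doubling wraps around at most once, so x + x = t leaves only 2 x = t or 2 x = t + p. Floor
  -- division makes this a superset of the true halves, always of length 2.
  halves : Fin p → List (Fin p)
  halves t = [_]ₚ p (toℕ t / 2) ∷ [_]ₚ p ((toℕ t ℕ.+ p) / 2) ∷ []

  private
    double/2 : ∀ n → (n ℕ.+ n) / 2 ≡ n
    double/2 n = trans (cong (_/ 2) (trans (cong (n ℕ.+_) (sym (ℕP.+-identityʳ n))) (ℕP.*-comm 2 n))) (m*n/n≡m n 2)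

    ≤half : ∀ {m n} → m ℕ.+ m ≤ n → m ≤ n / 2
    ≤half {m} {n} le = subst (_≤ n / 2) (double/2 m) (/-mono-≤ le (ℕP.≤-refl {2}))

    half≤ : ∀ n → n / 2 ℕ.+ n / 2 ≤ n
    half≤ n = subst (_≤ n) (trans (ℕP.*-comm (n / 2) 2) (cong (n / 2 ℕ.+_) (ℕP.+-identityʳ _))) (m/n*n≤m n 2)

  ∈-halves : ∀ x {t} → x ⊹ x ≡ t → x ∈ₗ halves t
  ∈-halves x {t} eq with ⊹-cases x x eq
  ... | inj₁ e = here (trans (sym ([toℕ] x)) (cong ([_]ₚ p) (trans (sym (double/2 (toℕ x))) (cong (_/ 2) e))))
  ... | inj₂ e = there (here (trans (sym ([toℕ] x)) (cong ([_]ₚ p) (trans (sym (double/2 (toℕ x))) (cong (_/ 2) e)))))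

  -- Contains the smaller member of every pair of residues with sum t; about p / 2 entries,
  -- since x + y ≡ t (mod p) means x + y = t or x + y = t + p.
  smaller : Fin p → List (Fin p)
  smaller t = map ([_]ₚ p) (upTo (suc (toℕ t / 2))) ++
              map (λ i → [_]ₚ p (suc (toℕ t) ℕ.+ i)) (upTo ((p ∸ toℕ t) / 2))

  private
    ∈-smaller : ∀ x y {t} → toℕ x ≤ toℕ y → x ⊹ y ≡ t → x ∈ₗ smaller t
    ∈-smaller x y {t} x≤y eq with ⊹-cases x y eq
    ... | inj₁ e = ∈-++⁺ˡ (subst (_∈ₗ map ([_]ₚ p) (upTo (suc (toℕ t / 2)))) ([toℕ] x) (∈-map⁺ _ (∈-upTo⁺ (s≤s (≤half
                     (ℕP.≤-trans (ℕP.+-monoʳ-≤ (toℕ x) x≤y) (ℕP.≤-reflexive e)))))))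
    ... | inj₂ e = ∈-++⁺ʳ (map ([_]ₚ p) (upTo (suc (toℕ t / 2))))
                     (subst (_∈ₗ map (λ i → [_]ₚ p (suc (toℕ t) ℕ.+ i)) (upTo ((p ∸ toℕ t) / 2)))
                       (trans (cong ([_]ₚ p) split) ([toℕ] x)) (∈-map⁺ _ (∈-upTo⁺ bound)))
      where
      -- After a wrap-around x exceeds t, since x + y = t + p and y < p. So x = t + d with d ≥ 1,
      -- and x ≤ y gives 2 d ≤ p - t.
      t<x : toℕ t < toℕ x
      t<x = ℕP.≰⇒> λ x≤t → ℕP.<-irrefl e (ℕP.+-mono-≤-< x≤t (FinP.toℕ<n y))
      i = toℕ x ∸ suc (toℕ t)
      split : suc (toℕ t) ℕ.+ i ≡ toℕ x
      split = ℕP.m+[n∸m]≡n t<x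
      d = toℕ x ∸ toℕ t
      d+t : d ℕ.+ toℕ t ≡ toℕ x
      d+t = ℕP.m∸n+n≡m (ℕP.<⇒≤ t<x)
      d+d : d ℕ.+ d ≤ p ∸ toℕ t
      d+d = ℕP.+-cancelʳ-≤ (toℕ t) _ _ (subst (d ℕ.+ d ℕ.+ toℕ t ≤_) (sym (ℕP.m∸n+n≡m (ℕP.<⇒≤ (FinP.toℕ<n t))))
        (ℕP.+-cancelʳ-≤ (toℕ t) _ _ (begin
          d ℕ.+ d ℕ.+ toℕ t ℕ.+ toℕ t     ≡⟨ rearrange d (toℕ t) ⟩
          (d ℕ.+ toℕ t) ℕ.+ (d ℕ.+ toℕ t) ≡⟨ cong₂ ℕ._+_ d+t d+t ⟩
          toℕ x ℕ.+ toℕ x                 ≤⟨ ℕP.+-monoʳ-≤ (toℕ x) x≤y ⟩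
          toℕ x ℕ.+ toℕ y                 ≡⟨ trans e (ℕP.+-comm (toℕ t) p) ⟩
          p ℕ.+ toℕ t                     ∎)))
        where
        open ℕP.≤-Reasoning
        rearrange : ∀ a b → a ℕ.+ a ℕ.+ b ℕ.+ b ≡ (a ℕ.+ b) ℕ.+ (a ℕ.+ b)
        rearrange = solve-∀
      bound : i < (p ∸ toℕ t) / 2
      bound = ℕP.≤-trans (ℕP.≤-reflexive (sym (ℕP.+-∸-assoc 1 t<x))) (≤half d+d)

  smaller-complete : ∀ x y {t} → x ⊹ y ≡ t → x ∈ₗ smaller t ⊎ y ∈ₗ smaller t
  smaller-complete x y eq with ℕP.≤-total (toℕ x) (toℕ y)
  ... | inj₁ x≤y = inj₁ (∈-smaller x y x≤y eq)
  ... | inj₂ y≤x = inj₂ (∈-smaller y x y≤x (trans (⊹-comm y x) eq))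

  length-smaller : ∀ t → length (smaller t) ℕ.+ length (smaller t) ≤ 2 ℕ.+ p
  length-smaller t = begin
    length (smaller t) ℕ.+ length (smaller t)              ≡⟨ cong (λ l → l ℕ.+ l) len ⟩
    (suc h ℕ.+ h′) ℕ.+ (suc h ℕ.+ h′)                      ≡⟨ rearrange h h′ ⟩
    2 ℕ.+ ((h ℕ.+ h) ℕ.+ (h′ ℕ.+ h′))                      ≤⟨ ℕP.+-monoʳ-≤ 2 (ℕP.+-mono-≤ (half≤ (toℕ t)) (half≤ (p ∸ toℕ t))) ⟩
    2 ℕ.+ (toℕ t ℕ.+ (p ∸ toℕ t))                          ≡⟨ cong (2 ℕ.+_) (ℕP.m+[n∸m]≡n (ℕP.<⇒≤ (FinP.toℕ<n t))) ⟩
    2 ℕ.+ p                                                ∎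
    where
    open ℕP.≤-Reasoning
    h  = toℕ t / 2
    h′ = (p ∸ toℕ t) / 2
    rearrange : ∀ a b → (suc a ℕ.+ b) ℕ.+ (suc a ℕ.+ b) ≡ 2 ℕ.+ ((a ℕ.+ a) ℕ.+ (b ℕ.+ b))
    rearrange = solve-∀
    len : length (smaller t) ≡ suc h ℕ.+ h′
    len = trans (ListP.length-++ (map ([_]ₚ p) (upTo (suc h)))) (cong₂ ℕ._+_
      (trans (ListP.length-map _ (upTo (suc h))) (ListP.length-upTo (suc h)))
      (trans (ListP.length-map _ (upTo h′)) (ListP.length-upTo h′)))

  module _ (pr : Prime p) (b d : Fin p) (d≢0 : toℕ d ≢ 0) where

    private
      %-∣∸ : ∀ m n → m % p ≡ n % p → p ∣ n ∸ m
      %-∣∸ m n eq = divides (n ℕ./ p ∸ m ℕ./ p) (begin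
        n ∸ m
          ≡⟨ cong₂ _∸_ (m≡m%n+[m/n]*n n p) (trans (m≡m%n+[m/n]*n m p) (cong (ℕ._+ m ℕ./ p ℕ.* p) eq)) ⟩
        (n % p ℕ.+ n ℕ./ p ℕ.* p) ∸ (n % p ℕ.+ m ℕ./ p ℕ.* p)
          ≡⟨ ℕP.[m+n]∸[m+o]≡n∸o (n % p) _ _ ⟩
        n ℕ./ p ℕ.* p ∸ m ℕ./ p ℕ.* p
          ≡⟨ ℕP.*-distribʳ-∸ p (n ℕ./ p) (m ℕ./ p) ⟨
        (n ℕ./ p ∸ m ℕ./ p) ℕ.* p ∎)
        where open ≡-Reasoning

      positive-small-∤ : ∀ {n} → 0 < n → n < p → ¬ p ∣ n
      positive-small-∤ {suc n} _ n<p = >⇒∤ n<p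

      -- Here primality is used: p would divide (j - i) d, hence one of two factors strictly between
      -- 0 and p.
      apTerm-distinct : ∀ {i j} → i < j → j < p → apTerm p b d i ≢ apTerm p b d j
      apTerm-distinct {i} {j} i<j j<p eq with euclidsLemma (j ∸ i) (toℕ d) pr p∣
        where
        p∣ : p ∣ (j ∸ i) ℕ.* toℕ d
        p∣ = subst (p ∣_) (trans (ℕP.[m+n]∸[m+o]≡n∸o (toℕ b) (j ℕ.* toℕ d) (i ℕ.* toℕ d)) (sym (ℕP.*-distribʳ-∸ (toℕ d) j i)))
          (%-∣∸ _ _ (trans (sym (toℕ-[] _)) (trans (cong toℕ eq) (toℕ-[] _))))
      ... | inj₁ p∣j-i = positive-small-∤ (ℕP.m<n⇒0<n∸m i<j) (ℕP.≤-<-trans (ℕP.m∸n≤m j i) j<p) p∣j-i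
      ... | inj₂ p∣d   = positive-small-∤ (ℕP.n≢0⇒n>0 d≢0) (FinP.toℕ<n d) p∣d

    apTerm-injective : ∀ {i j} → i < p → j < p → apTerm p b d i ≡ apTerm p b d j → i ≡ j
    apTerm-injective {i} {j} i<p j<p eq with ℕP.<-cmp i j
    ... | tri< i<j _ _ = ⊥-elim (apTerm-distinct i<j j<p eq)
    ... | tri≈ _ i≡j _ = i≡j
    ... | tri> _ _ j<i = ⊥-elim (apTerm-distinct j<i i<p (sym eq))

-- Progressions in A + A are short

length-cartesianProductWith : ∀ {A B C : Set} (f : A → B → C) xs ys →
                              length (cartesianProductWith f xs ys) ≡ length xs ℕ.* length ys
length-cartesianProductWith f []       ys = refl
length-cartesianProductWith f (x ∷ xs) ys = trans (ListP.length-++ (map (f x) ys))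
  (cong₂ ℕ._+_ (ListP.length-map (f x) ys) (length-cartesianProductWith f xs ys))

length-filter-map : ∀ {A B : Set} {P : B → Set} (P? : Decidable P) (f : A → B) xs →
                    length (filter P? (map f xs)) ≡ length (filter (P? ∘ f) xs)
length-filter-map P? f [] = refl
length-filter-map P? f (x ∷ xs) with does (P? (f x))
... | true  = cong suc (length-filter-map P? f xs)
... | false = length-filter-map P? f xs

private
  filter-grows : ∀ {A : Set} {P : A → Set} (P? : Decidable P) x xs → length (filter P? xs) ≤ length (filter P? (x ∷ xs))
  filter-grows P? x xs with does (P? x)
  ... | true  = ℕP.n≤1+n _
  ... | false = ℕP.≤-refl

  filter-counts : ∀ {A : Set} {P : A → Set} (P? : Decidable P) {x} xs → P x →
                  suc (length (filter P? xs)) ≤ length (filter P? (x ∷ xs))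
  filter-counts P? xs Px = ℕP.≤-reflexive (sym (cong length (ListP.filter-accept P? {xs = xs} Px)))

length≤filters : ∀ {A : Set} {P Q N : A → Set} (P? : Decidable P) (Q? : Decidable Q) (N? : Decidable N) xs →
                 (∀ x → x ∈ₗ xs → P x ⊎ Q x ⊎ N x) →
                 length xs ≤ length (filter P? xs) ℕ.+ length (filter Q? xs) ℕ.+ length (filter N? xs)
length≤filters P? Q? N? [] h = z≤n
length≤filters {A} P? Q? N? (x ∷ xs) h = ℕP.≤-trans (s≤s (length≤filters P? Q? N? xs λ y y∈xs → h y (there y∈xs))) (step (h x (here refl)))
  where
  #P = length (filter P? xs)
  #Q = length (filter Q? xs)
  #N = length (filter N? xs)
  step : _ → suc (#P ℕ.+ #Q ℕ.+ #N) ≤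
         length (filter P? (x ∷ xs)) ℕ.+ length (filter Q? (x ∷ xs)) ℕ.+ length (filter N? (x ∷ xs))
  step (inj₁ Px) = ℕP.+-mono-≤ (ℕP.+-mono-≤ (filter-counts P? xs Px) (filter-grows Q? x xs)) (filter-grows N? x xs)
  step (inj₂ (inj₁ Qx)) = ℕP.≤-trans (ℕP.≤-reflexive (sym (cong (ℕ._+ #N) (ℕP.+-suc #P #Q))))
    (ℕP.+-mono-≤ (ℕP.+-mono-≤ (filter-grows P? x xs) (filter-counts Q? xs Qx)) (filter-grows N? x xs))
  step (inj₂ (inj₂ Nx)) = ℕP.≤-trans (ℕP.≤-reflexive (sym (ℕP.+-suc (#P ℕ.+ #Q) #N)))
    (ℕP.+-mono-≤ (ℕP.+-mono-≤ (filter-grows P? x xs) (filter-grows Q? x xs)) (filter-counts N? xs Nx))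

module Insertion {n : ℕ} where
  open import Data.List.Membership.DecPropositional (FinP._≟_ {n}) public using () renaming (_∈?_ to _∈ₗ?_)

  -- Exposed elements are charged a factor q each, so a list of them must be free of repetitions.
  insert : Fin n → List (Fin n) → List (Fin n)
  insert x V with x ∈ₗ? V
  ... | yes _ = V
  ... | no _  = x ∷ V

  unique-insert : ∀ x {V} → Unique V → Unique (insert x V)
  unique-insert x {V} uniq with x ∈ₗ? V
  ... | yes _  = uniq
  ... | no x∉V = AllP.¬Any⇒All¬ V x∉V ∷ uniq

  ∈-insert : ∀ x V → x ∈ₗ insert x V
  ∈-insert x V with x ∈ₗ? V
  ... | yes x∈V = x∈V
  ... | no _    = here refl

  ⊆-insert : ∀ x {V y} → y ∈ₗ V → y ∈ₗ insert x V
  ⊆-insert x {V} y∈V with x ∈ₗ? V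
  ... | yes _ = y∈V
  ... | no _  = there y∈V

  ∈-insert⁻ : ∀ x {V y} → y ∈ₗ insert x V → y ≡ x ⊎ y ∈ₗ V
  ∈-insert⁻ x {V} y∈ with x ∈ₗ? V | y∈
  ... | yes _ | y∈V       = inj₂ y∈V
  ... | no _  | here y≡x  = inj₁ y≡x
  ... | no _  | there y∈V = inj₂ y∈V

  length-insert-≤ : ∀ x V → length (insert x V) ≤ suc (length V)
  length-insert-≤ x V with x ∈ₗ? V
  ... | yes _ = ℕP.n≤1+n _
  ... | no _  = ℕP.≤-refl

  length-insert-≥ : ∀ x V → length V ≤ length (insert x V)
  length-insert-≥ x V with x ∈ₗ? V
  ... | yes _ = ℕP.≤-refl
  ... | no _  = ℕP.n≤1+n _

  length-insert-< : ∀ x V → x ∉ₗ V → length V < length (insert x V)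
  length-insert-< x V x∉V with x ∈ₗ? V
  ... | yes x∈V = ⊥-elim (x∉V x∈V)
  ... | no _    = ℕP.≤-refl

module UpperBound (R : OrderedRing) (q : OrderedRing.Carrier R)
                  (0≲q : OrderedRingProperties._≲_ R (OrderedRing.0# R) q)
                  (q≲1 : OrderedRingProperties._≲_ R q (OrderedRing.1# R)) (p : ℕ) .{{_ : NonZero p}} where

  open OrderedRingProperties R
  open Expectation R q 0≲q q≲1
  open Residues p
  open Insertion {p}

  sumSet? : ∀ A → Decidable (SumSet p A)
  sumSet? A t = FinP.any? λ a → FinP.any? λ b → (a ∈? A) ×-dec (b ∈? A) ×-dec (a ⊹ b FinP.≟ t)

  -- Reveal the elements of `Y` in turn and move those found in `A` to `Z`. Using l^j in place of a
  -- binomial coefficient closes the recursion, as l^j + l^(j + 1) ≤ (l + 1)^(j + 1).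
  Pr-many : ∀ j Y Z → Unique Y → Unique Z → (∀ {y} → y ∈ₗ Y → y ∉ₗ Z) →
            (Q? : Decidable (λ (A : Subset p) → All (_∈ A) Z × j ≤ length (filter (_∈? A) Y))) →
            Pr Q? ≲ q ^ (length Z ℕ.+ j) * ⟦ length Y ℕ.^ j ⟧
  Pr-many zero Y Z uY uZ dis Q? = begin
    Pr Q?                            ≲⟨ Pr-mono Q? (λ A → All.all? (_∈? A) Z) (λ A → proj₁) ⟩
    Pr (λ A → All.all? (_∈? A) Z)    ≈⟨ Pr-⊆ Z uZ (λ A → All.all? (_∈? A) Z) ⟩
    q ^ length Z                     ≈⟨ cong (q ^_) (sym (ℕP.+-identityʳ (length Z))) ⟩
    q ^ (length Z ℕ.+ 0)             ≈⟨ sym (*-identityʳ _) ⟩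
    q ^ (length Z ℕ.+ 0) * 1#        ≈⟨ cong (q ^ (length Z ℕ.+ 0) *_) (sym ⟦1⟧) ⟩
    q ^ (length Z ℕ.+ 0) * ⟦ 1 ⟧     ∎
    where open ≲-Reasoning
  Pr-many (suc j) [] Z uY uZ dis Q? = ≲-trans (Pr-impossible Q? λ { A (_ , ()) })
    (0≲* (^-nonneg (length Z ℕ.+ suc j) 0≲q) (⟦⟧-nonneg _))
  Pr-many (suc j) (y ∷ Y) Z (y∉Y ∷ uY) uZ dis Q? = begin
    Pr Q?
      ≲⟨ Pr-⊎ Q? Q₁? Q₂? split ⟩
    Pr Q₁? + Pr Q₂?
      ≲⟨ +-mono (Pr-many j Y (y ∷ Z) uY (AllP.¬Any⇒All¬ Z (dis (here refl)) ∷ uZ) dis′ Q₁?)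
                (Pr-many (suc j) Y Z uY uZ (dis ∘ there) Q₂?) ⟩
    q ^ suc (length Z ℕ.+ j) * ⟦ l ℕ.^ j ⟧ + q ^ (length Z ℕ.+ suc j) * ⟦ l ℕ.^ suc j ⟧
      ≈⟨ cong (λ m → q ^ m * ⟦ l ℕ.^ j ⟧ + Qz * ⟦ l ℕ.^ suc j ⟧) (sym (ℕP.+-suc (length Z) j)) ⟩
    Qz * ⟦ l ℕ.^ j ⟧ + Qz * ⟦ l ℕ.^ suc j ⟧
      ≈⟨ trans (sym (distribˡ Qz _ _)) (cong (Qz *_) (sym (⟦+⟧ (l ℕ.^ j) (l ℕ.^ suc j)))) ⟩
    Qz * ⟦ l ℕ.^ j ℕ.+ l ℕ.^ suc j ⟧
      ≲⟨ *-monoʳ Qz (^-nonneg (length Z ℕ.+ suc j) 0≲q) (⟦⟧-mono (ℕP.*-monoʳ-≤ (suc l) (ℕP.^-monoˡ-≤ j (ℕP.n≤1+n l)))) ⟩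
    Qz * ⟦ suc l ℕ.^ suc j ⟧ ∎
    where
    open ≲-Reasoning
    l  = length Y
    Qz = q ^ (length Z ℕ.+ suc j)
    Q₁? : Decidable (λ A → All (_∈ A) (y ∷ Z) × j ≤ length (filter (_∈? A) Y))
    Q₁? A = All.all? (_∈? A) (y ∷ Z) ×-dec (j ℕP.≤? length (filter (_∈? A) Y))
    Q₂? : Decidable (λ A → All (_∈ A) Z × suc j ≤ length (filter (_∈? A) Y))
    Q₂? A = All.all? (_∈? A) Z ×-dec (suc j ℕP.≤? length (filter (_∈? A) Y))
    dis′ : ∀ {x} → x ∈ₗ Y → x ∉ₗ y ∷ Z
    dis′ x∈Y (here refl) = All.lookup y∉Y x∈Y refl
    dis′ x∈Y (there x∈Z) = dis (there x∈Y) x∈Z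
    split : ∀ A → All (_∈ A) Z × suc j ≤ length (filter (_∈? A) (y ∷ Y)) →
            (All (_∈ A) (y ∷ Z) × j ≤ length (filter (_∈? A) Y)) ⊎ (All (_∈ A) Z × suc j ≤ length (filter (_∈? A) Y))
    split A (Z⊆A , le) with y ∈? A
    ... | yes y∈A = inj₁ (y∈A ∷ Z⊆A , ℕP.≤-pred le)
    ... | no y∉A  = inj₂ (Z⊆A , le)

  InSum : List (Fin p) → Fin p → Set
  InSum V t = Any (λ v → Any (λ w → v ⊹ w ≡ t) V) V

  inSum? : ∀ V → Decidable (InSum V)
  inSum? V t = Any.any? (λ v → Any.any? (λ w → v ⊹ w FinP.≟ t) V) V

  inSum⁺ : ∀ {V t v w} → v ∈ₗ V → w ∈ₗ V → v ⊹ w ≡ t → InSum V t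
  inSum⁺ v∈V w∈V eq = lose v∈V (lose w∈V eq)

  inSum⁻ : ∀ {V t} → InSum V t → Σ (Fin p) λ v → Σ (Fin p) λ w → v ∈ₗ V × w ∈ₗ V × v ⊹ w ≡ t
  inSum⁻ t∈ = let v , v∈V , rest = find t∈
                  w , w∈V , eq = find rest in v , w , v∈V , w∈V , eq

  -- The size of the intersection of `X` with the translate u + A; it bounds how many elements of
  -- `X` the exposure of u can cover.
  degree : List (Fin p) → Subset p → Fin p → ℕ
  degree X A u = length (filter (λ x → (x -ₚ u) ∈? A) X)

  module Exceptional (t : Fin p) (T V : List (Fin p)) where

    -- A residue outside this list covers nothing in `T` by adding itself or a member of `V`;
    -- `exceptional` serves to demand the same of the partner t - a.
    exceptional₀ : List (Fin p)
    exceptional₀ = cartesianProductWith _-ₚ_ T V ++ concatMap halves T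

    exceptional : List (Fin p)
    exceptional = exceptional₀ ++ map (t -ₚ_) exceptional₀

    length-exceptional : ∀ k → length T ≤ k → length V ≤ 2 ℕ.* k → length exceptional ≤ 4 ℕ.* (k ℕ.* suc k)
    length-exceptional k T≤k V≤2k = begin
      length exceptional                             ≡⟨ ListP.length-++ exceptional₀ ⟩
      l₀ ℕ.+ length (map (t -ₚ_) exceptional₀)       ≡⟨ cong (l₀ ℕ.+_) (ListP.length-map _ exceptional₀) ⟩
      l₀ ℕ.+ l₀                                      ≤⟨ ℕP.+-mono-≤ l₀≤ l₀≤ ⟩
      b ℕ.+ b                                        ≡⟨ rearrange k ⟩
      4 ℕ.* (k ℕ.* suc k)                            ∎
      where
      open ℕP.≤-Reasoning
      l₀ = length exceptional₀
      b = k ℕ.* (2 ℕ.* k) ℕ.+ 2 ℕ.* k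
      rearrange : ∀ k → (k ℕ.* (2 ℕ.* k) ℕ.+ 2 ℕ.* k) ℕ.+ (k ℕ.* (2 ℕ.* k) ℕ.+ 2 ℕ.* k) ≡ 4 ℕ.* (k ℕ.* suc k)
      rearrange = solve-∀
      length-halves : ∀ T → length (concatMap halves T) ≡ 2 ℕ.* length T
      length-halves []      = refl
      length-halves (x ∷ T) = trans (cong (2 ℕ.+_) (length-halves T)) (sym (ℕP.*-distribˡ-+ 2 1 (length T)))
      l₀≤ : l₀ ≤ b
      l₀≤ = begin
        l₀                                                                   ≡⟨ ListP.length-++ (cartesianProductWith _-ₚ_ T V) ⟩
        length (cartesianProductWith _-ₚ_ T V) ℕ.+ length (concatMap halves T)
          ≡⟨ cong₂ ℕ._+_ (length-cartesianProductWith _-ₚ_ T V) (length-halves T) ⟩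
        length T ℕ.* length V ℕ.+ 2 ℕ.* length T                             ≤⟨ ℕP.+-mono-≤ (ℕP.*-mono-≤ T≤k V≤2k) (ℕP.*-monoʳ-≤ 2 T≤k) ⟩
        b ∎

    module _ {a : Fin p} (a∉ : a ∉ₗ exceptional) where

      private
        b = t -ₚ a

        a∉₀ : a ∉ₗ exceptional₀
        a∉₀ a∈ = a∉ (∈-++⁺ˡ a∈)

        b∉₀ : b ∉ₗ exceptional₀
        b∉₀ b∈ = a∉ (∈-++⁺ʳ exceptional₀ (subst (_∈ₗ map (t -ₚ_) exceptional₀)
          (sym (⊹⇒- (trans (⊹-comm b a) (x⊹[z-x]≡z a t)))) (∈-map⁺ (t -ₚ_) b∈)))

        avoids-V : ∀ {x t′ v} → x ∉ₗ exceptional₀ → t′ ∈ₗ T → v ∈ₗ V → v ⊹ x ≢ t′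
        avoids-V x∉ t′∈T v∈V eq = x∉ (∈-++⁺ˡ (subst (_∈ₗ cartesianProductWith _-ₚ_ T V) (sym (⊹⇒- eq))
          (∈-cartesianProductWith⁺ _-ₚ_ t′∈T v∈V)))

        avoids-half : ∀ {x t′} → x ∉ₗ exceptional₀ → t′ ∈ₗ T → x ⊹ x ≢ t′
        avoids-half {x} x∉ t′∈T eq = x∉ (∈-++⁺ʳ (cartesianProductWith _-ₚ_ T V)
          (∈-concatMap⁺ halves (lose t′∈T (∈-halves x eq))))

        a⊹b≡t : a ⊹ b ≡ t
        a⊹b≡t = x⊹[z-x]≡z a t

      -- As t itself belongs to `T`, avoiding halves separates a from t - a, and if one of them were
      -- in `V`, the other would be a difference of t and a member of `V`.
      generic-unique : t ∈ₗ T → Unique V → Unique (a ∷ (t -ₚ a) ∷ V)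
      generic-unique t∈T uV =
        ((λ a≡b → avoids-half a∉₀ t∈T (trans (cong (a ⊹_) a≡b) a⊹b≡t)) ∷
          AllP.¬Any⇒All¬ V (λ a∈V → avoids-V b∉₀ t∈T a∈V a⊹b≡t)) ∷
        (AllP.¬Any⇒All¬ V (λ b∈V → avoids-V a∉₀ t∈T b∈V (trans (⊹-comm b a) a⊹b≡t))) ∷ uV

      generic-covers-nothing : ∀ {t′} → t′ ∈ₗ T → t ≢ t′ → ¬ InSum V t′ → ¬ InSum (a ∷ (t -ₚ a) ∷ V) t′
      generic-covers-nothing {t′} t′∈T t≢t′ t′∉ t′∈ with inSum⁻ t′∈
      ... | v , w , here refl         , here refl         , eq = avoids-half a∉₀ t′∈T eq
      ... | v , w , here refl         , there (here refl) , eq = t≢t′ (trans (sym a⊹b≡t) eq)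
      ... | v , w , here refl         , there (there w∈V) , eq = avoids-V a∉₀ t′∈T w∈V (trans (⊹-comm w a) eq)
      ... | v , w , there (here refl) , here refl         , eq = t≢t′ (trans (sym a⊹b≡t) (trans (⊹-comm a b) eq))
      ... | v , w , there (here refl) , there (here refl) , eq = avoids-half b∉₀ t′∈T eq
      ... | v , w , there (here refl) , there (there w∈V) , eq = avoids-V b∉₀ t′∈T w∈V (trans (⊹-comm w b) eq)
      ... | v , w , there (there v∈V) , here refl         , eq = avoids-V a∉₀ t′∈T v∈V eq
      ... | v , w , there (there v∈V) , there (here refl) , eq = avoids-V b∉₀ t′∈T v∈V eq
      ... | v , w , there (there v∈V) , there (there w∈V) , eq = t′∉ (inSum⁺ v∈V w∈V eq)

  -- The bound gains `ν` per element of `X`, and `μ` is its inverse. `budget` says that an exposure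
  -- step does not lose: a generic choice pays q² for one element and weighs q² μ; an exceptional
  -- one pays at least one factor q for at most 2 D elements.
  module Covering (X : List (Fin p)) (D k : ℕ) (μ ν : Carrier) (0≲μ : 0# ≲ μ) (0≲ν : 0# ≲ ν) (ν≲1 : ν ≲ 1#)
                  (μν≡1 : μ * ν ≡ 1#)
                  (budget : ∀ c s → c ℕ.+ c ≤ 2 ℕ.+ p → s ≤ 4 ℕ.* (k ℕ.* suc k) →
                            ⟦ c ⟧ * (q * q * μ) + ⟦ s ⟧ * (q * μ ^ (D ℕ.+ D)) ≲ 1#) where

    Covered : List (Fin p) → List (Fin p) → Subset p → Set
    Covered V T A = All (_∈ A) V × All (SumSet p A) T × (∀ u → degree X A u ≤ D)

    covered? : ∀ V T → Decidable (Covered V T)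
    covered? V T A = All.all? (_∈? A) V ×-dec All.all? (sumSet? A) T ×-dec FinP.all? (λ u → degree X A u ℕP.≤? D)

    -- The inequality on lengths is an invariant, since a step adds at most two elements to `V` and
    -- removes at least one from `T`. It keeps `V` within 2 k elements, which bounds the exceptional
    -- list.
    Claim : List (Fin p) → List (Fin p) → Set
    Claim V T = Unique V → Unique T → (∀ {t} → t ∈ₗ T → ¬ InSum V t) → T ⊆ X → length V ℕ.+ 2 ℕ.* length T ≤ 2 ℕ.* k →
                Pr (covered? V T) ≲ q ^ length V * ν ^ length T

    private
      μⁿνⁿ≡1 : ∀ n → μ ^ n * ν ^ n ≡ 1#
      μⁿνⁿ≡1 n = trans (sym (^-distrib-* μ ν n)) (trans (cong (_^ n) μν≡1) (1^n≡1 n))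

      ν-loss : ∀ {m n} j → n ≤ j ℕ.+ m → ν ^ m ≲ μ ^ j * ν ^ n
      ν-loss {m} {n} j n≤j+m = begin
        ν ^ m                     ≈⟨ sym (*-identityˡ _) ⟩
        1# * ν ^ m                ≈⟨ cong (_* ν ^ m) (sym (μⁿνⁿ≡1 j)) ⟩
        μ ^ j * ν ^ j * ν ^ m     ≈⟨ *-assoc _ _ _ ⟩
        μ ^ j * (ν ^ j * ν ^ m)   ≈⟨ cong (μ ^ j *_) (sym (^-homo-* ν j m)) ⟩
        μ ^ j * ν ^ (j ℕ.+ m)     ≲⟨ *-monoʳ (μ ^ j) (^-nonneg j 0≲μ) (^-antitone 0≲ν ν≲1 n≤j+m) ⟩
        μ ^ j * ν ^ n             ∎
        where open ≲-Reasoning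

    module Step (V : List (Fin p)) (t : Fin p) (T : List (Fin p))
                (ih : ∀ V′ T′ → length T′ ≤ length T → Claim V′ T′)
                (uV : Unique V) (uT : Unique (t ∷ T)) (T∩V+V : ∀ {x} → x ∈ₗ t ∷ T → ¬ InSum V x)
                (T⊆X : t ∷ T ⊆ X) (size : length V ℕ.+ 2 ℕ.* length (t ∷ T) ≤ 2 ℕ.* k) where

      open Exceptional t (t ∷ T) V

      private
        l = length V
        n = length T

        size′ : ∀ {m j} → m ≤ suc (suc l) → j ≤ n → m ℕ.+ 2 ℕ.* j ≤ 2 ℕ.* k
        size′ {m} {j} m≤ j≤ = ℕP.≤-trans (ℕP.+-mono-≤ m≤ (ℕP.*-monoʳ-≤ 2 j≤)) (subst (_≤ 2 ℕ.* k) (rearrange l n) size)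
          where
          rearrange : ∀ l n → l ℕ.+ 2 ℕ.* suc n ≡ suc (suc l) ℕ.+ 2 ℕ.* n
          rearrange = solve-∀

      -- With non-membership as part of the event, the union bound may run over all of `smaller t`;
      -- for exceptional a the event is impossible.
      Generic : Fin p → Subset p → Set
      Generic a A = a ∉ₗ exceptional × Covered (a ∷ (t -ₚ a) ∷ V) T A

      generic? : ∀ a → Decidable (Generic a)
      generic? a A = ¬? (a ∈ₗ? exceptional) ×-dec covered? (a ∷ (t -ₚ a) ∷ V) T A

      V⁺ : Fin p → List (Fin p)
      V⁺ a = insert a (insert (t -ₚ a) V)

      T⁺ : Fin p → List (Fin p)
      T⁺ a = filter (¬? ∘ inSum? (V⁺ a)) (t ∷ T)

      -- The inequality does not involve `A`, but its proof takes a set `A` of degree at most `D`.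
      -- As part of the event it is at hand when the probability is bounded.
      Special : Fin p → Subset p → Set
      Special a A = suc n ≤ D ℕ.+ D ℕ.+ length (T⁺ a) × Covered (V⁺ a) (T⁺ a) A

      special? : ∀ a → Decidable (Special a)
      special? a A = (suc n ℕP.≤? D ℕ.+ D ℕ.+ length (T⁺ a)) ×-dec covered? (V⁺ a) (T⁺ a) A

      private
        a∈V⁺ : ∀ a → a ∈ₗ V⁺ a
        a∈V⁺ a = ∈-insert a (insert (t -ₚ a) V)

        b∈V⁺ : ∀ a → (t -ₚ a) ∈ₗ V⁺ a
        b∈V⁺ a = ⊆-insert a (∈-insert (t -ₚ a) V)

        t∈V⁺+V⁺ : ∀ a → InSum (V⁺ a) t
        t∈V⁺+V⁺ a = inSum⁺ (a∈V⁺ a) (b∈V⁺ a) (x⊹[z-x]≡z a t)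

        -- If a and t - a had both been exposed before, t would be covered already; so at least one
        -- factor q is paid.
        length-V⁺ : ∀ a → l < length (V⁺ a)
        length-V⁺ a = go ((t -ₚ a) ∈ₗ? V) (a ∈ₗ? V)
          where
          go : Dec ((t -ₚ a) ∈ₗ V) → Dec (a ∈ₗ V) → l < length (V⁺ a)
          go (no b∉V)  _         = ℕP.<-≤-trans (length-insert-< (t -ₚ a) V b∉V) (length-insert-≥ a (insert (t -ₚ a) V))
          go (yes b∈V) (yes a∈V) = ⊥-elim (T∩V+V (here refl) (inSum⁺ a∈V b∈V (x⊹[z-x]≡z a t)))
          go (yes b∈V) (no a∉V)  = ℕP.≤-<-trans (length-insert-≥ (t -ₚ a) V) (length-insert-< a (insert (t -ₚ a) V) a∉)
            where
            a∉ : a ∉ₗ insert (t -ₚ a) V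
            a∉ a∈ with ∈-insert⁻ (t -ₚ a) a∈
            ... | inj₁ a≡b = a∉V (subst (_∈ₗ V) (sym a≡b) b∈V)
            ... | inj₂ a∈V = a∉V a∈V

        length-V⁺-≤ : ∀ a → length (V⁺ a) ≤ suc (suc l)
        length-V⁺-≤ a = ℕP.≤-trans (length-insert-≤ a (insert (t -ₚ a) V)) (s≤s (length-insert-≤ (t -ₚ a) V))

        length-T⁺ : ∀ a → length (T⁺ a) ≤ n
        length-T⁺ a = ℕP.≤-trans
          (ℕP.≤-reflexive (cong length (ListP.filter-reject (¬? ∘ inSum? (V⁺ a)) {xs = T} λ ¬t → ¬t (t∈V⁺+V⁺ a))))
          (ListP.length-filter (¬? ∘ inSum? (V⁺ a)) T)

      Pr-generic : ∀ a → Pr (generic? a) ≲ q ^ l * ν ^ suc n * (q * q * μ)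
      Pr-generic a = case a ∈ₗ? exceptional of λ where
       (yes a∈) → ≲-trans (Pr-impossible (generic? a) λ A (a∉ , _) → a∉ a∈)
                       (0≲* (0≲* (^-nonneg l 0≲q) (^-nonneg (suc n) 0≲ν)) (0≲* (0≲* 0≲q 0≲q) 0≲μ))
       (no a∉) → begin
        Pr (generic? a)                           ≲⟨ Pr-mono (generic? a) (covered? (a ∷ (t -ₚ a) ∷ V) T) (λ A → proj₂) ⟩
        Pr (covered? (a ∷ (t -ₚ a) ∷ V) T)        ≲⟨ ih (a ∷ (t -ₚ a) ∷ V) T ℕP.≤-refl (generic-unique a∉ (here refl) uV)
                                                      uT′ (covers-nothing a∉) T⊆X′ (size′ ℕP.≤-refl ℕP.≤-refl) ⟩
        q ^ suc (suc l) * ν ^ n                   ≲⟨ *-monoʳ (q ^ suc (suc l)) (^-nonneg (suc (suc l)) 0≲q) (ν-loss {n} 1 ℕP.≤-refl) ⟩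
        q ^ suc (suc l) * (μ ^ 1 * ν ^ suc n)     ≈⟨ solve 4 (λ q a m b → q :* (q :* a) :* (m :* con 1 :* b) := a :* b :* (q :* q :* m))
                                                      refl q (q ^ l) μ (ν ^ suc n) ⟩
        q ^ l * ν ^ suc n * (q * q * μ)           ∎
        where
        open ≲-Reasoning
        uT′ : Unique T
        uT′ = AllPairs.tail uT
        t∉T : ∀ {x} → x ∈ₗ T → t ≢ x
        t∉T x∈T = All.lookup (AllPairs.head uT) x∈T
        T⊆X′ : T ⊆ X
        T⊆X′ = ⊆-trans (t ∷ʳ ⊆-refl) T⊆X
        covers-nothing : a ∉ₗ exceptional → ∀ {x} → x ∈ₗ T → ¬ InSum (a ∷ (t -ₚ a) ∷ V) x
        covers-nothing a∉ x∈T = generic-covers-nothing a∉ (there x∈T) (t∉T x∈T) (T∩V+V (there x∈T))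

      Pr-special : ∀ a → Pr (special? a) ≲ q ^ l * ν ^ suc n * (q * μ ^ (D ℕ.+ D))
      Pr-special a = case suc n ℕP.≤? D ℕ.+ D ℕ.+ length (T⁺ a) of λ where
       (no ≰) → ≲-trans (Pr-impossible (special? a) λ A (le , _) → ≰ le)
                     (0≲* (0≲* (^-nonneg l 0≲q) (^-nonneg (suc n) 0≲ν)) (0≲* 0≲q (^-nonneg (D ℕ.+ D) 0≲μ)))
       (yes le) → begin
        Pr (special? a)                            ≲⟨ Pr-mono (special? a) (covered? (V⁺ a) (T⁺ a)) (λ A → proj₂) ⟩
        Pr (covered? (V⁺ a) (T⁺ a))                ≲⟨ ih (V⁺ a) (T⁺ a) (length-T⁺ a) (unique-insert a (unique-insert (t -ₚ a) uV))
                                                        (UniqueP.filter⁺ (¬? ∘ inSum? (V⁺ a)) uT)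
                                                        (λ x∈ → proj₂ (∈-filter⁻ (¬? ∘ inSum? (V⁺ a)) {xs = t ∷ T} x∈))
                                                        (⊆-trans (filter-⊆ (¬? ∘ inSum? (V⁺ a)) (t ∷ T)) T⊆X)
                                                        (size′ (length-V⁺-≤ a) (length-T⁺ a)) ⟩
        q ^ length (V⁺ a) * ν ^ length (T⁺ a)      ≲⟨ *-mono (^-nonneg (length (V⁺ a)) 0≲q)
                                                        (0≲* (^-nonneg (D ℕ.+ D) 0≲μ) (^-nonneg (suc n) 0≲ν))
                                                        (^-antitone 0≲q q≲1 (length-V⁺ a)) (ν-loss (D ℕ.+ D) le) ⟩
        q ^ suc l * (μ ^ (D ℕ.+ D) * ν ^ suc n)    ≈⟨ solve 4 (λ q a m b → q :* a :* (m :* b) := a :* b :* (q :* m))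
                                                      refl q (q ^ l) (μ ^ (D ℕ.+ D)) (ν ^ suc n) ⟩
        q ^ l * ν ^ suc n * (q * μ ^ (D ℕ.+ D))    ∎
        where open ≲-Reasoning

      module _ {A : Subset p} (V⊆A : All (_∈ A) V) (T⊆A+A : All (SumSet p A) (t ∷ T)) (deg : ∀ u → degree X A u ≤ D)
               {a : Fin p} (a∈A : a ∈ A) (b∈A : (t -ₚ a) ∈ A) where

        private
          V⁺⊆A : ∀ {v} → v ∈ₗ V⁺ a → v ∈ A
          V⁺⊆A v∈ with ∈-insert⁻ a v∈
          ... | inj₁ refl = a∈A
          ... | inj₂ v∈′ with ∈-insert⁻ (t -ₚ a) v∈′
          ...   | inj₁ refl = b∈A
          ...   | inj₂ v∈V  = All.lookup V⊆A v∈V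

          -- An element covered only now has a or t - a as a summand, with the other summand in `A`.
          -- So the degrees of these two residues bound the loss from `T` by 2 D.
          new-summand : ∀ {x} → x ∈ₗ t ∷ T → InSum (V⁺ a) x → (x -ₚ a) ∈ A ⊎ (x -ₚ (t -ₚ a)) ∈ A
          new-summand x∈T x∈ with inSum⁻ x∈
          ... | v , w , v∈ , w∈ , eq with ∈-insert⁻ a v∈ | ∈-insert⁻ a w∈
          ... | inj₁ refl | _         = inj₁ (subst (_∈ A) (⊹⇒- eq) (V⁺⊆A w∈))
          ... | inj₂ _    | inj₁ refl = inj₁ (subst (_∈ A) (⊹⇒- (trans (⊹-comm a v) eq)) (V⁺⊆A v∈))
          ... | inj₂ v∈′  | inj₂ w∈′ with ∈-insert⁻ (t -ₚ a) v∈′ | ∈-insert⁻ (t -ₚ a) w∈′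
          ...   | inj₁ refl | _         = inj₂ (subst (_∈ A) (⊹⇒- eq) (V⁺⊆A w∈))
          ...   | inj₂ _    | inj₁ refl = inj₂ (subst (_∈ A) (⊹⇒- (trans (⊹-comm w v) eq)) (V⁺⊆A v∈))
          ...   | inj₂ v∈V  | inj₂ w∈V  = ⊥-elim (T∩V+V x∈T (inSum⁺ v∈V w∈V eq))

          degree-T : ∀ u → length (filter (λ x → (x -ₚ u) ∈? A) (t ∷ T)) ≤ D
          degree-T u = ℕP.≤-trans (length-mono-≤ (filter⁺ (λ x → (x -ₚ u) ∈? A) (λ x → (x -ₚ u) ∈? A) (λ { refl x∈ → x∈ }) T⊆X)) (deg u)

          T⁺-loss : suc n ≤ D ℕ.+ D ℕ.+ length (T⁺ a)
          T⁺-loss = ℕP.≤-trans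
            (length≤filters (λ x → (x -ₚ a) ∈? A) (λ x → (x -ₚ (t -ₚ a)) ∈? A) (¬? ∘ inSum? (V⁺ a)) (t ∷ T) classify)
            (ℕP.+-monoˡ-≤ (length (T⁺ a)) (ℕP.+-mono-≤ (degree-T a) (degree-T (t -ₚ a))))
            where
            classify : ∀ x → x ∈ₗ t ∷ T → (x -ₚ a) ∈ A ⊎ (x -ₚ (t -ₚ a)) ∈ A ⊎ ¬ InSum (V⁺ a) x
            classify x x∈T with inSum? (V⁺ a) x
            ... | no ∉ = inj₂ (inj₂ ∉)
            ... | yes ∈ with new-summand x∈T ∈
            ...   | inj₁ h = inj₁ h
            ...   | inj₂ h = inj₂ (inj₁ h)

        split-at : a ∈ₗ smaller t → Any (λ a → Generic a A) (smaller t) ⊎ Any (λ a → Special a A) exceptional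
        split-at a∈C with a ∈ₗ? exceptional
        ... | no a∉  = inj₁ (lose a∈C (a∉ , a∈A ∷ b∈A ∷ V⊆A , All.tail T⊆A+A , deg))
        ... | yes a∈ = inj₂ (lose a∈ (T⁺-loss , All.tabulate V⁺⊆A , AllP.filter⁺ (¬? ∘ inSum? (V⁺ a)) T⊆A+A , deg))

      -- A representation of t inside `A` supplies the choice of a. Recording it by its smaller
      -- member halves the number of generic choices, and this is what brings their total cost below
      -- 1.
      split : ∀ A → Covered V (t ∷ T) A → Any (λ a → Generic a A) (smaller t) ⊎ Any (λ a → Special a A) exceptional
      split A (V⊆A , T⊆A+A@((x , y , x∈A , y∈A , x+y≡t) ∷ _) , deg) with smaller-complete x y x+y≡t
      ... | inj₁ x∈C = split-at V⊆A T⊆A+A deg x∈A (subst (_∈ A) (⊹⇒- x+y≡t) y∈A) x∈C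
      ... | inj₂ y∈C = split-at V⊆A T⊆A+A deg y∈A (subst (_∈ A) (⊹⇒- (trans (⊹-comm y x) x+y≡t)) x∈A) y∈C

      conclusion : Pr (covered? V (t ∷ T)) ≲ q ^ l * ν ^ suc n
      conclusion = begin
        Pr (covered? V (t ∷ T))
          ≲⟨ Pr-⊎ (covered? V (t ∷ T)) some-generic? some-special? split ⟩
        Pr some-generic? + Pr some-special?
          ≲⟨ +-mono (Pr-Any (smaller t) some-generic? generic? (λ _ any → any))
                    (Pr-Any exceptional some-special? special? (λ _ any → any)) ⟩
        sumOver (smaller t) (λ a → Pr (generic? a)) + sumOver exceptional (λ a → Pr (special? a))
          ≲⟨ +-mono (sumOver-upper (smaller t) λ a _ → Pr-generic a) (sumOver-upper exceptional λ a _ → Pr-special a) ⟩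
        ⟦ c ⟧ * (q ^ l * ν ^ suc n * (q * q * μ)) + ⟦ s ⟧ * (q ^ l * ν ^ suc n * (q * μ ^ (D ℕ.+ D)))
          ≈⟨ solve 5 (λ c s w g h → c :* (w :* g) :+ s :* (w :* h) := w :* (c :* g :+ s :* h)) refl
               ⟦ c ⟧ ⟦ s ⟧ (q ^ l * ν ^ suc n) (q * q * μ) (q * μ ^ (D ℕ.+ D)) ⟩
        q ^ l * ν ^ suc n * (⟦ c ⟧ * (q * q * μ) + ⟦ s ⟧ * (q * μ ^ (D ℕ.+ D)))
          ≲⟨ *-monoʳ (q ^ l * ν ^ suc n) (0≲* (^-nonneg l 0≲q) (^-nonneg (suc n) 0≲ν))
               (budget c s (length-smaller t) (length-exceptional k T≤k V≤2k)) ⟩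
        q ^ l * ν ^ suc n * 1#
          ≈⟨ *-identityʳ _ ⟩
        q ^ l * ν ^ suc n ∎
        where
        open ≲-Reasoning
        c = length (smaller t)
        s = length exceptional
        some-generic? : Decidable (λ A → Any (λ a → Generic a A) (smaller t))
        some-generic? A = Any.any? (λ a → generic? a A) (smaller t)
        some-special? : Decidable (λ A → Any (λ a → Special a A) exceptional)
        some-special? A = Any.any? (λ a → special? a A) exceptional
        T≤k : suc n ≤ k
        T≤k = ℕP.*-cancelˡ-≤ 2 (ℕP.≤-trans (ℕP.m≤n+m _ l) size)
        V≤2k : l ≤ 2 ℕ.* k
        V≤2k = ℕP.≤-trans (ℕP.m≤m+n l _) size

    -- The recursion is on a bound for the length of `T`, because the next `T` may be a filtered
    -- list. With nothing left to cover, only the cost of `V` remains.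
    Pr-covered : ∀ m V T → length T ≤ m → Claim V T
    Pr-covered m V [] _ uV _ _ _ _ = begin
      Pr (covered? V [])             ≲⟨ Pr-mono (covered? V []) (λ A → All.all? (_∈? A) V) (λ A → proj₁) ⟩
      Pr (λ A → All.all? (_∈? A) V)  ≈⟨ Pr-⊆ V uV (λ A → All.all? (_∈? A) V) ⟩
      q ^ length V                   ≈⟨ sym (*-identityʳ _) ⟩
      q ^ length V * 1#              ∎
      where open ≲-Reasoning
    Pr-covered (suc m) V (t ∷ T) (s≤s T≤m) = Step.conclusion V t T
      λ V′ T′ T′≤T → Pr-covered m V′ T′ (ℕP.≤-trans T′≤T T≤m)

    module _ (uX : Unique X) (X≤k : length X ≤ k) where

      Pr-uncrowded : Pr (covered? [] X) ≲ ν ^ length X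
      Pr-uncrowded = ≲-respʳ (*-identityˡ _)
        (Pr-covered (length X) [] X ℕP.≤-refl [] uX (λ _ ()) ⊆-refl (ℕP.*-monoʳ-≤ 2 X≤k))

      -- A degree above `D` means that `A` contains D + 1 of the residues x - u, which are distinct.
      Pr-crowded : ∀ u (Q? : Decidable (λ (A : Subset p) → suc D ≤ degree X A u)) → Pr Q? ≲ q ^ suc D * ⟦ length X ℕ.^ suc D ⟧
      Pr-crowded u Q? = begin
        Pr Q?   ≲⟨ Pr-mono Q? Q′? (λ A le → [] , subst (suc D ≤_) (sym (length-filter-map (_∈? A) (_-ₚ u) X)) le) ⟩
        Pr Q′?  ≲⟨ Pr-many (suc D) Y [] (UniqueP.map⁺ (-ₚ-injective u) uX) [] (λ _ ()) Q′? ⟩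
        q ^ suc D * ⟦ length Y ℕ.^ suc D ⟧ ≈⟨ cong (λ z → q ^ suc D * ⟦ z ℕ.^ suc D ⟧) (ListP.length-map (_-ₚ u) X) ⟩
        q ^ suc D * ⟦ length X ℕ.^ suc D ⟧ ∎
        where
        open ≲-Reasoning
        Y = map (_-ₚ u) X
        Q′? : Decidable (λ A → All (_∈ A) [] × suc D ≤ length (filter (_∈? A) Y))
        Q′? A = All.all? (_∈? A) [] ×-dec (suc D ℕP.≤? length (filter (_∈? A) Y))

      Pr-contained : (Q? : Decidable (λ A → All (SumSet p A) X)) →
                     Pr Q? ≲ ⟦ p ⟧ * (q ^ suc D * ⟦ length X ℕ.^ suc D ⟧) + ν ^ length X
      Pr-contained Q? = begin
        Pr Q?                                    ≲⟨ Pr-⊎ Q? crowded? (covered? [] X) dichotomy ⟩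
        Pr crowded? + Pr (covered? [] X)         ≲⟨ +-mono (Pr-Any (allFin p) crowded? (λ u A → suc D ℕP.≤? degree X A u) (λ _ any → any)) Pr-uncrowded ⟩
        sumOver (allFin p) (λ u → Pr (λ A → suc D ℕP.≤? degree X A u)) + ν ^ length X
          ≲⟨ +-monoˡ (ν ^ length X) (sumOver-upper (allFin p) λ u _ → Pr-crowded u (λ A → suc D ℕP.≤? degree X A u)) ⟩
        ⟦ length (allFin p) ⟧ * (q ^ suc D * ⟦ length X ℕ.^ suc D ⟧) + ν ^ length X
          ≈⟨ cong (λ z → ⟦ z ⟧ * (q ^ suc D * ⟦ length X ℕ.^ suc D ⟧) + ν ^ length X) (ListP.length-tabulate {n = p} (λ i → i)) ⟩
        ⟦ p ⟧ * (q ^ suc D * ⟦ length X ℕ.^ suc D ⟧) + ν ^ length X ∎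
        where
        open ≲-Reasoning
        crowded? : Decidable (λ A → Any (λ u → suc D ≤ degree X A u) (allFin p))
        crowded? A = Any.any? (λ u → suc D ℕP.≤? degree X A u) (allFin p)
        dichotomy : ∀ A → All (SumSet p A) X → Any (λ u → suc D ≤ degree X A u) (allFin p) ⊎ Covered [] X A
        dichotomy A X⊆ with crowded? A
        ... | yes c = inj₁ c
        ... | no ¬c = inj₂ ([] , X⊆ , λ u → ℕP.≮⇒≥ λ D<deg → ¬c (lose (∈-allFin u) D<deg))

-- Union bound over all progressions

module ManyProgressions (R : OrderedRing) (p : ℕ) .{{nz : NonZero p}} (pr : Prime p) (s : InverseSqrt R p)
                        (k : ℕ) (k≤p : k ≤ p)
                        (k-small : (100 ℕ.* suc (4 ℕ.* (k ℕ.* suc k))) ℕ.* (100 ℕ.* suc (4 ℕ.* (k ℕ.* suc k))) ≤ p) where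
  open OrderedRingProperties R
  open InverseSqrtProperties R s
  open Expectation R q 0≲q q≲1
  open UpperBound R q 0≲q q≲1 p
  open Residues p

  progression : Fin p → Fin p → List (Fin p)
  progression b d = applyUpTo (apTerm p b d) k

  LongProgression : Subset p → Set
  LongProgression A = Any (λ b → Any (λ d → toℕ d ≢ 0 × All (SumSet p A) (progression b d)) (allFin p)) (allFin p)

  longProgression? : Decidable LongProgression
  longProgression? A = Any.any? (λ b → Any.any? (λ d → ¬? (toℕ d ℕP.≟ 0) ×-dec All.all? (sumSet? A) (progression b d)) (allFin p)) (allFin p)

  longProgression⁺ : ∀ A → HasAP p (SumSet p A) k → LongProgression A
  longProgression⁺ A (b , d , d≢0 , h) = lose (∈-allFin b) (lose (∈-allFin d) (d≢0 , AllP.applyUpTo⁺₁ (apTerm p b d) k λ {i} → h i))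

  -- These are 4/3 and 3/4, as `inv n` is 1 / (n + 1).
  μ ν : Carrier
  μ = ⟦ 4 ⟧ * inv 2
  ν = ⟦ 3 ⟧ * inv 3

  private
    3μ≡4 : ⟦ 3 ⟧ * μ ≡ ⟦ 4 ⟧
    3μ≡4 = trans (solve 3 (λ a b i → a :* (b :* i) := b :* (a :* i)) refl ⟦ 3 ⟧ ⟦ 4 ⟧ (inv 2))
      (trans (cong (⟦ 4 ⟧ *_) (invˡ 2)) (*-identityʳ _))

    4ν≡3 : ⟦ 4 ⟧ * ν ≡ ⟦ 3 ⟧
    4ν≡3 = trans (solve 3 (λ a b i → a :* (b :* i) := b :* (a :* i)) refl ⟦ 4 ⟧ ⟦ 3 ⟧ (inv 3))
      (trans (cong (⟦ 3 ⟧ *_) (invˡ 3)) (*-identityʳ _))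

    0≲μ : 0# ≲ μ
    0≲μ = 0≲* (⟦⟧-nonneg 4) (0≲inv 2)

    0≲ν : 0# ≲ ν
    0≲ν = 0≲* (⟦⟧-nonneg 3) (0≲inv 3)

    ν≲1 : ν ≲ 1#
    ν≲1 = ⟦⟧-cancel 3 (≲-respˡ (sym 4ν≡3) (≲-respʳ (sym (*-identityʳ _)) (⟦⟧-mono (ℕP.n≤1+n 3))))

    μν≡1 : μ * ν ≡ 1#
    μν≡1 = trans (solve 4 (λ a i b j → a :* i :* (b :* j) := (b :* i) :* (a :* j)) refl ⟦ 4 ⟧ (inv 2) ⟦ 3 ⟧ (inv 3))
      (trans (cong₂ _*_ (invˡ 2) (invˡ 3)) (*-identityˡ 1#))

    ⟦⟧^-cancel : ∀ m n {x y} → ⟦ suc m ⟧ ^ n * x ≲ ⟦ suc m ⟧ ^ n * y → x ≲ y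
    ⟦⟧^-cancel m zero le = ≲-respˡ (*-identityˡ _) (≲-respʳ (*-identityˡ _) le)
    ⟦⟧^-cancel m (suc n) le = ⟦⟧^-cancel m n (⟦⟧-cancel m (≲-respˡ (*-assoc _ _ _) (≲-respʳ (*-assoc _ _ _) le)))

    -- (4/3)^12 is about 31.6. The exponent is 2 D for D = 6.
    μ¹²≲32 : μ ^ 12 ≲ ⟦ 32 ⟧
    μ¹²≲32 = ⟦⟧^-cancel 2 12 (begin
      ⟦ 3 ⟧ ^ 12 * μ ^ 12     ≈⟨ sym (^-distrib-* ⟦ 3 ⟧ μ 12) ⟩
      (⟦ 3 ⟧ * μ) ^ 12        ≈⟨ cong (_^ 12) 3μ≡4 ⟩
      ⟦ 4 ⟧ ^ 12              ≈⟨ sym (⟦^⟧ 4 12) ⟩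
      ⟦ 4 ℕ.^ 12 ⟧            ≲⟨ ⟦⟧-mono (ℕP.≤ᵇ⇒≤ (4 ℕ.^ 12) (3 ℕ.^ 12 ℕ.* 32) _) ⟩
      ⟦ 3 ℕ.^ 12 ℕ.* 32 ⟧     ≈⟨ trans (⟦*⟧ (3 ℕ.^ 12) 32) (cong (_* ⟦ 32 ⟧) (⟦^⟧ 3 12)) ⟩
      ⟦ 3 ⟧ ^ 12 * ⟦ 32 ⟧     ∎)
      where open ≲-Reasoning

    ν³ⁿ2ⁿ≲1 : ∀ n → ν ^ (3 ℕ.* n) * ⟦ 2 ℕ.^ n ⟧ ≲ 1#
    ν³ⁿ2ⁿ≲1 n = begin
      ν ^ (3 ℕ.* n) * ⟦ 2 ℕ.^ n ⟧   ≈⟨ cong₂ _*_ (sym (^-assocʳ ν 3 n)) (⟦^⟧ 2 n) ⟩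
      (ν ^ 3) ^ n * ⟦ 2 ⟧ ^ n       ≈⟨ sym (^-distrib-* (ν ^ 3) ⟦ 2 ⟧ n) ⟩
      (ν ^ 3 * ⟦ 2 ⟧) ^ n           ≲⟨ ^-upper n (0≲* (^-nonneg 3 0≲ν) (⟦⟧-nonneg 2)) ν³2≲1 ⟩
      1#                            ∎
      where
      open ≲-Reasoning
      ν³2≲1 : ν ^ 3 * ⟦ 2 ⟧ ≲ 1#
      ν³2≲1 = ⟦⟧^-cancel 3 3 (begin
        ⟦ 4 ⟧ ^ 3 * (ν ^ 3 * ⟦ 2 ⟧)   ≈⟨ sym (*-assoc _ _ _) ⟩
        ⟦ 4 ⟧ ^ 3 * ν ^ 3 * ⟦ 2 ⟧     ≈⟨ cong (_* ⟦ 2 ⟧) (trans (sym (^-distrib-* ⟦ 4 ⟧ ν 3)) (trans (cong (_^ 3) 4ν≡3) (sym (⟦^⟧ 3 3)))) ⟩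
        ⟦ 27 ⟧ * ⟦ 2 ⟧                ≈⟨ sym (⟦*⟧ 27 2) ⟩
        ⟦ 54 ⟧                        ≲⟨ ⟦⟧-mono (ℕP.≤ᵇ⇒≤ 54 64 _) ⟩
        ⟦ 64 ⟧                        ≈⟨ trans (⟦^⟧ 4 3) (sym (*-identityʳ _)) ⟩
        ⟦ 4 ⟧ ^ 3 * 1#                ∎)

    S = 4 ℕ.* (k ℕ.* suc k)

    -- Everything is multiplied by 6. The c ≤ p/2 + 1 generic choices take 8 c q² ≤ 4 + 8 q,
    -- essentially two thirds; the exceptional ones take at most 6 · 32 · S q. Both remainders fit
    -- into 200 (1 + S) q, which `k-small` bounds by 2.
    budget : ∀ c s → c ℕ.+ c ≤ 2 ℕ.+ p → s ≤ S → ⟦ c ⟧ * (q * q * μ) + ⟦ s ⟧ * (q * μ ^ 12) ≲ 1#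
    budget c s 2c≤ s≤ = ⟦⟧-cancel 5 (begin
      ⟦ 6 ⟧ * (⟦ c ⟧ * (q * q * μ) + ⟦ s ⟧ * (q * μ ^ 12))
        ≈⟨ distribˡ _ _ _ ⟩
      ⟦ 6 ⟧ * (⟦ c ⟧ * (q * q * μ)) + ⟦ 6 ⟧ * (⟦ s ⟧ * (q * μ ^ 12))
        ≲⟨ +-mono main rest ⟩
      (⟦ 4 ⟧ + ⟦ 8 ⟧ * q) + ⟦ 192 ⟧ * (⟦ S ⟧ * q)
        ≲⟨ +-mono (+-monoʳ _ (*-monoˡ q 0≲q (⟦⟧-mono (ℕP.m≤m+n 8 192))))
                  (*-monoˡ (⟦ S ⟧ * q) (0≲* (⟦⟧-nonneg S) 0≲q) (⟦⟧-mono (ℕP.m≤m+n 192 8))) ⟩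
      (⟦ 4 ⟧ + ⟦ 200 ⟧ * q) + ⟦ 200 ⟧ * (⟦ S ⟧ * q)
        ≈⟨ cong (λ z → (⟦ 4 ⟧ + z * q) + z * (⟦ S ⟧ * q)) (⟦*⟧ 2 100) ⟩
      (⟦ 4 ⟧ + ⟦ 2 ⟧ * ⟦ 100 ⟧ * q) + ⟦ 2 ⟧ * ⟦ 100 ⟧ * (⟦ S ⟧ * q)
        ≈⟨ solve 5 (λ f t h s q → (f :+ t :* h :* q) :+ t :* h :* (s :* q) := f :+ t :* (h :* (con 1 :+ s) :* q)) refl ⟦ 4 ⟧ ⟦ 2 ⟧ ⟦ 100 ⟧ ⟦ S ⟧ q ⟩
      ⟦ 4 ⟧ + ⟦ 2 ⟧ * (⟦ 100 ⟧ * (1# + ⟦ S ⟧) * q)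
        ≈⟨ cong (λ z → ⟦ 4 ⟧ + ⟦ 2 ⟧ * (z * q)) (trans (cong (⟦ 100 ⟧ *_) (sym (⟦suc⟧ S))) (sym (⟦*⟧ 100 (suc S)))) ⟩
      ⟦ 4 ⟧ + ⟦ 2 ⟧ * (⟦ 100 ℕ.* suc S ⟧ * q)
        ≲⟨ +-monoʳ ⟦ 4 ⟧ (*-monoʳ ⟦ 2 ⟧ (⟦⟧-nonneg 2) (mq≲1 (100 ℕ.* suc S) k-small)) ⟩
      ⟦ 4 ⟧ + ⟦ 2 ⟧ * 1#
        ≈⟨ trans (cong (⟦ 4 ⟧ +_) (*-identityʳ _)) (trans (sym (⟦+⟧ 4 2)) (sym (*-identityʳ _))) ⟩
      ⟦ 6 ⟧ * 1# ∎)
      where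
      open ≲-Reasoning
      main : ⟦ 6 ⟧ * (⟦ c ⟧ * (q * q * μ)) ≲ ⟦ 4 ⟧ + ⟦ 8 ⟧ * q
      main = begin
        ⟦ 6 ⟧ * (⟦ c ⟧ * (q * q * μ))             ≈⟨ cong (_* (⟦ c ⟧ * (q * q * μ))) (⟦+⟧ 3 3) ⟩
        (⟦ 3 ⟧ + ⟦ 3 ⟧) * (⟦ c ⟧ * (q * q * μ))   ≈⟨ solve 4 (λ t c q m → (t :+ t) :* (c :* (q :* q :* m)) := (t :* m) :* ((c :+ c) :* (q :* q))) refl ⟦ 3 ⟧ ⟦ c ⟧ q μ ⟩
        ⟦ 3 ⟧ * μ * ((⟦ c ⟧ + ⟦ c ⟧) * (q * q))   ≈⟨ cong₂ (λ a b → a * (b * (q * q))) 3μ≡4 (sym (⟦+⟧ c c)) ⟩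
        ⟦ 4 ⟧ * (⟦ c ℕ.+ c ⟧ * (q * q))           ≲⟨ *-monoʳ ⟦ 4 ⟧ (⟦⟧-nonneg 4) (*-monoˡ (q * q) (0≲* 0≲q 0≲q) (⟦⟧-mono 2c≤)) ⟩
        ⟦ 4 ⟧ * (⟦ 2 ℕ.+ p ⟧ * (q * q))           ≈⟨ cong (λ z → ⟦ 4 ⟧ * (z * (q * q))) (⟦+⟧ 2 p) ⟩
        ⟦ 4 ⟧ * ((⟦ 2 ⟧ + ⟦ p ⟧) * (q * q))       ≈⟨ solve 4 (λ f t p q → f :* ((t :+ p) :* (q :* q)) := f :* (p :* (q :* q)) :+ f :* t :* (q :* q)) refl ⟦ 4 ⟧ ⟦ 2 ⟧ ⟦ p ⟧ q ⟩
        ⟦ 4 ⟧ * (⟦ p ⟧ * (q * q)) + ⟦ 4 ⟧ * ⟦ 2 ⟧ * (q * q) ≈⟨ cong₂ (λ a b → ⟦ 4 ⟧ * a + b * (q * q)) pq²≡1 (sym (⟦*⟧ 4 2)) ⟩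
        ⟦ 4 ⟧ * 1# + ⟦ 8 ⟧ * (q * q)              ≲⟨ +-mono (≲-reflexive (*-identityʳ _)) (*-monoʳ ⟦ 8 ⟧ (⟦⟧-nonneg 8) (≲-respʳ (*-identityʳ q) (*-monoʳ q 0≲q q≲1))) ⟩
        ⟦ 4 ⟧ + ⟦ 8 ⟧ * q                         ∎
      rest : ⟦ 6 ⟧ * (⟦ s ⟧ * (q * μ ^ 12)) ≲ ⟦ 192 ⟧ * (⟦ S ⟧ * q)
      rest = begin
        ⟦ 6 ⟧ * (⟦ s ⟧ * (q * μ ^ 12))            ≲⟨ *-monoʳ ⟦ 6 ⟧ (⟦⟧-nonneg 6) (*-mono (⟦⟧-nonneg s) (0≲* 0≲q (⟦⟧-nonneg 32)) (⟦⟧-mono s≤) (*-monoʳ q 0≲q μ¹²≲32)) ⟩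
        ⟦ 6 ⟧ * (⟦ S ⟧ * (q * ⟦ 32 ⟧))            ≈⟨ solve 4 (λ x s q y → x :* (s :* (q :* y)) := x :* y :* (s :* q)) refl ⟦ 6 ⟧ ⟦ S ⟧ q ⟦ 32 ⟧ ⟩
        ⟦ 6 ⟧ * ⟦ 32 ⟧ * (⟦ S ⟧ * q)              ≈⟨ cong (_* (⟦ S ⟧ * q)) (sym (⟦*⟧ 6 32)) ⟩
        ⟦ 192 ⟧ * (⟦ S ⟧ * q)                     ∎

    progression-unique : ∀ b d → toℕ d ≢ 0 → Unique (progression b d)
    progression-unique b d d≢0 = UniqueP.applyUpTo⁺₁ (apTerm p b d) k λ i<j j<k eq →
      ℕP.<⇒≢ i<j (apTerm-injective pr b d d≢0 (ℕP.<-≤-trans (ℕP.<-trans i<j j<k) k≤p) (ℕP.<-≤-trans j<k k≤p) eq)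

    β = ⟦ p ⟧ * (q ^ 7 * ⟦ k ℕ.^ 7 ⟧) + ν ^ k

    0≲β : 0# ≲ β
    0≲β = 0≲+ (0≲* (⟦⟧-nonneg p) (0≲* (^-nonneg 7 0≲q) (⟦⟧-nonneg (k ℕ.^ 7)))) (^-nonneg k 0≲ν)

    contains? : ∀ b d → Decidable (λ A → toℕ d ≢ 0 × All (SumSet p A) (progression b d))
    contains? b d A = ¬? (toℕ d ℕP.≟ 0) ×-dec All.all? (sumSet? A) (progression b d)

    length-progression : ∀ b d → length (progression b d) ≡ k
    length-progression b d = ListP.length-applyUpTo (apTerm p b d) k

    Pr-contains : ∀ b d → Pr (contains? b d) ≲ β
    Pr-contains b d = case toℕ d ℕP.≟ 0 of λ where
      (yes d≡0) → ≲-trans (Pr-impossible (contains? b d) λ A (d≢0 , _) → d≢0 d≡0) 0≲β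
      (no d≢0) → ≲-trans (Pr-mono (contains? b d) (λ A → All.all? (sumSet? A) (progression b d)) λ A → proj₂)
        (≲-respʳ (cong (λ z → ⟦ p ⟧ * (q ^ 7 * ⟦ z ℕ.^ 7 ⟧) + ν ^ z) (length-progression b d))
          (Covering.Pr-contained (progression b d) 6 k μ ν 0≲μ 0≲ν ν≲1 μν≡1 budget (progression-unique b d d≢0)
            (ℕP.≤-reflexive (length-progression b d)) (λ A → All.all? (sumSet? A) (progression b d))))

    length-allFin : length (allFin p) ≡ p
    length-allFin = ListP.length-tabulate {n = p} (λ i → i)

  Pr-longProgression : Pr longProgression? ≲ ⟦ k ℕ.^ 7 ⟧ * q + ⟦ p ℕ.* p ⟧ * ν ^ k
  Pr-longProgression = begin
    Pr longProgression?
      ≲⟨ Pr-Any (allFin p) longProgression? row? (λ _ any → any) ⟩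
    sumOver (allFin p) (λ b → Pr (row? b))
      ≲⟨ sumOver-upper (allFin p) (λ b _ → ≲-trans (Pr-Any (allFin p) (row? b) (contains? b) (λ _ any → any))
           (sumOver-upper (allFin p) λ d _ → Pr-contains b d)) ⟩
    ⟦ length (allFin p) ⟧ * (⟦ length (allFin p) ⟧ * β)
      ≈⟨ cong (λ z → ⟦ z ⟧ * (⟦ z ⟧ * β)) length-allFin ⟩
    ⟦ p ⟧ * (⟦ p ⟧ * β)
      -- As p³ q⁶ = 1, one factor q of q⁷ survives the union bounds; this fixes the degree cap at 6.
      ≈⟨ solve 4 (λ p q k n → p :* (p :* (p :* ((q :* (q :* (q :* (q :* (q :* (q :* (q :* con 1))))))) :* k) :+ n))
            := (p :* (q :* q)) :* (p :* (q :* q)) :* (p :* (q :* q)) :* (k :* q) :+ p :* p :* n) refl ⟦ p ⟧ q ⟦ k ℕ.^ 7 ⟧ (ν ^ k) ⟩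
    ⟦ p ⟧ * (q * q) * (⟦ p ⟧ * (q * q)) * (⟦ p ⟧ * (q * q)) * (⟦ k ℕ.^ 7 ⟧ * q) + ⟦ p ⟧ * ⟦ p ⟧ * ν ^ k
      ≈⟨ cong₂ (λ a b → a * a * a * (⟦ k ℕ.^ 7 ⟧ * q) + b * ν ^ k) pq²≡1 (sym (⟦*⟧ p p)) ⟩
    1# * 1# * 1# * (⟦ k ℕ.^ 7 ⟧ * q) + ⟦ p ℕ.* p ⟧ * ν ^ k
      ≈⟨ cong (_+ ⟦ p ℕ.* p ⟧ * ν ^ k) (solve 1 (λ z → con 1 :* con 1 :* con 1 :* z := z) refl (⟦ k ℕ.^ 7 ⟧ * q)) ⟩
    ⟦ k ℕ.^ 7 ⟧ * q + ⟦ p ℕ.* p ⟧ * ν ^ k ∎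
    where
    open ≲-Reasoning
    row? : ∀ b → Decidable (λ A → Any (λ d → toℕ d ≢ 0 × All (SumSet p A) (progression b d)) (allFin p))
    row? b A = Any.any? (λ d → contains? b d A) (allFin p)

  -- The progressions and `N` contribute p² N ≤ p³ ≤ 2^(3 L), and every three terms of a progression
  -- gain a factor 2 because (3/4)³ ≤ 1/2; hence the length 9 L.
  scaled-Pr-longProgression : ∀ N L → k ≡ 3 ℕ.* (3 ℕ.* L) → p ≤ 2 ℕ.^ L → N ≤ p →
                              (N ℕ.* k ℕ.^ 7) ℕ.* (N ℕ.* k ℕ.^ 7) ≤ p →
                              ⟦ N ⟧ * Pr longProgression? ≲ ⟦ 2 ⟧
  scaled-Pr-longProgression N L k≡ p≤ N≤p Nk-small = begin
    ⟦ N ⟧ * Pr longProgression?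
      ≲⟨ *-monoʳ ⟦ N ⟧ (⟦⟧-nonneg N) Pr-longProgression ⟩
    ⟦ N ⟧ * (⟦ k ℕ.^ 7 ⟧ * q + ⟦ p ℕ.* p ⟧ * ν ^ k)
      ≈⟨ solve 5 (λ n k q p v → n :* (k :* q :+ p :* v) := n :* k :* q :+ v :* (p :* n)) refl ⟦ N ⟧ ⟦ k ℕ.^ 7 ⟧ q ⟦ p ℕ.* p ⟧ (ν ^ k) ⟩
    ⟦ N ⟧ * ⟦ k ℕ.^ 7 ⟧ * q + ν ^ k * (⟦ p ℕ.* p ⟧ * ⟦ N ⟧)
      ≈⟨ cong₂ (λ a b → a * q + ν ^ k * b) (sym (⟦*⟧ N (k ℕ.^ 7))) (sym (⟦*⟧ (p ℕ.* p) N)) ⟩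
    ⟦ N ℕ.* k ℕ.^ 7 ⟧ * q + ν ^ k * ⟦ p ℕ.* p ℕ.* N ⟧
      ≲⟨ +-mono (mq≲1 (N ℕ.* k ℕ.^ 7) Nk-small) (*-monoʳ (ν ^ k) (^-nonneg k 0≲ν) (⟦⟧-mono p³≤)) ⟩
    1# + ν ^ k * ⟦ 2 ℕ.^ (3 ℕ.* L) ⟧
      ≲⟨ +-monoʳ 1# (≲-respˡ (cong (λ z → ν ^ z * ⟦ 2 ℕ.^ (3 ℕ.* L) ⟧) (sym k≡)) (ν³ⁿ2ⁿ≲1 (3 ℕ.* L))) ⟩
    1# + 1#
      ≈⟨ trans (cong₂ _+_ (sym ⟦1⟧) (sym ⟦1⟧)) (sym (⟦+⟧ 1 1)) ⟩
    ⟦ 2 ⟧ ∎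
    where
    open ≲-Reasoning
    p³≤ : p ℕ.* p ℕ.* N ≤ 2 ℕ.^ (3 ℕ.* L)
    p³≤ = ℕP.≤-trans (ℕP.*-mono-≤ (ℕP.*-mono-≤ p≤ p≤) (ℕP.≤-trans N≤p p≤)) (ℕP.≤-reflexive
      (trans (cong (ℕ._* 2 ℕ.^ L) (sym (ℕP.^-distribˡ-+-* 2 L L)))
        (trans (sym (ℕP.^-distribˡ-+-* 2 (L ℕ.+ L) L)) (cong (2 ℕ.^_) (trans (ℕP.+-assoc L L L) (cong (λ z → L ℕ.+ (L ℕ.+ z)) (sym (ℕP.+-identityʳ L))))))))

-- A + A contains an interval

quotient-< : ∀ d {a b r s} → r < d → a < b → d ℕ.* a ℕ.+ r < d ℕ.* b ℕ.+ s
quotient-< d {a} {b} {r} {s} r<d a<b = ℕP.<-≤-trans (ℕP.+-monoʳ-< (d ℕ.* a) r<d)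
  (ℕP.≤-trans (ℕP.≤-reflexive (trans (ℕP.+-comm (d ℕ.* a) d) (sym (ℕP.*-suc d a))))
    (ℕP.≤-trans (ℕP.*-monoʳ-≤ d a<b) (ℕP.m≤m+n (d ℕ.* b) s)))

quotient-unique : ∀ d {a b r s} → r < d → s < d → d ℕ.* a ℕ.+ r ≡ d ℕ.* b ℕ.+ s → a ≡ b
quotient-unique d {a} {b} r<d s<d eq with ℕP.<-cmp a b
... | tri< a<b _ _ = ⊥-elim (ℕP.<-irrefl eq (quotient-< d r<d a<b))
... | tri≈ _ a≡b _ = a≡b
... | tri> _ _ b<a = ⊥-elim (ℕP.<-irrefl (sym eq) (quotient-< d s<d b<a))

-- `W` is the length of a cell, `J` the number of cells, `n₀` the number of them that should be hit,
-- `r` the ratio J / n₀ and `m` an integer at least √p. The `M` intervals of length `k` lie in [0,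
-- W); the cells lie in the lower half of the residues.
module ManyIntervals (R : OrderedRing) (p : ℕ) .{{nz : NonZero p}} (is : InverseSqrt R p)
                     (W J n₀ r k M m : ℕ)
                     (1≤W : 1 ≤ W)
                     (fits : 2 ℕ.* W ℕ.* J ℕ.+ 2 ℕ.* W ℕ.* J ≤ p)
                     (Mk≤W : M ℕ.* k ≤ W) where
  open OrderedRingProperties R
  open InverseSqrtProperties R is
  open Expectation R q 0≲q q≲1
  open UpperBound R q 0≲q q≲1 p using (sumSet?)
  open Residues p

  private
    half : ℕ
    half = 2 ℕ.* W ℕ.* J

  -- Offset t in the j-th cell; consecutive cells are separated by gaps of length W.
  position : ℕ → ℕ → ℕ
  position j t = 2 ℕ.* W ℕ.* j ℕ.+ (W ℕ.+ t)

  -- As y < W ≤ position < p/2, the difference y - position wraps around exactly once and lands in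
  -- the upper half, which the first stage leaves unexposed.
  partner : ℕ → ℕ → ℕ → Fin p
  partner y j t = [_]ₚ p (p ℕ.+ y ∸ position j t)

  private
    position<half : ∀ {j t} → j < J → t < W → position j t < half
    position<half {j} {t} j<J t<W = ℕP.<-≤-trans
      (ℕP.+-monoʳ-< (2 ℕ.* W ℕ.* j) (ℕP.+-monoʳ-< W t<W))
      (ℕP.≤-trans (ℕP.≤-reflexive (rearrange W j)) (ℕP.*-monoʳ-≤ (2 ℕ.* W) j<J))
      where
      rearrange : ∀ W j → 2 ℕ.* W ℕ.* j ℕ.+ (W ℕ.+ W) ≡ 2 ℕ.* W ℕ.* suc j
      rearrange = solve-∀

    half≤p : half ≤ p
    half≤p = ℕP.≤-trans (ℕP.m≤m+n half half) fits

    position<p : ∀ {j t} → j < J → t < W → position j t < p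
    position<p j<J t<W = ℕP.<-≤-trans (position<half j<J t<W) half≤p

    y<position : ∀ {y} j t → y < W → y < position j t
    y<position j t y<W = ℕP.<-≤-trans y<W (ℕP.≤-trans (ℕP.m≤m+n W t) (ℕP.m≤n+m (W ℕ.+ t) (2 ℕ.* W ℕ.* j)))

    toℕ-partner : ∀ {y j t} → y < W → j < J → t < W → toℕ (partner y j t) ℕ.+ position j t ≡ p ℕ.+ y
    toℕ-partner {y} {j} {t} y<W j<J t<W = trans (cong (ℕ._+ position j t) (toℕ-[]-small
        (ℕP.+-cancelʳ-< (position j t) _ p (subst (_< p ℕ.+ position j t) (sym back) (ℕP.+-monoʳ-< p (y<position j t y<W))))))
      back
      where
      back : p ℕ.+ y ∸ position j t ℕ.+ position j t ≡ p ℕ.+ y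
      back = ℕP.m∸n+n≡m (ℕP.≤-trans (ℕP.<⇒≤ (position<p j<J t<W)) (ℕP.m≤m+n p y))

    half≤partner : ∀ {y j t} → y < W → j < J → t < W → half ≤ toℕ (partner y j t)
    half≤partner {y} {j} {t} y<W j<J t<W = ℕP.+-cancelʳ-≤ (position j t) half _ (begin
      half ℕ.+ position j t                     ≤⟨ ℕP.+-monoʳ-≤ half (ℕP.<⇒≤ (position<half j<J t<W)) ⟩
      half ℕ.+ half                             ≤⟨ fits ⟩
      p                                         ≤⟨ ℕP.m≤m+n p y ⟩
      p ℕ.+ y                                   ≡⟨ toℕ-partner y<W j<J t<W ⟨
      toℕ (partner y j t) ℕ.+ position j t      ∎)
      where open ℕP.≤-Reasoning

    sum-partner : ∀ {y j t} → j < J → t < W → [_]ₚ p (position j t) ⊹ partner y j t ≡ [_]ₚ p y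
    sum-partner {y} {j} {t} j<J t<W = trans ([[m]+n] (position j t) _) (trans ([m+[n]] (position j t) _)
      (trans (cong ([_]ₚ p) (trans (ℕP.m+[n∸m]≡n (ℕP.≤-trans (ℕP.<⇒≤ (position<p j<J t<W)) (ℕP.m≤m+n p y))) (ℕP.+-comm p y)))
             ([m+p] y)))

    -- Equal partners give 2 W j + (t + y′) = 2 W j′ + (t′ + y) with both remainders below 2 W, so
    -- quotients and remainders agree. The gaps between the cells leave room for the shift by y.
    partner-injective : ∀ {y y′ j j′ t t′} → y < W → y′ < W → j < J → j′ < J → t < W → t′ < W →
                        partner y j t ≡ partner y′ j′ t′ → j ≡ j′ × t ℕ.+ y′ ≡ t′ ℕ.+ y
    partner-injective {y} {y′} {j} {j′} {t} {t′} y<W y′<W j<J j′<J t<W t′<W eq = j≡j′ , t+y′≡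
      where
      c = toℕ (partner y j t)
      cross : position j′ t′ ℕ.+ y ≡ position j t ℕ.+ y′
      cross = ℕP.+-cancelˡ-≡ p _ _ (begin
        p ℕ.+ (position j′ t′ ℕ.+ y)                   ≡⟨ swap p (position j′ t′) y ⟩
        position j′ t′ ℕ.+ (p ℕ.+ y)                   ≡⟨ cong (position j′ t′ ℕ.+_) (sym (toℕ-partner y<W j<J t<W)) ⟩
        position j′ t′ ℕ.+ (c ℕ.+ position j t)        ≡⟨ swap′ (position j′ t′) c (position j t) ⟩
        position j t ℕ.+ (c ℕ.+ position j′ t′)        ≡⟨ cong (λ z → position j t ℕ.+ (toℕ z ℕ.+ position j′ t′)) eq ⟩
        position j t ℕ.+ (toℕ (partner y′ j′ t′) ℕ.+ position j′ t′) ≡⟨ cong (position j t ℕ.+_) (toℕ-partner y′<W j′<J t′<W) ⟩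
        position j t ℕ.+ (p ℕ.+ y′)                    ≡⟨ swap p (position j t) y′ ⟨
        p ℕ.+ (position j t ℕ.+ y′)                    ∎)
        where
        open ≡-Reasoning
        swap : ∀ a b c → a ℕ.+ (b ℕ.+ c) ≡ b ℕ.+ (a ℕ.+ c)
        swap = solve-∀
        swap′ : ∀ a b c → a ℕ.+ (b ℕ.+ c) ≡ c ℕ.+ (b ℕ.+ a)
        swap′ = solve-∀
      reduced : 2 ℕ.* W ℕ.* j ℕ.+ (t ℕ.+ y′) ≡ 2 ℕ.* W ℕ.* j′ ℕ.+ (t′ ℕ.+ y)
      reduced = ℕP.+-cancelˡ-≡ W _ _ (trans (shift W (2 ℕ.* W ℕ.* j) t y′) (trans (sym cross) (sym (shift W (2 ℕ.* W ℕ.* j′) t′ y))))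
        where
        shift : ∀ W a t y → W ℕ.+ (a ℕ.+ (t ℕ.+ y)) ≡ a ℕ.+ (W ℕ.+ t) ℕ.+ y
        shift = solve-∀
      small : ∀ {t y} → t < W → y < W → t ℕ.+ y < 2 ℕ.* W
      small t<W y<W = ℕP.<-≤-trans (ℕP.+-mono-< t<W y<W) (ℕP.≤-reflexive (cong (W ℕ.+_) (sym (ℕP.+-identityʳ W))))
      j≡j′ : j ≡ j′
      j≡j′ = quotient-unique (2 ℕ.* W) (small t<W y′<W) (small t′<W y<W) reduced
      t+y′≡ : t ℕ.+ y′ ≡ t′ ℕ.+ y
      t+y′≡ = ℕP.+-cancelˡ-≡ (2 ℕ.* W ℕ.* j) _ _ (trans reduced (cong (λ z → 2 ℕ.* W ℕ.* z ℕ.+ (t′ ℕ.+ y)) (sym j≡j′)))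

  Hit : Subset p → ℕ → Set
  Hit u j = Any (λ t → [_]ₚ p (position j t) ∈ u) (upTo W)

  hit? : ∀ u → Decidable (Hit u)
  hit? u j = Any.any? (λ t → [_]ₚ p (position j t) ∈? u) (upTo W)

  hits : Subset p → ℕ
  hits u = length (filter (hit? u) (upTo J))

  private
    -- One element is fixed per hit cell, so that different cells and sites read different
    -- coordinates. The default 0 for a missed cell keeps all offsets below `W`, given W ≥ 1.
    centre : ∀ {u j} → Dec (Hit u j) → ℕ
    centre (yes h) = proj₁ (find h)
    centre (no _)  = 0

    centre<W : ∀ {u j} (d : Dec (Hit u j)) → centre d < W
    centre<W (yes h) = ∈-upTo⁻ (proj₁ (proj₂ (find h)))
    centre<W (no _)  = 1≤W

    factor : ∀ {u} y j → Dec (Hit u j) → Poly p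
    factor y j (yes h) = compl (var (partner y j (centre (yes h))))
    factor y j (no _)  = const 1#

    occurs-factor : ∀ {u} y j (d : Dec (Hit u j)) {c} → Occurs c (factor y j d) → c ≡ partner y j (centre d)
    occurs-factor y j (yes h) c≡ = c≡

    readOnce-factor : ∀ {u} y j (d : Dec (Hit u j)) → ReadOnce (factor y j d)
    readOnce-factor y j (yes h) = tt
    readOnce-factor y j (no _)  = tt

    -- For fixed `u`, this and the next two polynomials indicate in terms of the second stage: no
    -- centre represents the site y; every site of an interval is represented; this happens for no
    -- interval.
    uncovered : Subset p → ℕ → Poly p
    uncovered u y = prod (upTo J) (λ j → factor y j (hit? u j))

    block : Subset p → ℕ → Poly p
    block u i = prod (upTo k) (λ x → compl (uncovered u (i ℕ.* k ℕ.+ x)))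

    noBlock : Subset p → Poly p
    noBlock u = prod (upTo M) (λ i → compl (block u i))

    site<W : ∀ {i x} → i < M → x < k → i ℕ.* k ℕ.+ x < W
    site<W {i} {x} i<M x<k = ℕP.<-≤-trans (ℕP.+-monoʳ-< (i ℕ.* k) x<k)
      (ℕP.≤-trans (ℕP.≤-trans (ℕP.≤-reflexive (ℕP.+-comm (i ℕ.* k) k)) (ℕP.*-monoˡ-≤ k i<M)) Mk≤W)

    -- A coordinate determines its cell, hence the centre, hence the site; this is what makes the
    -- sites independent.
    occurs-uncovered : ∀ u {y y′ c} → y < W → y′ < W → Occurs c (uncovered u y) → Occurs c (uncovered u y′) → y ≡ y′
    occurs-uncovered u {y} {y′} y<W y′<W o o′
      with occurs-prod (upTo J) (λ j → factor y j (hit? u j)) o | occurs-prod (upTo J) (λ j → factor y′ j (hit? u j)) o′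
    ... | j , j∈ , c≡ | j′ , j′∈ , c≡′
      with partner-injective y<W y′<W (∈-upTo⁻ j∈) (∈-upTo⁻ j′∈) (centre<W (hit? u j)) (centre<W (hit? u j′))
             (trans (sym (occurs-factor y j (hit? u j) c≡)) (occurs-factor y′ j′ (hit? u j′) c≡′))
    ... | refl , eq = sym (ℕP.+-cancelˡ-≡ (centre (hit? u j)) _ _ eq)

    readOnce-uncovered : ∀ u y → y < W → ReadOnce (uncovered u y)
    readOnce-uncovered u y y<W = readOnce-prod (UniqueP.upTo⁺ J) (λ j _ → readOnce-factor y j (hit? u j))
      λ j j′ c j∈ j′∈ o o′ → proj₁ (partner-injective y<W y<W (∈-upTo⁻ j∈) (∈-upTo⁻ j′∈) (centre<W (hit? u j)) (centre<W (hit? u j′))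
             (trans (sym (occurs-factor y j (hit? u j) o)) (occurs-factor y j′ (hit? u j′) o′)))

    readOnce-block : ∀ u i → i < M → ReadOnce (block u i)
    readOnce-block u i i<M = readOnce-prod (UniqueP.upTo⁺ k) (λ x x∈ → readOnce-uncovered u _ (site<W i<M (∈-upTo⁻ x∈)))
      λ x x′ c x∈ x′∈ o o′ → ℕP.+-cancelˡ-≡ (i ℕ.* k) _ _
        (occurs-uncovered u (site<W i<M (∈-upTo⁻ x∈)) (site<W i<M (∈-upTo⁻ x′∈)) o o′)

    readOnce-noBlock : ∀ u → ReadOnce (noBlock u)
    readOnce-noBlock u = readOnce-prod (UniqueP.upTo⁺ M) (λ i i∈ → readOnce-block u i (∈-upTo⁻ i∈)) disjoint
      where
      disjoint : ∀ i i′ c → i ∈ₗ upTo M → i′ ∈ₗ upTo M → Occurs c (block u i) → Occurs c (block u i′) → i ≡ i′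
      disjoint i i′ c i∈ i′∈ o o′
        with occurs-prod (upTo k) (λ x → compl (uncovered u (i ℕ.* k ℕ.+ x))) o
           | occurs-prod (upTo k) (λ x → compl (uncovered u (i′ ℕ.* k ℕ.+ x))) o′
      ... | x , x∈ , ox | x′ , x′∈ , ox′ = quotient-unique k (∈-upTo⁻ x∈) (∈-upTo⁻ x′∈)
        (trans (cong (ℕ._+ x) (ℕP.*-comm k i)) (trans
          (occurs-uncovered u (site<W (∈-upTo⁻ i∈) (∈-upTo⁻ x∈)) (site<W (∈-upTo⁻ i′∈) (∈-upTo⁻ x′∈)) ox ox′)
          (cong (ℕ._+ x′) (ℕP.*-comm i′ k))))

    value-uncovered : ∀ u y → value (uncovered u y) ≡ (1- q) ^ hits u
    value-uncovered u y = go (upTo J)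
      where
      go : ∀ L → value (prod L (λ j → factor y j (hit? u j))) ≡ (1- q) ^ length (filter (hit? u) L)
      go [] = refl
      go (j ∷ L) with hit? u j
      ... | yes h = cong (1- q *_) (go L)
      ... | no _  = trans (*-identityˡ _) (go L)

    value-noBlock : ∀ u → value (noBlock u) ≡ (1- ((1- ((1- q) ^ hits u)) ^ k)) ^ M
    value-noBlock u = trans (value-prod (upTo M) _ (1- ((1- ((1- q) ^ hits u)) ^ k)) λ i → cong 1-_
        (trans (value-prod (upTo k) _ (1- ((1- q) ^ hits u)) λ x → cong 1-_ (value-uncovered u (i ℕ.* k ℕ.+ x)))
          (cong ((1- ((1- q) ^ hits u)) ^_) (ListP.length-upTo k))))
      (cong ((1- ((1- ((1- q) ^ hits u)) ^ k)) ^_) (ListP.length-upTo M))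

  Interval : Subset p → ℕ → Set
  Interval A i = All (λ x → SumSet p A ([_]ₚ p (i ℕ.* k ℕ.+ x))) (upTo k)

  NoInterval : Subset p → Set
  NoInterval A = All (λ i → ¬ Interval A i) (upTo M)

  interval? : ∀ A → Decidable (Interval A)
  interval? A i = All.all? (λ x → sumSet? A ([_]ₚ p (i ℕ.* k ℕ.+ x))) (upTo k)

  noInterval? : Decidable NoInterval
  noInterval? A = All.all? (¬? ∘ interval? A) (upTo M)

  private
    lower : Fin p → Bool
    lower c = does (toℕ c ℕP.<? half)

    ∈-merge-lower : ∀ {u v c} → toℕ c < half → c ∈ u → c ∈ merge lower u v
    ∈-merge-lower {u} {v} {c} c< c∈u = VecP.lookup⇒[]= c _ (trans (lookup-merge lower u v c)
      (trans (cong (if_then lookup u c else lookup v c) (dec-true (toℕ c ℕP.<? half) c<)) (VecP.[]=⇒lookup c∈u)))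

    ∈-merge-upper : ∀ {u v c} → half ≤ toℕ c → c ∈ v → c ∈ merge lower u v
    ∈-merge-upper {u} {v} {c} c≥ c∈v = VecP.lookup⇒[]= c _ (trans (lookup-merge lower u v c)
      (trans (cong (if_then lookup u c else lookup v c) (dec-false (toℕ c ℕP.<? half) (ℕP.≤⇒≯ c≥))) (VecP.[]=⇒lookup c∈v)))

    Avoids : ∀ {u} → ℕ → ∀ j → Dec (Hit u j) → Subset p → Set
    Avoids y j (yes h) v = ¬ partner y j (centre (yes h)) ∈ v
    Avoids y j (no _)  v = ⊤

    indicates-factor : ∀ {u} y j (d : Dec (Hit u j)) v → Indicates (eval (factor y j d) v) (Avoids y j d v)
    indicates-factor y j (yes h) v = indicates-¬ (indicates-var (partner y j (centre (yes h))) v)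
    indicates-factor y j (no _)  v = holds tt refl

    avoids? : ∀ {u} y j (d : Dec (Hit u j)) v → Dec (Avoids y j d v)
    avoids? y j (yes h) v = ¬? (partner y j (centre (yes h)) ∈? v)
    avoids? y j (no _)  v = yes tt

    caught⇒∈ : ∀ {u v y j} (d : Dec (Hit u j)) → y < W → j < J → ¬ Avoids y j d v → SumSet p (merge lower u v) ([_]ₚ p y)
    caught⇒∈ (no _) y<W j<J ¬avoids = ⊥-elim (¬avoids tt)
    caught⇒∈ {u} {v} {y} {j} (yes h) y<W j<J ¬avoids =
      [_]ₚ p (position j t) , partner y j t ,
      ∈-merge-lower {u} {v} (subst (_< half) (sym (toℕ-[]-small (position<p j<J t<W))) (position<half j<J t<W)) (proj₂ (proj₂ (find h))) ,
      ∈-merge-upper {u} {v} (half≤partner y<W j<J t<W) (decidable-stable (partner y j t ∈? v) ¬avoids) ,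
      sum-partner j<J t<W
      where
      t = centre {u} {j} (yes h)
      t<W = centre<W {u} {j} (yes h)

    covered⇒∈ : ∀ {u v y} → y < W → ¬ All (λ j → Avoids y j (hit? u j) v) (upTo J) → SumSet p (merge lower u v) ([_]ₚ p y)
    covered⇒∈ {u} {v} {y} y<W ¬all with find (AllP.¬All⇒Any¬ (λ j → avoids? y j (hit? u j) v) (upTo J) ¬all)
    ... | j , j∈ , caught = caught⇒∈ (hit? u j) y<W (∈-upTo⁻ j∈) caught

    -- Only an inequality, since a site may also lie in A + A through sums of other elements.
    noInterval⇒noBlock : ∀ u v → ind (noInterval? (merge lower u v)) ≲ eval (noBlock u) v
    noInterval⇒noBlock u v = ind-≲ (noInterval? (merge lower u v)) (eval-nonneg indicator)
      (λ none → eval-1 indicator (All.tabulate λ {i} i∈ all → All.lookup none i∈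
        (All.tabulate λ {x} x∈ → covered⇒∈ (site<W (∈-upTo⁻ i∈) (∈-upTo⁻ x∈)) (All.lookup all x∈))))
      where
      indicator : Indicates (eval (noBlock u) v)
        (All (λ i → ¬ All (λ x → ¬ All (λ j → Avoids (i ℕ.* k ℕ.+ x) j (hit? u j) v) (upTo J)) (upTo k)) (upTo M))
      indicator = indicates-prod (upTo M) _ v λ i → indicates-¬ (indicates-prod (upTo k) _ v λ x →
        indicates-¬ (indicates-prod (upTo J) _ v λ j → indicates-factor (i ℕ.* k ℕ.+ x) j (hit? u j) v))
      eval-nonneg : ∀ {x} {Q : Set} → Indicates x Q → 0# ≲ x
      eval-nonneg (holds _ refl) = 0≲1
      eval-nonneg (fails _ refl) = ≲-refl
      eval-1 : ∀ {x} {Q : Set} → Indicates x Q → Q → 1# ≲ x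
      eval-1 (holds _ refl) Q = ≲-refl
      eval-1 (fails ¬Q _)   Q = ⊥-elim (¬Q Q)

    E-noInterval : ∀ u → E (λ v → ind (noInterval? (merge lower u v))) ≲ (1- ((1- ((1- q) ^ hits u)) ^ k)) ^ M
    E-noInterval u = ≲-trans (E-mono (noInterval⇒noBlock u))
      (≲-reflexive (trans (E-eval (noBlock u) (readOnce-noBlock u)) (value-noBlock u)))

  -- Exponential moment of the number of cells hit

  private
    ½ : Carrier
    ½ = inv 1

    ½+½≡1 : ½ + ½ ≡ 1#
    ½+½≡1 = trans (solve 1 (λ h → h :+ h := (con 1 :+ con 1) :* h) refl ½)
      (trans (cong (_* ½) (trans (cong₂ _+_ (sym ⟦1⟧) (sym ⟦1⟧)) (sym (⟦+⟧ 1 1)))) (invˡ 1))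

    0≲½ : 0# ≲ ½
    0≲½ = 0≲inv 1

    miss : ℕ → Poly p
    miss j = prod (upTo W) (λ t → compl (var ([_]ₚ p (position j t))))

    -- A missed cell contributes 1 and a hit cell 1/2, so this is 2^(-hits) in read-once form, and
    -- its expectation factors over the cells.
    damping : Poly p
    damping = prod (upTo J) (λ j → add (const ½) (mul (const ½) (miss j)))

    η z : Carrier
    η = (1- q) ^ W
    z = ½ + ½ * η

    position-injective : ∀ {j j′ t t′} → j < J → j′ < J → t < W → t′ < W →
                         [_]ₚ p (position j t) ≡ [_]ₚ p (position j′ t′) → j ≡ j′ × t ≡ t′
    position-injective {j} {j′} {t} {t′} j<J j′<J t<W t′<W eq = j≡j′ ,
        ℕP.+-cancelˡ-≡ W _ _ (ℕP.+-cancelˡ-≡ (2 ℕ.* W ℕ.* j) _ _ (trans eq′ (cong (λ i → position i t′) (sym j≡j′))))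
      where
      eq′ : position j t ≡ position j′ t′
      eq′ = trans (sym (toℕ-[]-small (position<p j<J t<W))) (trans (cong toℕ eq) (toℕ-[]-small (position<p j′<J t′<W)))
      small : ∀ {t} → t < W → W ℕ.+ t < 2 ℕ.* W
      small t<W = ℕP.<-≤-trans (ℕP.+-monoʳ-< W t<W) (ℕP.≤-reflexive (cong (W ℕ.+_) (sym (ℕP.+-identityʳ W))))
      j≡j′ : j ≡ j′
      j≡j′ = quotient-unique (2 ℕ.* W) (small t<W) (small t′<W) eq′

    readOnce-damping : ReadOnce damping
    readOnce-damping = readOnce-prod (UniqueP.upTo⁺ J)
      (λ j j∈ → tt , tt , readOnce-prod (UniqueP.upTo⁺ W) (λ _ _ → tt) (λ { t t′ c t∈ t′∈ refl o →
          proj₂ (position-injective (∈-upTo⁻ j∈) (∈-upTo⁻ j∈) (∈-upTo⁻ t∈) (∈-upTo⁻ t′∈) o) }) , λ _ ())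
      disjoint
      where
      disjoint : ∀ j j′ c → j ∈ₗ upTo J → j′ ∈ₗ upTo J → ⊥ ⊎ ⊥ ⊎ Occurs c (miss j) → ⊥ ⊎ ⊥ ⊎ Occurs c (miss j′) → j ≡ j′
      disjoint j j′ c j∈ j′∈ (inj₂ (inj₂ o)) (inj₂ (inj₂ o′))
        with occurs-prod (upTo W) (λ t → compl (var ([_]ₚ p (position j t)))) o
           | occurs-prod (upTo W) (λ t → compl (var ([_]ₚ p (position j′ t)))) o′
      ... | t , t∈ , refl | t′ , t′∈ , o″ =
        proj₁ (position-injective (∈-upTo⁻ j∈) (∈-upTo⁻ j′∈) (∈-upTo⁻ t∈) (∈-upTo⁻ t′∈) o″)

    E-damping : E (eval damping) ≡ z ^ J
    E-damping = trans (E-eval damping readOnce-damping)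
      (trans (value-prod (upTo J) _ z (λ j → cong (λ e → ½ + ½ * e)
        (trans (value-prod (upTo W) _ (1- q) (λ _ → refl)) (cong ((1- q) ^_) (ListP.length-upTo W)))))
      (cong (z ^_) (ListP.length-upTo J)))

    eval-damping : ∀ u → eval damping u ≡ ½ ^ hits u
    eval-damping u = go (upTo J)
      where
      indicates-miss : ∀ j → Indicates (eval (miss j) u) (All (λ t → ¬ [_]ₚ p (position j t) ∈ u) (upTo W))
      indicates-miss j = indicates-prod (upTo W) _ u λ t → indicates-¬ (indicates-var ([_]ₚ p (position j t)) u)
      go : ∀ L → eval (prod L (λ j → add (const ½) (mul (const ½) (miss j)))) u ≡ ½ ^ length (filter (hit? u) L)
      go [] = refl
      go (j ∷ L) with hit? u j | indicates-miss j
      ... | yes h | holds none _  = ⊥-elim (AllP.All¬⇒¬Any none h)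
      ... | yes h | fails _ eq    = cong₂ _*_ (trans (cong (λ e → ½ + ½ * e) eq) (trans (cong (½ +_) (zeroʳ ½)) (+-identityʳ ½))) (go L)
      ... | no ¬h | fails ¬none _ = ⊥-elim (¬none (AllP.¬Any⇒All¬ (upTo W) ¬h))
      ... | no ¬h | holds _ eq    = trans (cong₂ _*_ (trans (cong (λ e → ½ + ½ * e) eq) (trans (cong (½ +_) (*-identityʳ ½)) ½+½≡1)) (go L))
                                      (*-identityˡ _)

  module Estimate (M≡ : M ≡ 2 ℕ.^ (10 ℕ.* k)) (J≡ : J ≡ r ℕ.* n₀) (W²≤p : W ℕ.* W ≤ p)
                  (p≤m² : p ≤ m ℕ.* m) (16m≤rW : 16 ℕ.* m ≤ r ℕ.* W) (m≤256n₀ : m ≤ 256 ℕ.* n₀) where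

    private
      0≲1-q : 0# ≲ 1- q
      0≲1-q = 1-nonneg q≲1

      1-q≲1 : 1- q ≲ 1#
      1-q≲1 = 1-upper 0≲q

      -- As n₀ q ≥ 1/256, Bernoulli's inequality gives (1 - q)^n₀ ≤ 256/257, so a site is covered
      -- with probability at least 1/257 ≥ 2^(-9).
      covered-often : ∀ n → n₀ ≤ n → 1# ≲ ⟦ 2 ℕ.^ 9 ⟧ * 1- ((1- q) ^ n)
      covered-often n n₀≤n = ≲-trans (+-cancelʳ (⟦ 257 ⟧ * y) (begin
          1# + ⟦ 257 ⟧ * y              ≲⟨ +-monoʳ 1# 257y≲256 ⟩
          1# + ⟦ 256 ⟧                  ≈⟨ sym (⟦suc⟧ 256) ⟩
          ⟦ 257 ⟧                       ≈⟨ sym (*-identityʳ _) ⟩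
          ⟦ 257 ⟧ * 1#                  ≈⟨ cong (⟦ 257 ⟧ *_) (sym (x+1-x y)) ⟩
          ⟦ 257 ⟧ * (y + 1- y)          ≈⟨ trans (distribˡ _ _ _) (+-comm _ _) ⟩
          ⟦ 257 ⟧ * 1- y + ⟦ 257 ⟧ * y  ∎))
        (*-monoˡ (1- y) (1-nonneg (^-upper n 0≲1-q 1-q≲1)) (⟦⟧-mono (ℕP.≤ᵇ⇒≤ 257 512 _)))
        where
        open ≲-Reasoning
        y  = (1- q) ^ n
        y₀ = (1- q) ^ n₀
        1≲256n₀q : 1# ≲ ⟦ 256 ⟧ * (⟦ n₀ ⟧ * q)
        1≲256n₀q = begin
          1#                         ≲⟨ 1≲mq m p≤m² ⟩
          ⟦ m ⟧ * q                  ≲⟨ *-monoˡ q 0≲q (⟦⟧-mono m≤256n₀) ⟩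
          ⟦ 256 ℕ.* n₀ ⟧ * q         ≈⟨ trans (cong (_* q) (⟦*⟧ 256 n₀)) (*-assoc _ _ _) ⟩
          ⟦ 256 ⟧ * (⟦ n₀ ⟧ * q)     ∎
        257y≲256 : ⟦ 257 ⟧ * y ≲ ⟦ 256 ⟧
        257y≲256 = begin
          ⟦ 257 ⟧ * y                                    ≲⟨ *-monoʳ ⟦ 257 ⟧ (⟦⟧-nonneg 257) (^-antitone 0≲1-q 1-q≲1 n₀≤n) ⟩
          ⟦ 257 ⟧ * y₀                                   ≈⟨ trans (cong (_* y₀) (⟦suc⟧ 256)) (solve 2 (λ t y → (con 1 :+ t) :* y := t :* y :+ con 1 :* y) refl ⟦ 256 ⟧ y₀) ⟩
          ⟦ 256 ⟧ * y₀ + 1# * y₀                         ≲⟨ +-monoʳ _ (*-monoˡ y₀ (^-nonneg n₀ 0≲1-q) 1≲256n₀q) ⟩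
          ⟦ 256 ⟧ * y₀ + ⟦ 256 ⟧ * (⟦ n₀ ⟧ * q) * y₀     ≈⟨ solve 3 (λ t y x → t :* y :+ t :* x :* y := t :* (y :* (con 1 :+ x))) refl ⟦ 256 ⟧ y₀ (⟦ n₀ ⟧ * q) ⟩
          ⟦ 256 ⟧ * (y₀ * (1# + ⟦ n₀ ⟧ * q))             ≲⟨ *-monoʳ ⟦ 256 ⟧ (⟦⟧-nonneg 256) (bernoulli n₀ (x+1-x q) 0≲q 0≲1-q) ⟩
          ⟦ 256 ⟧ * 1#                                   ≈⟨ *-identityʳ _ ⟩
          ⟦ 256 ⟧                                        ∎

      -- An interval is covered with probability x ≥ 2^(-9 k). So M x ≥ 2^k for M = 2^(10 k), and (1
      -- - x)^M ≤ 1 / (1 + M x).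
      no-block-rare : ∀ n → n₀ ≤ n → ⟦ 2 ℕ.^ k ⟧ * (1- ((1- ((1- q) ^ n)) ^ k)) ^ M ≲ 1#
      no-block-rare n n₀≤n = begin
        ⟦ 2 ℕ.^ k ⟧ * (1- x) ^ M           ≈⟨ *-comm _ _ ⟩
        (1- x) ^ M * ⟦ 2 ℕ.^ k ⟧           ≲⟨ *-monoʳ ((1- x) ^ M) (^-nonneg M 0≲1-x) (≲-trans 2ᵏ≲Mx (x≲y+x 0≲1)) ⟩
        (1- x) ^ M * (1# + ⟦ M ⟧ * x)      ≲⟨ bernoulli M (x+1-x x) 0≲x 0≲1-x ⟩
        1#                                 ∎
        where
        open ≲-Reasoning
        c = 1- ((1- q) ^ n)
        x = c ^ k
        0≲c : 0# ≲ c
        0≲c = 1-nonneg (^-upper n 0≲1-q 1-q≲1)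
        0≲x : 0# ≲ x
        0≲x = ^-nonneg k 0≲c
        0≲1-x : 0# ≲ 1- x
        0≲1-x = 1-nonneg (^-upper k 0≲c (1-upper (^-nonneg n 0≲1-q)))
        2ᵏ≲Mx : ⟦ 2 ℕ.^ k ⟧ ≲ ⟦ M ⟧ * x
        2ᵏ≲Mx = begin
          ⟦ 2 ℕ.^ k ⟧                                    ≈⟨ sym (*-identityʳ _) ⟩
          ⟦ 2 ℕ.^ k ⟧ * 1#                               ≲⟨ *-monoʳ _ (⟦⟧-nonneg (2 ℕ.^ k)) (^-lower k (covered-often n n₀≤n)) ⟩
          ⟦ 2 ℕ.^ k ⟧ * (⟦ 2 ℕ.^ 9 ⟧ * c) ^ k            ≈⟨ cong (⟦ 2 ℕ.^ k ⟧ *_) (^-distrib-* ⟦ 2 ℕ.^ 9 ⟧ c k) ⟩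
          ⟦ 2 ℕ.^ k ⟧ * (⟦ 2 ℕ.^ 9 ⟧ ^ k * x)            ≈⟨ sym (*-assoc _ _ _) ⟩
          ⟦ 2 ℕ.^ k ⟧ * ⟦ 2 ℕ.^ 9 ⟧ ^ k * x              ≈⟨ cong (λ e → ⟦ 2 ℕ.^ k ⟧ * e * x) (sym (⟦^⟧ (2 ℕ.^ 9) k)) ⟩
          ⟦ 2 ℕ.^ k ⟧ * ⟦ (2 ℕ.^ 9) ℕ.^ k ⟧ * x          ≈⟨ cong (_* x) (sym (⟦*⟧ (2 ℕ.^ k) ((2 ℕ.^ 9) ℕ.^ k))) ⟩
          ⟦ 2 ℕ.^ k ℕ.* (2 ℕ.^ 9) ℕ.^ k ⟧ * x            ≈⟨ cong (λ e → ⟦ 2 ℕ.^ k ℕ.* e ⟧ * x) (ℕP.^-*-assoc 2 9 k) ⟩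
          ⟦ 2 ℕ.^ k ℕ.* 2 ℕ.^ (9 ℕ.* k) ⟧ * x            ≈⟨ cong (λ e → ⟦ e ⟧ * x) (trans (sym (ℕP.^-distribˡ-+-* 2 k (9 ℕ.* k))) (sym M≡)) ⟩
          ⟦ M ⟧ * x                                      ∎

      -- It is enough that z^r ≤ 1/4. One factor 2^n₀ will be spent in Markov's inequality, the
      -- other absorbs the scaling by N.
      damping-small : ⟦ 2 ℕ.^ n₀ ⟧ * (⟦ 2 ℕ.^ n₀ ⟧ * z ^ J) ≲ 1#
      damping-small = begin
        ⟦ 2 ℕ.^ n₀ ⟧ * (⟦ 2 ℕ.^ n₀ ⟧ * z ^ J)    ≈⟨ cong₂ (λ a b → a * (a * b)) (⟦^⟧ 2 n₀) (trans (cong (z ^_) J≡) (sym (^-assocʳ z r n₀))) ⟩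
        ⟦ 2 ⟧ ^ n₀ * (⟦ 2 ⟧ ^ n₀ * (z ^ r) ^ n₀) ≈⟨ trans (cong (⟦ 2 ⟧ ^ n₀ *_) (sym (^-distrib-* ⟦ 2 ⟧ (z ^ r) n₀))) (sym (^-distrib-* ⟦ 2 ⟧ (⟦ 2 ⟧ * z ^ r) n₀)) ⟩
        (⟦ 2 ⟧ * (⟦ 2 ⟧ * z ^ r)) ^ n₀           ≲⟨ ^-upper n₀ (0≲* (⟦⟧-nonneg 2) (0≲* (⟦⟧-nonneg 2) 0≲zʳ)) 4zʳ≲1 ⟩
        1#                                       ∎
        where
        open ≲-Reasoning
        0≲η : 0# ≲ η
        0≲η = ^-nonneg W 0≲1-q
        η≲1 : η ≲ 1#
        η≲1 = ^-upper W 0≲1-q 1-q≲1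
        0≲z : 0# ≲ z
        0≲z = 0≲+ 0≲½ (0≲* 0≲½ 0≲η)
        0≲zʳ : 0# ≲ z ^ r
        0≲zʳ = ^-nonneg r 0≲z
        h = 1- η
        x = ½ * h
        0≲x : 0# ≲ x
        0≲x = 0≲* 0≲½ (1-nonneg η≲1)
        x+z≡1 : x + z ≡ 1#
        x+z≡1 = trans (solve 3 (λ a h e → a :* h :+ (a :+ a :* e) := a :+ a :* (e :+ h)) refl ½ h η)
          (trans (cong (λ s → ½ + ½ * s) (x+1-x η)) (trans (cong (½ +_) (*-identityʳ ½)) ½+½≡1))
        w = ⟦ W ⟧ * q
        -- Bernoulli's inequality and w ≤ 1 give 1 + w = h (1 + w) + η (1 + w) ≤ 2 h + 1: a cell is
        -- hit with probability h ≥ W q / 2.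
        w≲4x : w ≲ ⟦ 4 ⟧ * x
        w≲4x = +-cancelʳ 1# (begin
          w + 1#                              ≈⟨ +-comm _ _ ⟩
          1# + w                              ≈⟨ sym (*-identityˡ _) ⟩
          1# * (1# + w)                       ≈⟨ cong (_* (1# + w)) (sym (x+1-x η)) ⟩
          (η + h) * (1# + w)                  ≈⟨ trans (distribʳ _ _ _) (+-comm _ _) ⟩
          h * (1# + w) + η * (1# + w)         ≲⟨ +-mono (*-monoʳ h (1-nonneg η≲1) (+-monoʳ 1# (mq≲1 W W²≤p))) (bernoulli W (x+1-x q) 0≲q 0≲1-q) ⟩
          h * (1# + 1#) + 1#                  ≈⟨ cong (_+ 1#) (2h≡4½h h) ⟩
          ⟦ 4 ⟧ * x + 1#                      ∎)
          where
          2h≡4½h : ∀ h → h * (1# + 1#) ≡ ⟦ 4 ⟧ * (½ * h)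
          2h≡4½h h = trans (trans (cong (h *_) (trans (cong₂ _+_ (sym ⟦1⟧) (sym ⟦1⟧)) (sym (⟦+⟧ 1 1)))) (sym (*-identityˡ _)))
            (trans (cong (_* (h * ⟦ 2 ⟧)) (sym (invˡ 1)))
            (trans (solve 3 (λ t a h → t :* a :* (h :* t) := t :* t :* (a :* h)) refl ⟦ 2 ⟧ ½ h) (cong (_* (½ * h)) (sym (⟦*⟧ 2 2)))))
        4≲rx : ⟦ 4 ⟧ ≲ ⟦ r ⟧ * x
        4≲rx = ⟦⟧-cancel 3 (begin
          ⟦ 4 ⟧ * ⟦ 4 ⟧              ≈⟨ trans (sym (⟦*⟧ 4 4)) (sym (*-identityʳ _)) ⟩
          ⟦ 16 ⟧ * 1#                ≲⟨ *-monoʳ ⟦ 16 ⟧ (⟦⟧-nonneg 16) (1≲mq m p≤m²) ⟩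
          ⟦ 16 ⟧ * (⟦ m ⟧ * q)       ≈⟨ trans (sym (*-assoc _ _ _)) (cong (_* q) (sym (⟦*⟧ 16 m))) ⟩
          ⟦ 16 ℕ.* m ⟧ * q           ≲⟨ *-monoˡ q 0≲q (⟦⟧-mono 16m≤rW) ⟩
          ⟦ r ℕ.* W ⟧ * q            ≈⟨ trans (cong (_* q) (⟦*⟧ r W)) (*-assoc _ _ _) ⟩
          ⟦ r ⟧ * w                  ≲⟨ *-monoʳ ⟦ r ⟧ (⟦⟧-nonneg r) w≲4x ⟩
          ⟦ r ⟧ * (⟦ 4 ⟧ * x)        ≈⟨ solve 3 (λ r f x → r :* (f :* x) := f :* (r :* x)) refl ⟦ r ⟧ ⟦ 4 ⟧ x ⟩
          ⟦ 4 ⟧ * (⟦ r ⟧ * x)        ∎)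
        4zʳ≲1 : ⟦ 2 ⟧ * (⟦ 2 ⟧ * z ^ r) ≲ 1#
        4zʳ≲1 = begin
          ⟦ 2 ⟧ * (⟦ 2 ⟧ * z ^ r)    ≈⟨ trans (sym (*-assoc _ _ _)) (trans (cong (_* z ^ r) (sym (⟦*⟧ 2 2))) (*-comm _ _)) ⟩
          z ^ r * ⟦ 4 ⟧              ≲⟨ *-monoʳ (z ^ r) 0≲zʳ (≲-trans 4≲rx (x≲y+x 0≲1)) ⟩
          z ^ r * (1# + ⟦ r ⟧ * x)   ≲⟨ bernoulli r x+z≡1 0≲x 0≲z ⟩
          1#                         ∎

    -- Pointwise in u: with at least `n₀` cells hit, the second stage fails with probability at most
    -- 1 / N; otherwise N ≤ 2^n₀ ≤ B 2^(-hits). Averaging the second bound is Markov's inequality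
    -- for `damping`.
    scaled-Pr-noInterval : ∀ N → N ≤ 2 ℕ.^ k → N ≤ 2 ℕ.^ n₀ → ⟦ N ⟧ * Pr noInterval? ≲ ⟦ 2 ⟧
    scaled-Pr-noInterval N N≤2ᵏ N≤2ⁿ = begin
      ⟦ N ⟧ * Pr noInterval?
        ≈⟨ cong (⟦ N ⟧ *_) (E-merge lower (λ A → ind (noInterval? A))) ⟩
      ⟦ N ⟧ * E F
        ≈⟨ sym (E-* ⟦ N ⟧ F) ⟩
      E (λ u → ⟦ N ⟧ * F u)
        ≲⟨ E-mono pointwise ⟩
      E (λ u → 1# + B * eval damping u)
        ≈⟨ trans (E-+ (λ _ → 1#) (λ u → B * eval damping u)) (cong₂ _+_ (E-const p 1#) (trans (E-* B (eval damping)) (cong (B *_) E-damping))) ⟩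
      1# + B * z ^ J
        ≈⟨ cong (1# +_) (*-assoc _ _ _) ⟩
      1# + ⟦ 2 ℕ.^ n₀ ⟧ * (⟦ 2 ℕ.^ n₀ ⟧ * z ^ J)
        ≲⟨ +-monoʳ 1# damping-small ⟩
      1# + 1#
        ≈⟨ trans (cong₂ _+_ (sym ⟦1⟧) (sym ⟦1⟧)) (sym (⟦+⟧ 1 1)) ⟩
      ⟦ 2 ⟧ ∎
      where
      open ≲-Reasoning
      B = ⟦ 2 ℕ.^ n₀ ⟧ * ⟦ 2 ℕ.^ n₀ ⟧
      F : Subset p → Carrier
      F u = E (λ v → ind (noInterval? (merge lower u v)))
      0≲damping : ∀ u → 0# ≲ eval damping u
      0≲damping u = ≲-respʳ (sym (eval-damping u)) (^-nonneg (hits u) 0≲½)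
      ½≲1 : ½ ≲ 1#
      ½≲1 = ≲-respʳ ½+½≡1 (x≲x+y 0≲½)
      pointwise : ∀ u → ⟦ N ⟧ * F u ≲ 1# + B * eval damping u
      pointwise u with ℕP.≤-total n₀ (hits u)
      ... | inj₁ n₀≤ = begin
        ⟦ N ⟧ * F u                                                    ≲⟨ *-mono (⟦⟧-nonneg N) (^-nonneg M (1-nonneg (^-upper k 0≲c (1-upper (^-nonneg (hits u) 0≲1-q))))) (⟦⟧-mono N≤2ᵏ) (E-noInterval u) ⟩
        ⟦ 2 ℕ.^ k ⟧ * (1- ((1- ((1- q) ^ hits u)) ^ k)) ^ M            ≲⟨ no-block-rare (hits u) n₀≤ ⟩
        1#                                                             ≲⟨ x≲x+y (0≲* (0≲* (⟦⟧-nonneg _) (⟦⟧-nonneg _)) (0≲damping u)) ⟩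
        1# + B * eval damping u                                        ∎
        where
        0≲c : 0# ≲ 1- ((1- q) ^ hits u)
        0≲c = 1-nonneg (^-upper (hits u) 0≲1-q 1-q≲1)
      ... | inj₂ ≤n₀ = begin
        ⟦ N ⟧ * F u                                                    ≲⟨ *-mono (⟦⟧-nonneg N) 0≲1 (⟦⟧-mono N≤2ⁿ) (≲-respʳ (E-const p 1#) (E-mono λ v → ind-upper (noInterval? (merge lower u v)))) ⟩
        ⟦ 2 ℕ.^ n₀ ⟧ * 1#                                              ≈⟨ cong (⟦ 2 ℕ.^ n₀ ⟧ *_) (sym 2ⁿ½ⁿ≡1) ⟩
        ⟦ 2 ℕ.^ n₀ ⟧ * (⟦ 2 ℕ.^ n₀ ⟧ * ½ ^ n₀)                         ≈⟨ sym (*-assoc _ _ _) ⟩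
        B * ½ ^ n₀                                                     ≲⟨ *-monoʳ B (0≲* (⟦⟧-nonneg _) (⟦⟧-nonneg _)) (^-antitone 0≲½ ½≲1 ≤n₀) ⟩
        B * ½ ^ hits u                                                 ≈⟨ cong (B *_) (sym (eval-damping u)) ⟩
        B * eval damping u                                             ≲⟨ x≲y+x 0≲1 ⟩
        1# + B * eval damping u                                        ∎
        where
        2ⁿ½ⁿ≡1 : ⟦ 2 ℕ.^ n₀ ⟧ * ½ ^ n₀ ≡ 1#
        2ⁿ½ⁿ≡1 = trans (cong (_* ½ ^ n₀) (⟦^⟧ 2 n₀)) (trans (sym (^-distrib-* ⟦ 2 ⟧ ½ n₀)) (trans (cong (_^ n₀) (invˡ 1)) (1^n≡1 n₀)))

-- Choice of the parameters

subsets : ∀ n → List (Subset n)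
subsets zero    = [] ∷ []
subsets (suc n) = map (true ∷_) (subsets n) ++ map (false ∷_) (subsets n)

subsets-unique : ∀ n → Unique (subsets n)
subsets-unique zero    = [] ∷ []
subsets-unique (suc n) = UniqueP.++⁺ (UniqueP.map⁺ (λ { refl → refl }) (subsets-unique n))
  (UniqueP.map⁺ (λ { refl → refl }) (subsets-unique n)) disjoint
  where
  disjoint : ∀ {A} → A ∈ₗ map (true ∷_) (subsets n) × A ∈ₗ map (false ∷_) (subsets n) → ⊥
  disjoint (A∈ , A∈′) with ∈-map⁻ (true ∷_) A∈ | ∈-map⁻ (false ∷_) A∈′
  ... | _ , _ , refl | _ , _ , ()

module Weights (R : OrderedRing) (q : OrderedRing.Carrier R)
               (0≲q : OrderedRingProperties._≲_ R (OrderedRing.0# R) q)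
               (q≲1 : OrderedRingProperties._≲_ R q (OrderedRing.1# R)) where

  open OrderedRingProperties R
  open Expectation R q 0≲q q≲1

  mass : ∀ {n} → Subset n → Carrier
  mass {n} A = q ^ ∣ A ∣ * (1- q) ^ (n ℕ.∸ ∣ A ∣)

  private
    mass-true : ∀ {n} (A : Subset n) → mass (true ∷ A) ≡ q * mass A
    mass-true A = *-assoc _ _ _

    mass-false : ∀ {n} (A : Subset n) → mass (false ∷ A) ≡ 1- q * mass A
    mass-false {n} A = trans (cong (λ m → q ^ ∣ A ∣ * (1- q) ^ m) (ℕP.+-∸-assoc 1 (∣p∣≤n A)))
      (solve 3 (λ a b c → a :* (b :* c) := b :* (a :* c)) refl (q ^ ∣ A ∣) (1- q) ((1- q) ^ (n ℕ.∸ ∣ A ∣)))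

    sumOver-++ : ∀ {I : Set} (L L′ : List I) f → sumOver (L ++ L′) f ≡ sumOver L f + sumOver L′ f
    sumOver-++ []      L′ f = sym (+-identityˡ _)
    sumOver-++ (i ∷ L) L′ f = trans (cong (f i +_) (sumOver-++ L L′ f)) (sym (+-assoc _ _ _))

    sumOver-scale : ∀ {I J : Set} (g : I → J) (L : List I) {f : J → Carrier} {h : I → Carrier} c →
                    (∀ i → f (g i) ≡ c * h i) → sumOver (map g L) f ≡ c * sumOver L h
    sumOver-scale g []      c eq = sym (zeroʳ c)
    sumOver-scale g (i ∷ L) c eq = trans (cong₂ _+_ (eq i) (sumOver-scale g L c eq)) (sym (distribˡ c _ _))

  -- Links the recursive expectation to the weights of the theorem: the subsets with and without the
  -- head coordinate split off the factors q and 1 - q.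
  E-as-sum : ∀ n (f : Subset n → Carrier) → E f ≡ sumOver (subsets n) (λ A → mass A * f A)
  E-as-sum zero    f = solve 1 (λ x → x := con 1 :* con 1 :* x :+ con 0) refl (f [])
  E-as-sum (suc n) f = sym (trans (sumOver-++ (map (true ∷_) (subsets n)) _ _) (cong₂ _+_
    (trans (sumOver-scale (true ∷_) (subsets n) q λ A → trans (cong (_* f (true ∷ A)) (mass-true A)) (*-assoc _ _ _))
      (cong (q *_) (sym (E-as-sum n (f ∘ (true ∷_))))))
    (trans (sumOver-scale (false ∷_) (subsets n) (1- q) λ A → trans (cong (_* f (false ∷ A)) (mass-false A)) (*-assoc _ _ _))
      (cong (1- q *_) (sym (E-as-sum n (f ∘ (false ∷_))))))))

  mass-filter : ∀ {n} {Q : Subset n → Set} (Q? : Decidable Q) → sumOver (filter Q? (subsets n)) mass ≡ Pr Q?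
  mass-filter {n} Q? = trans (go (subsets n)) (sym (E-as-sum n (λ A → ind (Q? A))))
    where
    go : ∀ L → sumOver (filter Q? L) mass ≡ sumOver L (λ A → mass A * ind (Q? A))
    go [] = refl
    go (A ∷ L) with does (Q? A)
    ... | true  = cong₂ _+_ (sym (*-identityʳ _)) (go L)
    ... | false = trans (go L) (trans (sym (+-identityˡ _)) (cong (_+ sumOver L (λ A → mass A * ind (Q? A))) (sym (zeroʳ _))))

-- Exponential against polynomial growth

n<2^n : ∀ n → n < 2 ℕ.^ n
n<2^n zero    = s≤s z≤n
n<2^n (suc n) = ℕP.+-mono-≤ (ℕP.m^n>0 2 n) (ℕP.≤-trans (n<2^n n) (ℕP.m≤m+n (2 ℕ.^ n) 0))

^-distribʳ-* : ∀ j a b → (a ℕ.* b) ℕ.^ j ≡ a ℕ.^ j ℕ.* b ℕ.^ j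
^-distribʳ-* zero    a b = refl
^-distribʳ-* (suc j) a b = trans (cong (a ℕ.* b ℕ.*_) (^-distribʳ-* j a b)) (swap a b (a ℕ.^ j) (b ℕ.^ j))
  where
  swap : ∀ a b c d → a ℕ.* b ℕ.* (c ℕ.* d) ≡ a ℕ.* c ℕ.* (b ℕ.* d)
  swap = solve-∀

-- 18 comes from the length 9 L with L = 2 (e + 1), and `c₂` is the coefficient that
-- `quadratic-bound` yields for that length. Both stay unevaluated; only their defining equations
-- are exported.
opaque
  18⁷ : ℕ
  18⁷ = 18 ℕ.^ 7

  18⁷≡ : 18 ℕ.^ 7 ≡ 18⁷
  18⁷≡ = refl

  c₂ : ℕ
  c₂ = 100 ℕ.* suc (4 ℕ.* (18 ℕ.* 19))

  c₂≡ : 100 ℕ.* suc (4 ℕ.* (18 ℕ.* 19)) ≡ c₂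
  c₂≡ = refl

-- Since a ≥ 1, every 1 may be raised to a power of a, which makes the expression homogeneous of
-- degree 2.
quadratic-bound : ∀ x w y a → 1 ≤ a →
                  x ℕ.* suc (w ℕ.* (y ℕ.* a ℕ.* suc (y ℕ.* a))) ≤ x ℕ.* suc (w ℕ.* (y ℕ.* suc y)) ℕ.* a ℕ.^ 2
quadratic-bound x w y a 1≤a = begin
  x ℕ.* suc (w ℕ.* (y ℕ.* a ℕ.* suc (y ℕ.* a)))                ≤⟨ ℕP.*-monoʳ-≤ x (ℕP.+-mono-≤ (ℕP.*-mono-≤ 1≤a 1≤a)
                                                                  (ℕP.*-monoʳ-≤ w (ℕP.*-monoʳ-≤ (y ℕ.* a) (ℕP.+-monoˡ-≤ (y ℕ.* a) 1≤a)))) ⟩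
  x ℕ.* (a ℕ.* a ℕ.+ w ℕ.* (y ℕ.* a ℕ.* (a ℕ.+ y ℕ.* a)))      ≡⟨ rearrange x w y a ⟩
  x ℕ.* suc (w ℕ.* (y ℕ.* suc y)) ℕ.* a ℕ.^ 2                  ∎
  where
  open ℕP.≤-Reasoning
  rearrange : ∀ x w y a → x ℕ.* (a ℕ.* a ℕ.+ w ℕ.* (y ℕ.* a ℕ.* (a ℕ.+ y ℕ.* a)))
                        ≡ x ℕ.* suc (w ℕ.* (y ℕ.* suc y)) ℕ.* (a ℕ.* (a ℕ.* 1))
  rearrange = solve-∀

private
  -- Put m = j + 1 and let r be the integer part of e / m. Then e + 1 ≤ m (r + 1) and c m^j ≤ r, so
  -- the left side is at most (r + 1)^m ≤ 2^(r m) ≤ 2^e.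
  power≤exponential : ∀ c j e → c ℕ.* suc j ℕ.^ j ℕ.* suc j ≤ e → c ℕ.* suc e ℕ.^ j ≤ 2 ℕ.^ e
  power≤exponential c j e le = begin
    c ℕ.* suc e ℕ.^ j                         ≤⟨ ℕP.*-monoʳ-≤ c (ℕP.^-monoˡ-≤ j e<) ⟩
    c ℕ.* (m ℕ.* suc r) ℕ.^ j                 ≡⟨ cong (c ℕ.*_) (^-distribʳ-* j m (suc r)) ⟩
    c ℕ.* (m ℕ.^ j ℕ.* suc r ℕ.^ j)           ≡⟨ sym (ℕP.*-assoc c _ _) ⟩
    c ℕ.* m ℕ.^ j ℕ.* suc r ℕ.^ j             ≤⟨ ℕP.*-monoˡ-≤ (suc r ℕ.^ j) (ℕP.≤-trans le′ (ℕP.n≤1+n r)) ⟩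
    suc r ℕ.^ m                               ≤⟨ ℕP.^-monoˡ-≤ m (n<2^n r) ⟩
    (2 ℕ.^ r) ℕ.^ m                           ≡⟨ ℕP.^-*-assoc 2 r m ⟩
    2 ℕ.^ (r ℕ.* m)                           ≤⟨ ℕP.^-monoʳ-≤ 2 (m/n*n≤m e m) ⟩
    2 ℕ.^ e                                   ∎
    where
    open ℕP.≤-Reasoning
    m = suc j
    r = e ℕ./ m
    le′ : c ℕ.* m ℕ.^ j ≤ r
    le′ = subst (_≤ r) (m*n/n≡m (c ℕ.* m ℕ.^ j) m) (/-monoˡ-≤ m le)
    e< : suc e ≤ m ℕ.* suc r
    e< = begin
      suc e                          ≡⟨ cong suc (m≡m%n+[m/n]*n e m) ⟩
      suc (e ℕ.% m) ℕ.+ r ℕ.* m      ≤⟨ ℕP.+-monoˡ-≤ (r ℕ.* m) (m%n<n e m) ⟩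
      m ℕ.+ r ℕ.* m                  ≡⟨ ℕP.*-comm (suc r) m ⟩
      m ℕ.* suc r                    ∎

opaque
  exponential-beats-power : ∀ c j → Σ ℕ λ e₀ → ∀ e → e₀ ≤ e → c ℕ.* suc e ℕ.^ j ≤ 2 ℕ.^ e
  exponential-beats-power c j = c ℕ.* suc j ℕ.^ j ℕ.* suc j , power≤exponential c j

-- Provides a power of 2 within a factor 2 of √p, from which all parameters are built. In the
-- induction e grows only when n reaches 4^(e + 1).
square-bracket : ∀ n .{{_ : NonZero n}} → Σ ℕ λ e → 2 ℕ.^ e ℕ.* 2 ℕ.^ e ≤ n × n < (2 ℕ.* 2 ℕ.^ e) ℕ.* (2 ℕ.* 2 ℕ.^ e)
square-bracket 1 = 0 , s≤s z≤n , s≤s (s≤s z≤n)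
square-bracket (suc (suc n)) with square-bracket (suc n)
... | e , lo , hi with suc (suc n) ℕP.<? (2 ℕ.* 2 ℕ.^ e) ℕ.* (2 ℕ.* 2 ℕ.^ e)
...   | yes lt = e , ℕP.≤-trans lo (ℕP.n≤1+n _) , lt
...   | no ≮ = suc e , ℕP.≮⇒≥ ≮ , ℕP.≤-<-trans hi (ℕP.*-mono-< grow grow)
  where
  grow : 2 ℕ.* 2 ℕ.^ e < 2 ℕ.* (2 ℕ.* 2 ℕ.^ e)
  grow = ℕP.m<m+n (2 ℕ.* 2 ℕ.^ e) (ℕP.≤-trans (ℕP.m^n>0 2 (suc e)) (ℕP.m≤m+n (2 ℕ.* 2 ℕ.^ e) 0))

exponent-bound : ∀ c {p e k} → 1 ≤ e → 2 ℕ.^ e ℕ.* 2 ℕ.^ e ≤ p → k ≤ c ℕ.* suc e → 2 ℕ.^ (1 ℕ.* k) ≤ p ℕ.^ c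
exponent-bound c {p} {e} {k} 1≤e lo k≤ = begin
  2 ℕ.^ (1 ℕ.* k)                ≤⟨ ℕP.^-monoʳ-≤ 2 k≤′ ⟩
  2 ℕ.^ ((e ℕ.+ e) ℕ.* c)        ≡⟨ sym (ℕP.^-*-assoc 2 (e ℕ.+ e) c) ⟩
  (2 ℕ.^ (e ℕ.+ e)) ℕ.^ c        ≡⟨ cong (ℕ._^ c) (ℕP.^-distribˡ-+-* 2 e e) ⟩
  (2 ℕ.^ e ℕ.* 2 ℕ.^ e) ℕ.^ c    ≤⟨ ℕP.^-monoˡ-≤ c lo ⟩
  p ℕ.^ c                        ∎
  where
  open ℕP.≤-Reasoning
  k≤′ : 1 ℕ.* k ≤ (e ℕ.+ e) ℕ.* c
  k≤′ = begin
    1 ℕ.* k               ≡⟨ ℕP.*-identityˡ k ⟩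
    k                     ≤⟨ k≤ ⟩
    c ℕ.* (1 ℕ.+ e)       ≤⟨ ℕP.*-monoʳ-≤ c (ℕP.+-monoˡ-≤ e 1≤e) ⟩
    c ℕ.* (e ℕ.+ e)       ≡⟨ ℕP.*-comm c (e ℕ.+ e) ⟩
    (e ℕ.+ e) ℕ.* c       ∎

Conclusion : (ε : ℚ) (p : ℕ) .{{_ : NonZero p}} → Set
Conclusion ε p = Σ (List (Subset p)) λ L → Unique L × All (GoodEvent p 1 44 18 1) L ×
  _≤√_ p ((1ℚ ℚ.- ε) +√ 0ℚ) (totalWeight p L)

module LargePrime (R : OrderedRing) (p : ℕ) .{{_ : NonZero p}} (pr : Prime p) (is : InverseSqrt R p) (e k g f D : ℕ)
                  (11k+g≡e : 11 ℕ.* k ℕ.+ g ≡ e) (g<11 : g < 11) (7+f≡e : 7 ℕ.+ f ≡ e)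
                  (lo : 2 ℕ.^ e ℕ.* 2 ℕ.^ e ≤ p) (hi : p < (2 ℕ.* 2 ℕ.^ e) ℕ.* (2 ℕ.* 2 ℕ.^ e))
                  (N≤k : 4 ℕ.* suc D ≤ k) (N≤f : 4 ℕ.* suc D ≤ f)
                  (quadratic : c₂ ℕ.* suc e ℕ.^ 2 ≤ 2 ℕ.^ e)
                  (septic : (4 ℕ.* suc D ℕ.* 18⁷) ℕ.* suc e ℕ.^ 7 ≤ 2 ℕ.^ e) where

  private
    -- Each of the two failures will have probability at most 2 / N, together 4 / N = 1 / (D + 1).
    -- `L` is chosen with p < 2^L, and `kᵤ` = 9 L is the length to be excluded.
    N E₂ ℓ L kᵤ : ℕ
    N  = 4 ℕ.* suc D
    E₂ = 2 ℕ.^ e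
    ℓ  = suc e
    L  = ℓ ℕ.+ ℓ
    kᵤ = 3 ℕ.* (3 ℕ.* L)

    kᵤ≡ : kᵤ ≡ 18 ℕ.* ℓ
    kᵤ≡ = eq ℓ
      where
      eq : ∀ a → 3 ℕ.* (3 ℕ.* (a ℕ.+ a)) ≡ 18 ℕ.* a
      eq = solve-∀

    1≤E₂ : 1 ≤ E₂
    1≤E₂ = ℕP.m^n>0 2 e

    E₂≤p : E₂ ≤ p
    E₂≤p = ℕP.≤-trans (ℕP.m≤m*n E₂ E₂ {{ℕ.>-nonZero 1≤E₂}}) lo

    square≤p : ∀ {a} → a ≤ E₂ → a ℕ.* a ≤ p
    square≤p a≤ = ℕP.≤-trans (ℕP.*-mono-≤ a≤ a≤) lo

    Xᵤ≤E₂ : 100 ℕ.* suc (4 ℕ.* (kᵤ ℕ.* suc kᵤ)) ≤ E₂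
    Xᵤ≤E₂ = ℕP.≤-trans (subst (λ z → 100 ℕ.* suc (4 ℕ.* (z ℕ.* suc z)) ≤ c₂ ℕ.* ℓ ℕ.^ 2) (sym kᵤ≡)
      (subst (λ c → 100 ℕ.* suc (4 ℕ.* (18 ℕ.* ℓ ℕ.* suc (18 ℕ.* ℓ))) ≤ c ℕ.* ℓ ℕ.^ 2) c₂≡ (quadratic-bound 100 4 18 ℓ (s≤s z≤n)))) quadratic

    kᵤ≤p : kᵤ ≤ p
    kᵤ≤p = begin
      kᵤ                                        ≤⟨ ℕP.m≤m*n kᵤ (suc kᵤ) ⟩
      kᵤ ℕ.* suc kᵤ                             ≤⟨ ℕP.m≤n*m (kᵤ ℕ.* suc kᵤ) 4 ⟩
      4 ℕ.* (kᵤ ℕ.* suc kᵤ)                     ≤⟨ ℕP.n≤1+n _ ⟩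
      suc (4 ℕ.* (kᵤ ℕ.* suc kᵤ))               ≤⟨ ℕP.m≤n*m (suc (4 ℕ.* (kᵤ ℕ.* suc kᵤ))) 100 ⟩
      100 ℕ.* suc (4 ℕ.* (kᵤ ℕ.* suc kᵤ))       ≤⟨ Xᵤ≤E₂ ⟩
      E₂                                        ≤⟨ E₂≤p ⟩
      p                                         ∎
      where open ℕP.≤-Reasoning

    Nkᵤ⁷≤E₂ : N ℕ.* kᵤ ℕ.^ 7 ≤ E₂
    Nkᵤ⁷≤E₂ = subst (_≤ E₂) (trans (ℕP.*-assoc N 18⁷ (ℓ ℕ.^ 7))
      (cong (N ℕ.*_) (trans (cong (ℕ._* ℓ ℕ.^ 7) (sym 18⁷≡)) (trans (sym (^-distribʳ-* 7 18 ℓ)) (cong (ℕ._^ 7) (sym kᵤ≡)))))) septic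

    p≤2^L : p ≤ 2 ℕ.^ L
    p≤2^L = ℕP.≤-trans (ℕP.<⇒≤ hi) (ℕP.≤-reflexive (sym (ℕP.^-distribˡ-+-* 2 ℓ ℓ)))

    1≤k : 1 ≤ k
    1≤k = ℕP.≤-trans (s≤s z≤n) N≤k

    k≤e : k ≤ e
    k≤e = ℕP.≤-trans (ℕP.m≤n*m k 11) (ℕP.≤-trans (ℕP.m≤m+n _ g) (ℕP.≤-reflexive 11k+g≡e))

    N≤p : N ≤ p
    N≤p = ℕP.≤-trans N≤k (ℕP.≤-trans k≤e (ℕP.≤-trans (ℕP.<⇒≤ (n<2^n e)) E₂≤p))

    -- W = M 2^k has room for `M` intervals of length k < 2^k. The factor 2^g lost by rounding is
    -- returned in `r`, so that W 2^g = 2^e. Then r W = 32 · 2^e = 16 m, where m = 2 · 2^e > √p, and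
    -- n₀ = 2^e / 128 makes 4 W J = 4^e ≤ p and m = 256 n₀.
    W M n₀ r J m : ℕ
    W  = 2 ℕ.^ (11 ℕ.* k)
    M  = 2 ℕ.^ (10 ℕ.* k)
    n₀ = 2 ℕ.^ f
    r  = 32 ℕ.* 2 ℕ.^ g
    J  = r ℕ.* n₀
    m  = 2 ℕ.* E₂

    W*2^g : W ℕ.* 2 ℕ.^ g ≡ E₂
    W*2^g = trans (sym (ℕP.^-distribˡ-+-* 2 (11 ℕ.* k) g)) (cong (2 ℕ.^_) 11k+g≡e)

    128n₀ : 128 ℕ.* n₀ ≡ E₂
    128n₀ = trans (sym (ℕP.^-distribˡ-+-* 2 7 f)) (cong (2 ℕ.^_) 7+f≡e)

    fits : 2 ℕ.* W ℕ.* J ℕ.+ 2 ℕ.* W ℕ.* J ≤ p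
    fits = ℕP.≤-trans (ℕP.≤-reflexive (trans (eq W (2 ℕ.^ g) n₀) (cong₂ ℕ._*_ 128n₀ W*2^g))) lo
      where
      eq : ∀ w g n → 2 ℕ.* w ℕ.* (32 ℕ.* g ℕ.* n) ℕ.+ 2 ℕ.* w ℕ.* (32 ℕ.* g ℕ.* n) ≡ 128 ℕ.* n ℕ.* (w ℕ.* g)
      eq = solve-∀

    Mk≤W : M ℕ.* k ≤ W
    Mk≤W = ℕP.≤-trans (ℕP.*-monoʳ-≤ M (ℕP.<⇒≤ (n<2^n k))) (ℕP.≤-reflexive
      (trans (sym (ℕP.^-distribˡ-+-* 2 (10 ℕ.* k) k)) (cong (2 ℕ.^_) (ℕP.+-comm (10 ℕ.* k) k))))

    W≤E₂ : W ≤ E₂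
    W≤E₂ = ℕP.^-monoʳ-≤ 2 (ℕP.≤-trans (ℕP.m≤m+n _ g) (ℕP.≤-reflexive 11k+g≡e))

    16m≤rW : 16 ℕ.* m ≤ r ℕ.* W
    16m≤rW = ℕP.≤-reflexive (trans (cong (λ z → 16 ℕ.* (2 ℕ.* z)) (sym W*2^g)) (eq W (2 ℕ.^ g)))
      where
      eq : ∀ w g → 16 ℕ.* (2 ℕ.* (w ℕ.* g)) ≡ 32 ℕ.* g ℕ.* w
      eq = solve-∀

    m≤256n₀ : m ≤ 256 ℕ.* n₀
    m≤256n₀ = ℕP.≤-reflexive (trans (cong (2 ℕ.*_) (sym 128n₀)) (sym (ℕP.*-assoc 2 128 n₀)))

    1≤e : 1 ≤ e
    1≤e = ℕP.≤-trans 1≤k k≤e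

    1<p : 1 < p
    1<p = ℕP.≤-trans (ℕP.^-monoʳ-≤ 2 1≤e) E₂≤p

  open OrderedRingProperties R
  open InverseSqrtProperties R is
  open Expectation R q 0≲q q≲1
  open Residues p
  open ManyProgressions R p pr is kᵤ kᵤ≤p (square≤p Xᵤ≤E₂)
    using (LongProgression; longProgression?; longProgression⁺; scaled-Pr-longProgression)
  open ManyIntervals R p is W J n₀ r k M m (ℕP.m^n>0 2 (11 ℕ.* k)) fits Mk≤W
    using (NoInterval; noInterval?; interval?; module Estimate)
  open Estimate refl refl (square≤p W≤E₂) (ℕP.<⇒≤ hi) 16m≤rW m≤256n₀ using (scaled-Pr-noInterval)

  Good : Subset p → Set
  Good A = ¬ NoInterval A × ¬ LongProgression A

  good? : Decidable Good
  good? A = ¬? (noInterval? A) ×-dec ¬? (longProgression? A)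

  -- 44 arises from p < 2^(2 (e + 1)) and e + 1 ≤ 22 k, the latter because e = 11 k + g with g < 11
  -- and k ≥ 1. 18 arises from the excluded length 18 (e + 1), as p ≥ 2^(2 e) and e + 1 ≤ 2 e.
  good⇒GoodEvent : ∀ {A} → Good A → GoodEvent p 1 44 18 1 A
  good⇒GoodEvent {A} (some , none) = (k , p¹≤ , hasAP) , short
    where
    p¹≤ : p ℕ.^ 1 ≤ 2 ℕ.^ (44 ℕ.* k)
    p¹≤ = ℕP.≤-trans (ℕP.≤-reflexive (ℕP.*-identityʳ p)) (ℕP.≤-trans p≤2^L (ℕP.^-monoʳ-≤ 2 (begin
      ℓ ℕ.+ ℓ                              ≤⟨ ℕP.+-mono-≤ ℓ≤ ℓ≤ ⟩
      22 ℕ.* k ℕ.+ 22 ℕ.* k                ≡⟨ sym (ℕP.*-distribʳ-+ k 22 22) ⟩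
      44 ℕ.* k                             ∎)))
      where
      open ℕP.≤-Reasoning
      ℓ≤ : ℓ ≤ 22 ℕ.* k
      ℓ≤ = begin
        suc e                    ≡⟨ cong suc (sym 11k+g≡e) ⟩
        suc (11 ℕ.* k ℕ.+ g)     ≡⟨ sym (ℕP.+-suc (11 ℕ.* k) g) ⟩
        11 ℕ.* k ℕ.+ suc g       ≤⟨ ℕP.+-monoʳ-≤ (11 ℕ.* k) (ℕP.≤-trans g<11 (ℕP.*-monoʳ-≤ 11 1≤k)) ⟩
        11 ℕ.* k ℕ.+ 11 ℕ.* k    ≡⟨ sym (ℕP.*-distribʳ-+ k 11 11) ⟩
        22 ℕ.* k                 ∎
    hasAP : HasAP p (SumSet p A) k
    hasAP with find (AllP.¬All⇒Any¬ (¬? ∘ interval? A) (upTo M) some)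
    ... | i , _ , ¬¬interval = [_]ₚ p (i ℕ.* k) , [_]ₚ p 1 , (λ eq → ℕP.1+n≢0 (trans (sym (toℕ-[]-small 1<p)) eq)) ,
      λ x x<k → subst (SumSet p A) (sym (term x)) (All.lookup (decidable-stable (interval? A i) ¬¬interval) (∈-upTo⁺ x<k))
      where
      term : ∀ x → apTerm p ([_]ₚ p (i ℕ.* k)) ([_]ₚ p 1) x ≡ [_]ₚ p (i ℕ.* k ℕ.+ x)
      term x = trans ([[m]+n] (i ℕ.* k) (x ℕ.* toℕ ([_]ₚ p 1)))
        (cong (λ z → [_]ₚ p (i ℕ.* k ℕ.+ z)) (trans (cong (x ℕ.*_) (toℕ-[]-small 1<p)) (ℕP.*-identityʳ x)))
    short : ∀ k′ → HasAP p (SumSet p A) k′ → 2 ℕ.^ (1 ℕ.* k′) ≤ p ℕ.^ 18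
    short k′ (b , d , d≢0 , terms) = case kᵤ ℕP.≤? k′ of λ where
      (yes kᵤ≤k′) → ⊥-elim (none (longProgression⁺ A (b , d , d≢0 , λ i i<kᵤ → terms i (ℕP.<-≤-trans i<kᵤ kᵤ≤k′))))
      (no kᵤ≰k′) → exponent-bound 18 1≤e lo (ℕP.≤-trans (ℕP.<⇒≤ (ℕP.≰⇒> kᵤ≰k′)) (ℕP.≤-reflexive kᵤ≡))

  Pr-good : 1# ≲ Pr good? + inv D
  Pr-good = begin
    1#                               ≈⟨ sym (E-const p 1#) ⟩
    Pr always?                       ≲⟨ Pr-⊎ always? good? bad? (λ A _ → dichotomy A) ⟩
    Pr good? + Pr bad?               ≲⟨ +-monoʳ (Pr good?) bad≲ ⟩
    Pr good? + inv D                 ∎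
    where
    open ≲-Reasoning
    always? : Decidable {A = Subset p} (λ _ → ⊤)
    always? _ = yes tt
    bad? : Decidable (λ A → NoInterval A ⊎ LongProgression A)
    bad? A = noInterval? A ⊎-dec longProgression? A
    dichotomy : ∀ A → Good A ⊎ (NoInterval A ⊎ LongProgression A)
    dichotomy A with noInterval? A | longProgression? A
    ... | yes h | _     = inj₂ (inj₁ h)
    ... | no _  | yes h = inj₂ (inj₂ h)
    ... | no h  | no h′ = inj₁ (h , h′)
    bad≲ : Pr bad? ≲ inv D
    bad≲ = ⟦⟧-cancel D (⟦⟧-cancel 3 (begin
      ⟦ 4 ⟧ * (⟦ suc D ⟧ * Pr bad?)                            ≈⟨ trans (sym (*-assoc _ _ _)) (cong (_* Pr bad?) (sym (⟦*⟧ 4 (suc D)))) ⟩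
      ⟦ N ⟧ * Pr bad?                                          ≲⟨ *-monoʳ ⟦ N ⟧ (⟦⟧-nonneg N) (Pr-⊎ bad? noInterval? longProgression? (λ _ h → h)) ⟩
      ⟦ N ⟧ * (Pr noInterval? + Pr longProgression?)           ≈⟨ distribˡ _ _ _ ⟩
      ⟦ N ⟧ * Pr noInterval? + ⟦ N ⟧ * Pr longProgression?     ≲⟨ +-mono
          (scaled-Pr-noInterval N (ℕP.≤-trans N≤k (ℕP.<⇒≤ (n<2^n k))) (ℕP.≤-trans N≤f (ℕP.≤-trans (ℕP.<⇒≤ (n<2^n f)) (ℕP.<⇒≤ (n<2^n n₀)))))
          (scaled-Pr-longProgression N L refl p≤2^L N≤p (square≤p Nkᵤ⁷≤E₂)) ⟩
      ⟦ 2 ⟧ + ⟦ 2 ⟧                                            ≈⟨ trans (sym (⟦+⟧ 2 2)) (sym (*-identityʳ _)) ⟩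
      ⟦ 4 ⟧ * 1#                                               ≈⟨ cong (⟦ 4 ⟧ *_) (sym (invˡ D)) ⟩
      ⟦ 4 ⟧ * (⟦ suc D ⟧ * inv D)                              ∎))

  -- `heavy` is the passage from `E` to the weights of the theorem; as a hypothesis it keeps the
  -- argument over an arbitrary ordered ring.
  conclusion : ∀ {ε} →
    (∀ {Q : Subset p → Set} (Q? : Decidable Q) → 1# ≲ Pr Q? + inv D →
      _≤√_ p ((1ℚ ℚ.- ε) +√ 0ℚ) (totalWeight p (filter Q? (subsets p)))) → Conclusion ε p
  conclusion heavy = filter good? (subsets p) , UniqueP.filter⁺ good? (subsets-unique p) ,
    All.map good⇒GoodEvent (AllP.all-filter good? (subsets p)) , heavy good? Pr-good

-- Return to the weights in ℚ(√p)

module TotalWeight (p : ℕ) .{{_ : NonZero p}} where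

  open InverseSqrt√ p using (q≡; inv≡)
  open OrderedRingProperties ℚ[√ p ]
  open InverseSqrtProperties ℚ[√ p ] (InverseSqrt√.inverseSqrt p)
  open Expectation ℚ[√ p ] q 0≲q q≲1
  open Weights ℚ[√ p ] q 0≲q q≲1

  private
    pow√≡ : ∀ z j → pow√ p z j ≡ z ^ j
    pow√≡ z zero    = refl
    pow√≡ z (suc j) = cong (_⊗_ p z) (pow√≡ z j)

    1-q≡ : 1-qₚ p ≡ 1- q
    1-q≡ = trans (cong₂ _+√_ refl (sym (ℚP.+-identityˡ _))) (cong 1-_ (sym q≡))

    weight≡ : ∀ A → weight p A ≡ mass A
    weight≡ A = cong₂ (_⊗_ p) (trans (cong (λ z → pow√ p z ∣ A ∣) (sym q≡)) (pow√≡ q ∣ A ∣)) (trans (cong (λ z → pow√ p z (p ℕ.∸ ∣ A ∣)) 1-q≡) (pow√≡ (1- q) (p ℕ.∸ ∣ A ∣)))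

    totalWeight≡ : ∀ As → totalWeight p As ≡ sumOver As mass
    totalWeight≡ []       = refl
    totalWeight≡ (A ∷ As) = cong₂ (_⊕_ p) (weight≡ A) (totalWeight≡ As)

  totalWeight-filter : ∀ {Q : Subset p → Set} (Q? : Decidable Q) → totalWeight p (filter Q? (subsets p)) ≡ Pr Q?
  totalWeight-filter Q? = trans (totalWeight≡ (filter Q? (subsets p))) (mass-filter Q?)

  private
    open +-*-Solver using () renaming (solve to solveℚ; _:=_ to _:≡_; _:+_ to _:⊹_; _:-_ to _:∸_; :-_ to :∸_; con to conℚ)

    inv≲ε : ∀ D {ε} → (ℤ.+ 1 ℚ./ suc D) ℚ.≤ ε → inv D ≲ (ε +√ 0ℚ)
    inv≲ε D {ε} ≤ε = ≲-respˡ (sym (inv≡ D)) (gap ((ε ℚ.- i) +√ 0ℚ)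
      (inj₁ (subst (ℚ._≤ ε ℚ.- i) (ℚP.+-inverseʳ i) (ℚP.+-monoˡ-≤ (ℚ.- i) ≤ε) , ℚP.≤-refl))
      (cong₂ _+√_ (solveℚ 2 (λ i ε → i :⊹ (ε :∸ i) :≡ ε) refl i ε) (ℚP.+-identityˡ 0ℚ)))
      where
      i : ℚ
      i = ℤ.+ 1 ℚ./ suc D

    -- The difference stored in the hypothesis is already z - (1 - ε), the element whose
    -- nonnegativity is claimed.
    ≲⇒≤√ : ∀ {ε} z → 1# ≲ _⊕_ p z (ε +√ 0ℚ) → _≤√_ p ((1ℚ ℚ.- ε) +√ 0ℚ) z
    ≲⇒≤√ {ε} (x +√ y) (gap (c +√ d) nn eq) = subst (Nonneg√ p) (cong₂ _+√_
      (trans (solveℚ 1 (λ c → c :≡ (conℚ 1ℚ :⊹ c) :∸ conℚ 1ℚ) refl c) (trans (cong (ℚ._- 1ℚ) (cong re eq))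
        (solveℚ 2 (λ x ε → (x :⊹ ε) :∸ conℚ 1ℚ :≡ x :⊹ (:∸ (conℚ 1ℚ :∸ ε))) refl x ε)))
      (trans (solveℚ 1 (λ d → d :≡ conℚ 0ℚ :⊹ d) refl d) (cong im eq))) nn

  totalWeight-≥ : ∀ D {ε} → (ℤ.+ 1 ℚ./ suc D) ℚ.≤ ε → ∀ {Q : Subset p → Set} (Q? : Decidable Q) → 1# ≲ Pr Q? + inv D →
                  _≤√_ p ((1ℚ ℚ.- ε) +√ 0ℚ) (totalWeight p (filter Q? (subsets p)))
  totalWeight-≥ D {ε} ≤ε Q? le = subst (_≤√_ p ((1ℚ ℚ.- ε) +√ 0ℚ)) (sym (totalWeight-filter Q?))
    (≲⇒≤√ (Pr Q?) (≲-trans le (+-monoʳ (Pr Q?) (inv≲ε D ≤ε))))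

opaque
  -- A sum, so that it dominates every lower bound required of e. With N = 4 (D + 1), the part 11 N
  -- + 7 yields N ≤ e / 11 and N ≤ e - 7.
  threshold : ℕ → ℕ
  threshold D = 11 ℕ.* (4 ℕ.* suc D) ℕ.+ 7 ℕ.+ proj₁ (exponential-beats-power c₂ 2) ℕ.+
                proj₁ (exponential-beats-power (4 ℕ.* suc D ℕ.* 18⁷) 7)

  threshold-linear : ∀ D → 11 ℕ.* (4 ℕ.* suc D) ℕ.+ 7 ≤ threshold D
  threshold-linear D = ℕP.≤-trans (ℕP.m≤m+n _ _) (ℕP.m≤m+n _ _)

  threshold-quadratic : ∀ D e → threshold D ≤ e → c₂ ℕ.* suc e ℕ.^ 2 ≤ 2 ℕ.^ e
  threshold-quadratic D e le = proj₂ (exponential-beats-power c₂ 2) e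
    (ℕP.≤-trans (ℕP.≤-trans (ℕP.m≤n+m _ (11 ℕ.* (4 ℕ.* suc D) ℕ.+ 7)) (ℕP.m≤m+n _ _)) le)

  threshold-septic : ∀ D e → threshold D ≤ e → (4 ℕ.* suc D ℕ.* 18⁷) ℕ.* suc e ℕ.^ 7 ≤ 2 ℕ.^ e
  threshold-septic D e le = proj₂ (exponential-beats-power (4 ℕ.* suc D ℕ.* 18⁷) 7) e (ℕP.≤-trans (ℕP.m≤n+m _ _) le)

private
  bracketed : ∀ D p .{{_ : NonZero p}} (pr : Prime p) {ε} → (ℤ.+ 1 ℚ./ suc D) ℚ.≤ ε → ∀ e → threshold D ≤ e →
              2 ℕ.^ e ℕ.* 2 ℕ.^ e ≤ p → p < (2 ℕ.* 2 ℕ.^ e) ℕ.* (2 ℕ.* 2 ℕ.^ e) → Conclusion ε p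
  bracketed D p pr {ε} ≤ε e thr≤e lo hi =
    LargePrime.conclusion ℚ[√ p ] p pr (InverseSqrt√.inverseSqrt p) e (e ℕ./ 11) (e ℕ.% 11) (e ℕ.∸ 7) D
      11k+g≡e (m%n<n e 11) (ℕP.m+[n∸m]≡n 7≤e) lo hi N≤k N≤f (threshold-quadratic D e thr≤e) (threshold-septic D e thr≤e)
      {ε} (TotalWeight.totalWeight-≥ p D ≤ε)
    where
    N : ℕ
    N = 4 ℕ.* suc D
    11k+g≡e : 11 ℕ.* (e ℕ./ 11) ℕ.+ e ℕ.% 11 ≡ e
    11k+g≡e = trans (ℕP.+-comm (11 ℕ.* (e ℕ./ 11)) (e ℕ.% 11))
      (trans (cong (e ℕ.% 11 ℕ.+_) (ℕP.*-comm 11 (e ℕ./ 11))) (sym (m≡m%n+[m/n]*n e 11)))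
    11N+7≤e : 11 ℕ.* N ℕ.+ 7 ≤ e
    11N+7≤e = ℕP.≤-trans (threshold-linear D) thr≤e
    N≤k : N ≤ e ℕ./ 11
    N≤k = subst (_≤ e ℕ./ 11) (m*n/n≡m N 11) (/-monoˡ-≤ 11 (ℕP.≤-trans (ℕP.≤-trans (ℕP.≤-reflexive (ℕP.*-comm N 11)) (ℕP.m≤m+n _ 7)) 11N+7≤e))
    7≤e : 7 ≤ e
    7≤e = ℕP.≤-trans (ℕP.m≤n+m 7 (11 ℕ.* N)) 11N+7≤e
    N≤f : N ≤ e ℕ.∸ 7
    N≤f = ℕP.≤-trans (ℕP.≤-trans (ℕP.m≤n*m N 11) (ℕP.≤-reflexive (sym (ℕP.m+n∸n≡m (11 ℕ.* N) 7)))) (ℕP.∸-monoˡ-≤ 7 11N+7≤e)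

  large : ∀ D p .{{_ : NonZero p}} (pr : Prime p) {ε} → (ℤ.+ 1 ℚ./ suc D) ℚ.≤ ε →
          2 ℕ.^ threshold D ℕ.* 2 ℕ.^ threshold D ≤ p → Conclusion ε p
  large D p pr ≤ε thr = let e , lo , hi = square-bracket p in
    bracketed D p pr ≤ε e
      -- For e below the threshold, the upper end of the bracket would not exceed the assumed lower
      -- bound for p.
      (ℕP.≮⇒≥ λ e<thr → ℕP.<⇒≱ hi (ℕP.≤-trans (ℕP.*-mono-≤ (ℕP.^-monoʳ-≤ 2 e<thr) (ℕP.^-monoʳ-≤ 2 e<thr)) thr)) lo hi

  -- A positive rational is at least the reciprocal of its denominator, which `mkℚ` stores
  -- diminished by 1, just as `D` is used.
  eventually : ∀ ε → 0ℚ ℚ.< ε → Σ ℕ λ N → (p : ℕ) (pr : Prime p) → N ≤ p → Conclusion ε p {{prime⇒nonZero pr}}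
  eventually ε@(mkℚ (ℤ.+ suc a) d _) _ = 2 ℕ.^ threshold d ℕ.* 2 ℕ.^ threshold d , λ p pr → large d p {{prime⇒nonZero pr}} pr 1/d≤ε
    where
    1/d≤ε : (ℤ.+ 1 ℚ./ suc d) ℚ.≤ ε
    1/d≤ε = ℚP.toℚᵘ-cancel-≤ (ℚᵘP.≤-trans (ℚᵘP.≤-reflexive (ℚP.toℚᵘ-fromℚᵘ (ℚᵘ.mkℚᵘ (ℤ.+ 1) d)))
      (ℚᵘ.*≤* (ℤP.*-monoʳ-≤-nonNeg (ℤ.+ suc d) (ℤ.+≤+ (s≤s (z≤n {a}))))))
  eventually ε@(mkℚ (ℤ.+ zero) _ _) 0<ε = ⊥-elim (ℤ.Positive.pos (ℚ.positive {ε} 0<ε))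
  eventually ε@(mkℚ ℤ.-[1+ _ ] _ _) 0<ε = ⊥-elim (ℤ.Positive.pos (ℚ.positive {ε} 0<ε))

theorem1p8 : Σ ℕ λ a₁ → Σ ℕ λ b₁ → Σ ℕ λ a₂ → Σ ℕ λ b₂ →
    (0 < a₁ × 0 < b₁ × 0 < a₂ × 0 < b₂) ×
    ((ε : ℚ) → 0ℚ ℚ.< ε → Σ ℕ λ N → (p : ℕ) → (pr : Prime p) → N ≤ p →
    Σ (List (Subset p)) λ L →
    Unique L ×
    All (GoodEvent p {{prime⇒nonZero pr}} a₁ b₁ a₂ b₂) L ×
    _≤√_ p ((1ℚ ℚ.- ε) +√ 0ℚ) (totalWeight p {{prime⇒nonZero pr}} L))
theorem1p8 = 1 , 44 , 18 , 1 , (s≤s z≤n , s≤s z≤n , s≤s z≤n , s≤s z≤n) , eventually
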